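{- For each positive integer $t$, \[\liminf_{n\to\infty}\frac{\mathrm{ex}(n,\{C_3,K_{2,2t+1}\})}{z(n,K_{2,2t+1})}\ge\frac{t+1}{\sqrt{t(t+2)}}.\]
   Context: $\mathrm{ex}(n,\mathcal{H})$ is the maximum number of edges in an $n$-vertex graph containing no member of $\mathcal{H}$ as a subgraph; $z(n,H)$ is the maximum number of edges in an $n$-vertex bipartite graph containing no copy of $H$. $C_3$ is the triangle and $K_{2,2t+1}$ the complete bipartite graph with parts of sizes $2$ and $2t+1$. -}

module Defs where

open import Data.Nat.Base using (ℕ; zero; suc; _+_; _⊔_; _<ᵇ_; _≡ᵇ_)
open import Data.Bool.Base using (Bool; true; false; not; _∧_; _∨_; _xor_; if_then_else_)
open import Data.Fin.Base using (Fin; toℕ)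
open import Data.List.Base using (List; []; _∷_; map; concatMap; allFin; foldr)
open import Data.Bool.ListAction using (all; any)
open import Data.Nat.ListAction using (sum)
open import Data.Product.Base using (Σ; _,_)
import Data.Vec.Functional as VF

-- A labelled graph on vertex set Fin n is given by a Boolean function;
-- only the values G i j with i < j matter (simple, loopless, undirected).
Graph : ℕ → Set
Graph n = Fin n → Fin n → Bool

adj : ∀ {n} → Graph n → Fin n → Fin n → Bool
adj G i j = if toℕ i <ᵇ toℕ j then G i j
            else (if toℕ j <ᵇ toℕ i then G j i else false)

allV : ∀ {n} → (Fin n → Bool) → Bool
allV {n} p = all p (allFin n)

anyV : ∀ {n} → (Fin n → Bool) → Bool
anyV {n} p = any p (allFin n)

edges : ∀ {n} → Graph n → ℕ
edges {n} G = sum (map (λ i → sum (map (λ j →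
  if (toℕ i <ᵇ toℕ j) ∧ adj G i j then 1 else 0) (allFin n))) (allFin n))

allFuns : ∀ {A : Set} (k : ℕ) → List A → List (Fin k → A)
allFuns zero xs = (λ ()) ∷ []
allFuns (suc k) xs = concatMap (λ x → map (λ f → x VF.∷ f) (allFuns k xs)) xs

allGraphs : (n : ℕ) → List (Graph n)
allGraphs n = allFuns n (allFuns n (true ∷ false ∷ []))

injᵇ : ∀ {h n} → (Fin h → Fin n) → Bool
injᵇ f = allV (λ i → allV (λ j →
  (toℕ i ≡ᵇ toℕ j) ∨ not (toℕ (f i) ≡ᵇ toℕ (f j))))

contains : ∀ {n h} → Graph n → Graph h → Bool
contains {n} {h} G H = any (λ f → injᵇ f ∧
  allV (λ i → allV (λ j → not (adj H i j) ∨ adj G (f i) (f j))))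
  (allFuns h (allFin n))

Family : Set
Family = List (Σ ℕ Graph)

containsSome : ∀ {n} → Graph n → Family → Bool
containsSome G Hs = any (λ { (h , H) → contains G H }) Hs

maxList : List ℕ → ℕ
maxList = foldr _⊔_ 0

ex : ℕ → Family → ℕ
ex n Hs = maxList (map (λ G → if containsSome G Hs then 0 else edges G) (allGraphs n))

bipartite : ∀ {n} → Graph n → Bool
bipartite {n} G = any (λ c → allV (λ i → allV (λ j → not (adj G i j) ∨ (c i xor c j))))
  (allFuns n (true ∷ false ∷ []))

z : ∀ {h} → ℕ → Graph h → ℕ
z n H = maxList (map (λ G → if bipartite G ∧ not (contains G H) then edges G else 0) (allGraphs n))

C3 : Graph 3
C3 _ _ = true

K2 : (s : ℕ) → Graph (2 + s)
K2 s i j = (toℕ i <ᵇ 2) xor (toℕ j <ᵇ 2)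

{-# OPTIONS --safe #-}
-- Upper bound: double counting paths of length two from both colour classes of a bipartite K_{2,2t+1}-free
-- graph with e edges gives 4e² ≤ t n³ + 2 n e.  Lower bound: for a prime q take t + 2 copies of (ℤ/q)², and join
-- (i , a , b) to (k , a′ , b′), i ≠ k, when (k − i)(b′ − b) = (a′ − a)² + ν (k − i)⁴.  Two vertices of the same copy
-- have at most one common neighbour in each other copy (a linear equation), two vertices of different copies have
-- at most two (a quadratic one), so no pair has more than 2t; a triangle would make 3ν a square, which fails for
-- suitable ν.  As (t + 2) q² should be close to n for every n, one needs that the ratio of consecutive primes
-- tends to 1.  This follows from Selberg's formula by an argument of Erdős: if (x , x + x/k] contains no prime, then
-- by Selberg's formula (x/p , (x + x/k)/p] has about twice the expected number of primes for most p, and applying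
-- this twice shows that the density is about twice the expected one on a whole interval [n , 64 n], contradicting
-- Chebyshev's upper bound for ψ.
module Submission where

open import Defs
open import Level using (0ℓ)
open import Algebra.Bundles using (CommutativeMonoid)
open import Data.Bool.Base as Bool using (Bool; true; false; if_then_else_; not; _∧_; _∨_; _xor_)
open import Data.Bool.Properties using (∧-zeroʳ; ∨-zeroʳ; xor-comm)
import Data.Bool.ListAction as List
open import Data.Empty using (⊥; ⊥-elim)
open import Data.Fin.Base as Fin using (Fin; toℕ)
import Data.Fin.Properties as Finₚ
open import Data.Integer.Base as ℤ using (ℤ; +_; ∣_∣)
import Data.Integer.DivMod as ℤ
open import Data.Integer.Divisibility.Signed as ℤ∣ using () renaming (_∣_ to _∣ℤ_; _∣?_ to _∣ℤ?_; divides to dividesℤ)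
import Data.Integer.Properties as ℤₚ
import Data.Integer.Tactic.RingSolver as ℤ-Ring
open import Data.List.Base using (List; []; _∷_; map; allFin; tabulate)
open import Data.List.Membership.Propositional using (_∈_)
open import Data.List.Membership.Propositional.Properties using (∈-map⁺; ∈-map⁻; ∈-concat⁺′; ∈-allFin)
open import Data.List.Properties using (map-tabulate)
open import Data.List.Relation.Unary.All as All using (All)
open import Data.List.Relation.Unary.Any using (here; there)
open import Data.Nat.Base using (ℕ; zero; suc; _+_; _*_; _∸_; _^_; _/_; _≤_; _<_; z≤n; s≤s; NonZero; >-nonZero; NonTrivial; _<ᵇ_; _≡ᵇ_)
open import Data.Nat.Coprimality using (prime⇒coprime; coprime-Bézout)
open import Data.Nat.DivMod using (m/n*n≤m; m/n≤m; m≡m%n+[m/n]*n; m%n<n)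
open import Data.Nat.Divisibility using (_∣_; _∣?_; divides; ∣⇒≤; m∣m*n; n∣m*n; ∣-trans; ∣-refl; *-monoʳ-∣; *-cancelˡ-∣; ∣1⇒≡1; m*n∣⇒m∣; ∣n⇒∣m*n)
open import Data.Nat.GCD using (module Bézout)
open import Data.Nat.Induction using (<-rec)
import Data.Nat.ListAction as List
open import Data.Nat.ListAction using (product)
open import Data.Nat.Primality using (Prime; prime?; euclidsLemma; prime⇒irreducible; prime⇒nonZero; prime⇒nonTrivial)
open import Data.Nat.Primality.Factorisation using (factorise; module PrimeFactorisation)
open import Data.Nat.Properties
open import Data.Nat.Tactic.RingSolver using (solve; solve-∀)
open import Data.Product.Base using (Σ; ∃-syntax; _×_; _,_; proj₁; proj₂)
open import Data.Sum.Base using (_⊎_; inj₁; inj₂)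
import Data.Vec.Functional as VF
open import Function.Base using (_∘_; case_of_)
open import Relation.Binary.PropositionalEquality using (_≡_; _≢_; refl; sym; trans; cong; cong₂; subst; module ≡-Reasoning)
open import Relation.Nullary using (¬_; Dec; yes; no; does)
open import Relation.Nullary.Decidable using (dec-true)
open import Algebra.Properties.Semiring.Sum +-*-semiring using (∑-distrib-+; ∑-comm; *-distribˡ-sum; *-distribʳ-sum; sum-cong-≗) renaming (sum to ∑)

-- Finite sums and floor division

-- A ≤ B follows from a ≤ b when (B − A) − (b − a) = s ≥ 0; a ≤ b is typically a linear combination, built with ⊹ and ⊛.
lin : ∀ {a b A B : ℕ} → a ≤ b → ∀ s → A + b + s ≡ B + a → A ≤ B
lin {a} {b} {A} {B} h s e =
  +-cancelʳ-≤ b A B (≤-trans (m≤m+n (A + b) s) (≤-trans (≤-reflexive e) (+-monoʳ-≤ B h)))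

lin/ : ∀ k .{{_ : NonZero k}} {a b A B : ℕ} → a ≤ b → ∀ s → k * A + b + s ≡ k * B + a → A ≤ B
lin/ k h s e = *-cancelˡ-≤ k (lin h s e)

infixl 6 _⊹_
infixl 7 _⊛_
_⊹_ : ∀ {a b c d : ℕ} → a ≤ b → c ≤ d → a + c ≤ b + d
_⊹_ = +-mono-≤

_⊛_ : ∀ k {a b : ℕ} → a ≤ b → k * a ≤ k * b
k ⊛ h = *-monoʳ-≤ k h

infixl 7 _÷_
_÷_ : ℕ → ℕ → ℕ
x ÷ zero = 0
x ÷ suc k = x / suc k

÷-lower : ∀ x k → (x ÷ k) * k ≤ x
÷-lower x zero = ≤-trans (≤-reflexive (*-zeroʳ 0)) z≤n
÷-lower x (suc k) = m/n*n≤m x (suc k)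

÷-upper : ∀ x {k} → 1 ≤ k → x < suc (x ÷ k) * k
÷-upper x {suc k} _ = begin-strict
  x ≡⟨ m≡m%n+[m/n]*n x (suc k) ⟩
  _ <⟨ +-monoˡ-< (x / suc k * suc k) (m%n<n x (suc k)) ⟩
  suc (x / suc k) * suc k ∎
  where open ≤-Reasoning

÷-greatest : ∀ x {k j} → 1 ≤ k → j * k ≤ x → j ≤ x ÷ k
÷-greatest x {k} {j} 1≤k h with j ≤? x ÷ k
... | yes p = p
... | no ¬p = ⊥-elim (<-irrefl refl (<-≤-trans (÷-upper x 1≤k) (≤-trans (*-monoˡ-≤ k (≰⇒> ¬p)) h)))

÷-unique : ∀ x {k j} → 1 ≤ k → j * k ≤ x → x < suc j * k → x ÷ k ≡ j
÷-unique x {k} {j} 1≤k h h' = ≤-antisym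
  (≤-pred (*-cancelʳ-< k _ _ (≤-<-trans (÷-lower x k) h'))) (÷-greatest x 1≤k h)

÷-÷ : ∀ x {d k} → 1 ≤ d → 1 ≤ k → x ÷ d ÷ k ≡ x ÷ (d * k)
÷-÷ x {d} {k} 1≤d 1≤k = ≤-antisym
  (÷-greatest x (*-mono-≤ 1≤d 1≤k) (begin
    q * (d * k) ≡⟨ swap-assoc q d k ⟩
    q * k * d ≤⟨ *-monoˡ-≤ d (÷-lower (x ÷ d) k) ⟩
    x ÷ d * d ≤⟨ ÷-lower x d ⟩
    x ∎))
  (÷-greatest (x ÷ d) 1≤k (÷-greatest x 1≤d (begin
    q' * k * d ≡⟨ sym (swap-assoc q' d k) ⟩
    q' * (d * k) ≤⟨ ÷-lower x (d * k) ⟩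
    x ∎)))
  where open ≤-Reasoning
        q = x ÷ d ÷ k
        q' = x ÷ (d * k)
        swap-assoc : ∀ a b c → a * (b * c) ≡ a * c * b
        swap-assoc = solve-∀

÷-monoˡ : ∀ {x y} k → x ≤ y → x ÷ k ≤ y ÷ k
÷-monoˡ zero h = z≤n
÷-monoˡ {x} {y} (suc k) h = ÷-greatest y (s≤s z≤n) (≤-trans (÷-lower x (suc k)) h)

÷-antiʳ : ∀ x {j k} → 1 ≤ j → j ≤ k → x ÷ k ≤ x ÷ j
÷-antiʳ x {j} {k} 1≤j h = ÷-greatest x 1≤j (≤-trans (*-monoʳ-≤ (x ÷ k) h) (÷-lower x k))

÷≤ : ∀ x k → x ÷ k ≤ x
÷≤ x zero = z≤n
÷≤ x (suc k) = m/n≤m x (suc k)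

÷1 : ∀ x → x ÷ 1 ≡ x
÷1 x = ÷-unique x ≤-refl (≤-reflexive (*-identityʳ x)) (s≤s (≤-reflexive (sym (*-identityʳ x))))

÷-pos : ∀ {x k} → 1 ≤ k → k ≤ x → 1 ≤ x ÷ k
÷-pos {x} {k} 1≤k h = ÷-greatest x 1≤k (≤-trans (≤-reflexive (*-identityˡ k)) h)

module Sums (G : CommutativeMonoid 0ℓ 0ℓ) where
  open CommutativeMonoid G renaming (Carrier to A; refl to ≈-refl; sym to ≈-sym; trans to ≈-trans)
  open import Relation.Binary.Reasoning.Setoid setoid

  -- S n f sums f over 1 ≤ k ≤ n.
  S : ℕ → (ℕ → A) → A
  S zero f = ε
  S (suc n) f = S n f ∙ f (suc n)

  S-cong : ∀ n {f g : ℕ → A} → (∀ k → 1 ≤ k → k ≤ n → f k ≈ g k) → S n f ≈ S n g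
  S-cong zero h = ≈-refl
  S-cong (suc n) h = ∙-cong (S-cong n λ k p q → h k p (m≤n⇒m≤1+n q)) (h (suc n) (s≤s z≤n) ≤-refl)

  S-ε : ∀ n {f : ℕ → A} → (∀ k → 1 ≤ k → k ≤ n → f k ≈ ε) → S n f ≈ ε
  S-ε zero h = ≈-refl
  S-ε (suc n) h = ≈-trans (∙-cong (S-ε n λ k p q → h k p (m≤n⇒m≤1+n q)) (h (suc n) (s≤s z≤n) ≤-refl))
    (identityˡ ε)

  S-∙ : ∀ n (f g : ℕ → A) → S n (λ k → f k ∙ g k) ≈ S n f ∙ S n g
  S-∙ zero f g = ≈-sym (identityˡ ε)
  S-∙ (suc n) f g = begin
    S n (λ k → f k ∙ g k) ∙ (f (suc n) ∙ g (suc n)) ≈⟨ ∙-congʳ (S-∙ n f g) ⟩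
    (S n f ∙ S n g) ∙ (f (suc n) ∙ g (suc n)) ≈⟨ assoc _ _ _ ⟩
    S n f ∙ (S n g ∙ (f (suc n) ∙ g (suc n))) ≈⟨ ∙-congˡ (≈-sym (assoc _ _ _)) ⟩
    S n f ∙ ((S n g ∙ f (suc n)) ∙ g (suc n)) ≈⟨ ∙-congˡ (∙-congʳ (comm _ _)) ⟩
    S n f ∙ ((f (suc n) ∙ S n g) ∙ g (suc n)) ≈⟨ ∙-congˡ (assoc _ _ _) ⟩
    S n f ∙ (f (suc n) ∙ (S n g ∙ g (suc n))) ≈⟨ ≈-sym (assoc _ _ _) ⟩
    (S n f ∙ f (suc n)) ∙ (S n g ∙ g (suc n)) ∎

  S-swap : ∀ n m (F : ℕ → ℕ → A) → S n (λ i → S m (F i)) ≈ S m (λ j → S n (λ i → F i j))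
  S-swap zero m F = ≈-sym (S-ε m λ _ _ _ → ≈-refl)
  S-swap (suc n) m F = ≈-trans (∙-congʳ (S-swap n m F)) (≈-sym (S-∙ m _ _))

  S-extend : ∀ {n m} (f : ℕ → A) → n ≤ m → (∀ k → n < k → k ≤ m → f k ≈ ε) → S m f ≈ S n f
  S-extend {n} {zero} f z≤n h = ≈-refl
  S-extend {n} {suc m} f n≤m h with n ≤? m
  ... | yes n≤m' = ≈-trans (∙-cong (S-extend f n≤m' λ k p q → h k p (m≤n⇒m≤1+n q))
    (h (suc m) (s≤s n≤m') ≤-refl)) (identityʳ _)
  ... | no n≰m with refl ← ≤-antisym n≤m (≰⇒> n≰m) = ≈-refl

  when : ∀ {P : Set} → Dec P → A → A
  when d v = if does d then v else ε

  when-yes : ∀ {P : Set} (d : Dec P) {v} → P → when d v ≈ v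
  when-yes (yes _) p = ≈-refl
  when-yes (no ¬p) p = ⊥-elim (¬p p)

  when-no : ∀ {P : Set} (d : Dec P) {v} → ¬ P → when d v ≈ ε
  when-no (no _) p = ≈-refl
  when-no (yes p) ¬p = ⊥-elim (¬p p)

  when-⇔ : ∀ {P Q : Set} (d : Dec P) (e : Dec Q) {v} → (P → Q) → (Q → P) → when d v ≈ when e v
  when-⇔ (yes p) (yes q) f g = ≈-refl
  when-⇔ (yes p) (no ¬q) f g = ⊥-elim (¬q (f p))
  when-⇔ (no ¬p) (yes q) f g = ⊥-elim (¬p (g q))
  when-⇔ (no ¬p) (no ¬q) f g = ≈-refl

  when-cong : ∀ {P : Set} (d : Dec P) {v w} → (P → v ≈ w) → when d v ≈ when d w
  when-cong (yes p) h = h p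
  when-cong (no ¬p) h = ≈-refl

  S-when : ∀ n {P : Set} (d : Dec P) (f : ℕ → A) → S n (λ k → when d (f k)) ≈ when d (S n f)
  S-when n (yes p) f = ≈-refl
  S-when n (no ¬p) f = S-ε n λ _ _ _ → ≈-refl

  S-point : ∀ n j (f : ℕ → A) → 1 ≤ j → j ≤ n → S n (λ k → when (j ≟ k) (f k)) ≈ f j
  S-point zero j f p q = ⊥-elim (<-irrefl refl (≤-trans p q))
  S-point (suc n) j f p q with j ≟ suc n
  ... | yes refl = ≈-trans (∙-cong (S-ε n λ k _ k≤n → when-no (suc n ≟ k) λ e → <-irrefl refl
    (≤-trans (≤-reflexive e) k≤n)) (when-yes (suc n ≟ suc n) refl)) (identityˡ _)
  ... | no ne = ≈-trans (∙-congˡ (when-no (j ≟ suc n) ne)) (≈-trans (identityʳ _)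
    (S-point n j f p (≤-pred (≤∧≢⇒< q ne))))

  S-multiples : ∀ x {d} → 1 ≤ d → ∀ (f : ℕ → A) → S x (λ n → when (d ∣? n) (f n)) ≈ S (x ÷ d)
    (λ m → f (d * m))
  S-multiples zero {d} 1≤d f = ≈-trans ≈-refl (≈-sym
    (reflexive-S (÷-unique 0 1≤d z≤n (≤-trans 1≤d (≤-reflexive (sym (*-identityˡ d)))))))
    where reflexive-S : ∀ {n} → n ≡ 0 → S n (λ m → f (d * m)) ≈ ε
          reflexive-S refl = ≈-refl
  S-multiples (suc x) {d} 1≤d f with d ∣? suc x
  ... | yes (divides zero ())
  ... | yes (divides (suc q) e) = begin
      S x (λ n → when (d ∣? n) (f n)) ∙ f (suc x) ≈⟨ ∙-cong (S-multiples x 1≤d f)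
        (reflexive (cong f (trans e (*-comm (suc q) d)))) ⟩
      S (x ÷ d) (λ m → f (d * m)) ∙ f (d * suc q) ≈⟨ reflexive (cong
        (λ n → S n (λ m → f (d * m)) ∙ f (d * suc q)) eq1) ⟩
      S (suc q) (λ m → f (d * m)) ≈⟨ reflexive (cong (λ n → S n (λ m → f (d * m))) (sym eq2)) ⟩
      S (suc x ÷ d) (λ m → f (d * m)) ∎
    where eq1 : x ÷ d ≡ q
          eq1 = ÷-unique x 1≤d (≤-pred (≤-trans (+-monoˡ-≤ (q * d) 1≤d) (≤-reflexive (sym e))))
            (≤-reflexive e)
          eq2 : suc x ÷ d ≡ suc q
          eq2 = ÷-unique (suc x) 1≤d (≤-reflexive (sym e)) (≤-trans (≤-reflexive (cong suc e))
            (+-monoˡ-≤ (suc q * d) 1≤d))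
  ... | no ∤ = ≈-trans (identityʳ _) (≈-trans (S-multiples x 1≤d f)
    (reflexive (cong (λ n → S n (λ m → f (d * m))) eq)))
    where eq : x ÷ d ≡ suc x ÷ d
          eq = sym (÷-unique (suc x) 1≤d (m≤n⇒m≤1+n (÷-lower x d))
            (≤∧≢⇒< (÷-upper x 1≤d) λ e → ∤ (divides (suc (x ÷ d)) e)))

  S-divisors-bound : ∀ {n x} (f : ℕ → A) → 1 ≤ n → n ≤ x → S x (λ d → when (d ∣? n) (f d)) ≈ S n
    (λ d → when (d ∣? n) (f d))
  S-divisors-bound {suc n} f _ n≤x = S-extend _ n≤x λ k n<k _ → when-no (k ∣? suc n) λ k∣n → <-irrefl refl
    (<-≤-trans n<k (∣⇒≤ k∣n))

  S-hyperbola : ∀ x (F : ℕ → ℕ → A) → S x (λ d → S (x ÷ d) (λ m → F d (d * m))) ≈ S x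
    (λ n → S n (λ d → when (d ∣? n) (F d n)))
  S-hyperbola x F = begin
    S x (λ d → S (x ÷ d) (λ m → F d (d * m))) ≈⟨ S-cong x (λ d p _ → ≈-sym (S-multiples x p (F d))) ⟩
    S x (λ d → S x (λ n → when (d ∣? n) (F d n))) ≈⟨ S-swap x x _ ⟩
    S x (λ n → S x (λ d → when (d ∣? n) (F d n))) ≈⟨ S-cong x (λ n p q → S-divisors-bound (λ d → F d n) p q) ⟩
    S x (λ n → S n (λ d → when (d ∣? n) (F d n))) ∎

  S-hyperbola-swap : ∀ x (F : ℕ → ℕ → A) → S x (λ d → S (x ÷ d) (F d)) ≈ S x (λ m → S (x ÷ m) (λ d → F d m))
  S-hyperbola-swap x F = begin
    S x (λ d → S (x ÷ d) (F d)) ≈⟨ S-cong x (λ d p _ → ≈-sym (cut p (F d))) ⟩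
    S x (λ d → S x (λ m → when (d * m ≤? x) (F d m))) ≈⟨ S-swap x x _ ⟩
    S x (λ m → S x (λ d → when (d * m ≤? x) (F d m))) ≈⟨ S-cong x (λ m p _ → ≈-trans
      (S-cong x λ d _ _ → when-⇔ (d * m ≤? x) (m * d ≤? x) (≤-trans (≤-reflexive (*-comm m d)))
      (≤-trans (≤-reflexive (*-comm d m)))) (cut p λ d → F d m)) ⟩
    S x (λ m → S (x ÷ m) (λ d → F d m)) ∎
    where
    cut : ∀ {d} → 1 ≤ d → ∀ (f : ℕ → A) → S x (λ m → when (d * m ≤? x) (f m)) ≈ S (x ÷ d) f
    cut {d} p f = ≈-trans
      (S-extend _ (÷≤ x d) λ k h _ → when-no (d * k ≤? x) λ dk≤x → <-irrefl refl
        (<-≤-trans h (÷-greatest x p (≤-trans (≤-reflexive (*-comm k d)) dk≤x))))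
      (S-cong (x ÷ d) λ k _ h → when-yes (d * k ≤? x) (≤-trans (≤-reflexive (*-comm d k))
        (≤-trans (*-monoˡ-≤ d h) (÷-lower x d))))

open Sums +-0-commutativeMonoid

S-mono : ∀ n {f g} → (∀ k → 1 ≤ k → k ≤ n → f k ≤ g k) → S n f ≤ S n g
S-mono zero h = z≤n
S-mono (suc n) h = +-mono-≤ (S-mono n λ k p q → h k p (m≤n⇒m≤1+n q)) (h (suc n) (s≤s z≤n) ≤-refl)

S-*ˡ : ∀ n c f → S n (λ k → c * f k) ≡ c * S n f
S-*ˡ zero c f = sym (*-zeroʳ c)
S-*ˡ (suc n) c f = trans (cong (_+ c * f (suc n)) (S-*ˡ n c f)) (sym (*-distribˡ-+ c (S n f) (f (suc n))))

S-const : ∀ n c → S n (λ _ → c) ≡ n * c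
S-const zero c = refl
S-const (suc n) c = trans (cong (_+ c) (S-const n c)) (+-comm (n * c) c)

S-monoˡ : ∀ {n m} f → n ≤ m → S n f ≤ S m f
S-monoˡ {n} {zero} f z≤n = z≤n
S-monoˡ {n} {suc m} f h with n ≤? m
... | yes p = ≤-trans (S-monoˡ f p) (m≤m+n _ _)
... | no ¬p with refl ← ≤-antisym h (≰⇒> ¬p) = ≤-refl

term≤S : ∀ {n} f {k} → 1 ≤ k → k ≤ n → f k ≤ S n f
term≤S f {suc k} _ h = ≤-trans (m≤n+m (f (suc k)) (S k f)) (S-monoˡ f h)

-- An integer-valued logarithm

greatest : {P : ℕ → Set} → (∀ j → Dec (P j)) → ℕ → ℕ
greatest P? zero = 0
greatest P? (suc b) with P? (suc b)
... | yes _ = suc b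
... | no _ = greatest P? b

greatest-holds : {P : ℕ → Set} (P? : ∀ j → Dec (P j)) → P 0 → ∀ b → P (greatest P? b)
greatest-holds P? p0 zero = p0
greatest-holds P? p0 (suc b) with P? (suc b)
... | yes p = p
... | no _ = greatest-holds P? p0 b

greatest-max : {P : ℕ → Set} (P? : ∀ j → Dec (P j)) → ∀ b {j} → j ≤ b → P j → j ≤ greatest P? b
greatest-max P? zero h _ = h
greatest-max {P} P? (suc b) {j} h p with P? (suc b)
... | yes _ = h
... | no ¬p = greatest-max P? b (≤-pred (≤∧≢⇒< h λ e → ¬p (subst P e p))) p

bernoulli-lower : ∀ M j → M ^ j * (M + j) ≤ (suc M) ^ j * M
bernoulli-lower M zero = ≤-reflexive (solve (M ∷ []))
bernoulli-lower M (suc j) = step (M ^ j) ((suc M) ^ j) (bernoulli-lower M j)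
  where
  step : ∀ p q → p * (M + j) ≤ q * M → M * p * (M + suc j) ≤ (suc M) * q * M
  step p q h = lin ((1 + M) ⊛ h) (j * p) (solve (M ∷ j ∷ p ∷ q ∷ []))

^-monoˡ-suc : ∀ M j → M ^ j ≤ (suc M) ^ j
^-monoˡ-suc M j = ^-monoˡ-≤ j (n≤1+n M)

bernoulli-upper : ∀ M j → suc M * (suc M) ^ j ≤ M ^ j * suc M + j * (suc M) ^ j
bernoulli-upper M zero = ≤-reflexive (solve (M ∷ []))
bernoulli-upper M (suc j) = step (M ^ j) ((suc M) ^ j) (bernoulli-upper M j) (^-monoˡ-suc M j)
  where
  step : ∀ p q → suc M * q ≤ p * suc M + j * q → p ≤ q →
    suc M * (suc M * q) ≤ M * p * suc M + suc j * (suc M * q)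
  step p q h k = lin ((1 + M) ⊛ h ⊹ (1 + M) ⊛ k) 0 (solve (M ∷ j ∷ p ∷ q ∷ []))

-- L is the logarithm to base 1 + 1/M, rounded down; thus L n ≈ M · ln n, and M plays the role of 1.
module Logarithm (M : ℕ) (1≤M : 1 ≤ M) where

  instance
    M≢0 : NonZero M
    M≢0 = >-nonZero 1≤M

  private
    P : ℕ → ℕ → Set
    P n j = suc M ^ j ≤ n * M ^ j

    P? : ∀ n j → Dec (P n j)
    P? n j = suc M ^ j ≤? n * M ^ j

    pow-pos : ∀ j → NonZero (M ^ j)
    pow-pos j = m^n≢0 M j

    P-bound : ∀ n j → P n j → M + j ≤ n * M
    P-bound n j h = *-cancelˡ-≤ (M ^ j) {{pow-pos j}} (begin
      M ^ j * (M + j) ≤⟨ bernoulli-lower M j ⟩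
      suc M ^ j * M ≤⟨ *-monoˡ-≤ M h ⟩
      n * M ^ j * M ≡⟨ rearrange n (M ^ j) M ⟩
      M ^ j * (n * M) ∎)
      where open ≤-Reasoning
            rearrange : ∀ a b c → a * b * c ≡ b * (a * c)
            rearrange = solve-∀

    P-zero : ∀ n → 1 ≤ n → P n 0
    P-zero n h = ≤-trans h (≤-reflexive (sym (*-identityʳ n)))

  L : ℕ → ℕ
  L n = greatest (P? n) (n * M)

  private
    L-holds : ∀ n → 1 ≤ n → P n (L n)
    L-holds n h = greatest-holds (P? n) (P-zero n h) (n * M)

    L-max : ∀ n j → P n j → j ≤ L n
    L-max n j h = greatest-max (P? n) (n * M) (≤-trans (m≤n+m j M) (P-bound n j h)) h

    L-fails : ∀ n → n * M ^ suc (L n) < suc M ^ suc (L n)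
    L-fails n = ≰⇒> λ h → <-irrefl refl (L-max n (suc (L n)) h)

    P-split : ∀ n a b → P n (a + b) → (suc M ^ a) * (suc M ^ b) ≤ n * (M ^ a * M ^ b)
    P-split n a b h = ≤-trans (≤-reflexive (sym (^-distribˡ-+-* (suc M) a b)))
      (≤-trans h (≤-reflexive (cong (n *_) (^-distribˡ-+-* M a b))))

    P-join : ∀ n a b → (suc M ^ a) * (suc M ^ b) ≤ n * (M ^ a * M ^ b) → P n (a + b)
    P-join n a b h = ≤-trans (≤-reflexive (^-distribˡ-+-* (suc M) a b))
      (≤-trans h (≤-reflexive (cong (n *_) (sym (^-distribˡ-+-* M a b)))))

  L-bound : ∀ {n} → 1 ≤ n → M + L n ≤ n * M
  L-bound {n} h = P-bound n (L n) (L-holds n h)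

  L-one : L 1 ≡ 0
  L-one = n≤0⇒n≡0 (+-cancelˡ-≤ M (L 1) 0 (L-bound ≤-refl))

  L-mono : ∀ {m n} → 1 ≤ m → m ≤ n → L m ≤ L n
  L-mono {m} {n} 1≤m h = L-max n (L m) (≤-trans (L-holds m 1≤m) (*-monoˡ-≤ (M ^ L m) h))

  L-*-lower : ∀ {m n} → 1 ≤ m → 1 ≤ n → L m + L n ≤ L (m * n)
  L-*-lower {m} {n} p q = L-max (m * n) (L m + L n) (P-join (m * n) (L m) (L n)
    (≤-trans (*-mono-≤ (L-holds m p) (L-holds n q)) (≤-reflexive (rearrange m (M ^ L m) n (M ^ L n)))))
    where rearrange : ∀ a b c d → a * b * (c * d) ≡ a * c * (b * d)
          rearrange = solve-∀

  L-*-upper : ∀ {m n} → 1 ≤ m → 1 ≤ n → L (m * n) ≤ suc (L m + L n)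
  L-*-upper {m} {n} p q with L (m * n) ≤? suc (L m + L n)
  ... | yes h = h
  ... | no h = ⊥-elim (<-irrefl refl (<-≤-trans strict upper))
    where
    a = suc (L m)
    b = suc (L n)
    j = a + b
    rest = L (m * n) ∸ j
    j≤L : j ≤ L (m * n)
    j≤L = ≤-trans (≤-reflexive (cong suc (+-suc (L m) (L n)))) (≰⇒> h)
    upper : suc M ^ j * suc M ^ rest ≤ (m * n) * (M ^ j * M ^ rest)
    upper = P-split (m * n) j rest (subst (P (m * n)) (sym (m+[n∸m]≡n j≤L)) (L-holds (m * n) (*-mono-≤ p q)))
    strict : (m * n) * (M ^ j * M ^ rest) < suc M ^ j * suc M ^ rest
    strict = begin-strict
      (m * n) * (M ^ j * M ^ rest) ≡⟨ cong (λ t → (m * n) * (t * M ^ rest)) (^-distribˡ-+-* M a b) ⟩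
      (m * n) * (M ^ a * M ^ b * M ^ rest) ≡⟨ rearrange m n (M ^ a) (M ^ b) (M ^ rest) ⟩
      (m * M ^ a) * (n * M ^ b) * M ^ rest ≤⟨ *-monoʳ-≤ ((m * M ^ a) * (n * M ^ b)) (^-monoˡ-suc M rest) ⟩
      (m * M ^ a) * (n * M ^ b) * suc M ^ rest <⟨ *-monoˡ-< (suc M ^ rest) {{m^n≢0 (suc M) rest}}
        (*-mono-< (L-fails m) (L-fails n)) ⟩
      suc M ^ a * suc M ^ b * suc M ^ rest ≡⟨ cong (_* suc M ^ rest) (sym (^-distribˡ-+-* (suc M) a b)) ⟩
      suc M ^ j * suc M ^ rest ∎
      where open ≤-Reasoning
            rearrange : ∀ x y u v w → (x * y) * (u * v * w) ≡ (x * u) * (y * v) * w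
            rearrange = solve-∀

  r : ℕ → ℕ
  r n = M ÷ n

  H : ℕ → ℕ
  H n = S n r

  L-step-lower : ∀ {n} → 1 ≤ n → L n + r (suc n) ≤ L (suc n)
  L-step-lower {n} 1≤n = L-max (suc n) (L n + δ) (P-join (suc n) (L n) δ (begin
    suc M ^ L n * suc M ^ δ ≤⟨ *-monoˡ-≤ (suc M ^ δ) (L-holds n 1≤n) ⟩
    n * M ^ L n * suc M ^ δ ≡⟨ rearrange n (M ^ L n) (suc M ^ δ) ⟩
    M ^ L n * (n * suc M ^ δ) ≤⟨ *-monoʳ-≤ (M ^ L n) (ratio (suc M ^ δ) (M ^ δ) (bernoulli-upper M δ)
      (÷-lower M (suc n))) ⟩
    M ^ L n * (suc n * M ^ δ) ≡⟨ rearrange' (M ^ L n) (suc n) (M ^ δ) ⟩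
    suc n * (M ^ L n * M ^ δ) ∎))
    where
    open ≤-Reasoning
    δ = r (suc n)
    rearrange : ∀ a b c → a * b * c ≡ b * (a * c)
    rearrange = solve-∀
    rearrange' : ∀ a b c → a * (b * c) ≡ b * (a * c)
    rearrange' = solve-∀
    ratio : ∀ x y → suc M * x ≤ y * suc M + δ * x → δ * suc n ≤ M → n * x ≤ suc n * y
    ratio x y h k = *-cancelˡ-≤ (suc M) (ratio' x y δ h k)
      where
      ratio' : ∀ x y d → suc M * x ≤ y * suc M + d * x → d * suc n ≤ M → suc M * (n * x) ≤ suc M * (suc n * y)
      ratio' x y d h k = lin ((1 + n) ⊛ h ⊹ x ⊛ k) x (solve (M ∷ n ∷ x ∷ y ∷ d ∷ []))

  L-step-upper : ∀ {n} → 1 ≤ n → L (suc n) ≤ suc (L n + r n)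
  L-step-upper {n} 1≤n with L (suc n) ≤? suc (L n + r n)
  ... | yes h = h
  ... | no h = ⊥-elim (<-irrefl refl (≤-trans small δ≤r))
    where
    a = suc (L n)
    δ = L (suc n) ∸ a
    a≤L : a ≤ L (suc n)
    a≤L = ≤-trans (s≤s (m≤m+n (L n) (r n))) (<⇒≤ (≰⇒> h))
    small : suc (r n) ≤ δ
    small = +-cancelˡ-≤ a _ _ (≤-trans (≤-reflexive (+-suc a (r n)))
      (≤-trans (≰⇒> h) (≤-reflexive (sym (m+[n∸m]≡n a≤L)))))
    upper : suc M ^ a * suc M ^ δ ≤ suc n * (M ^ a * M ^ δ)
    upper = P-split (suc n) a δ (subst (P (suc n)) (sym (m+[n∸m]≡n a≤L)) (L-holds (suc n) (s≤s z≤n)))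
    combine : ∀ x y z w → n * y ≤ x → x * z ≤ suc n * (y * w) → y * (n * z) ≤ y * (suc n * w)
    combine x y z w h k = lin (z ⊛ h ⊹ k) 0 (solve (n ∷ x ∷ y ∷ z ∷ w ∷ []))
    quotient : n * suc M ^ δ ≤ suc n * M ^ δ
    quotient = *-cancelˡ-≤ (M ^ a) {{pow-pos a}} (combine _ (M ^ a) (suc M ^ δ) (M ^ δ) (<⇒≤ (L-fails n))
      upper)
    combine' : ∀ p q → p * (M + δ) ≤ q * M → n * q ≤ suc n * p → p * (δ * n) ≤ p * M
    combine' p q h k = c δ p q h k
      where
      c : ∀ d p q → p * (M + d) ≤ q * M → n * q ≤ suc n * p → p * (d * n) ≤ p * M
      c d p q h k = lin (n ⊛ h ⊹ M ⊛ k) 0 (solve (M ∷ n ∷ d ∷ p ∷ q ∷ []))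
    δ≤r : δ ≤ r n
    δ≤r = ÷-greatest M 1≤n (*-cancelˡ-≤ (M ^ δ) {{pow-pos δ}} (combine' (M ^ δ) (suc M ^ δ)
      (bernoulli-lower M δ) quotient))

  r-one : r 1 ≡ M
  r-one = ÷1 M

  H-one : H 1 ≡ M
  H-one = r-one

  H≤L+M : ∀ {n} → 1 ≤ n → H n ≤ L n + M
  H≤L+M {suc zero} _ = ≤-trans (≤-reflexive H-one) (m≤n+m M (L 1))
  H≤L+M {suc (suc n)} _ = step (H (suc n)) (r (suc (suc n))) (L (suc n)) (L (suc (suc n)))
    (H≤L+M {suc n} (s≤s z≤n)) (L-step-lower {suc n} (s≤s z≤n))
    where
    step : ∀ h q a b → h ≤ a + M → a + q ≤ b → h + q ≤ b + M
    step h q a b p k = lin (p ⊹ k) 0 (solve (M ∷ h ∷ q ∷ a ∷ b ∷ []))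

  L≤H+n : ∀ n → L (suc n) ≤ H n + n
  L≤H+n zero = ≤-trans (≤-reflexive L-one) z≤n
  L≤H+n (suc n) = step (L (suc (suc n))) (L (suc n)) (H n) (r (suc n)) (L-step-upper {suc n} (s≤s z≤n))
    (L≤H+n n)
    where
    step : ∀ a b h q → a ≤ suc (b + q) → b ≤ h + n → a ≤ h + q + suc n
    step a b h q p k = lin (p ⊹ k) 0 (solve (n ∷ a ∷ b ∷ h ∷ q ∷ []))

  H-step-bounds : ∀ n → M ≤ suc n * r (suc n) + n
  H-step-bounds n = ≤-pred (≤-trans (÷-upper M (s≤s z≤n)) (≤-reflexive (rearrange (r (suc n)) n)))
    where rearrange : ∀ a n → suc a * suc n ≡ suc (suc n * a + n)
          rearrange = solve-∀

  *r≤M : ∀ n → n * r n ≤ M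
  *r≤M n = ≤-trans (≤-reflexive (*-comm n (r n))) (÷-lower M n)

  H-odd : ∀ n → H (suc (n + n)) ≤ M + H n
  H-odd zero = ≤-trans (≤-reflexive H-one) (m≤m+n M 0)
  H-odd (suc n) = subst (λ k → H (suc (suc k)) ≤ M + H (suc n)) (sym (+-suc n n))
    (step (H (suc (n + n))) (r (suc (suc (n + n)))) (r (suc (suc (suc (n + n))))) (H n) (r (suc n)) (H-odd n)
      (÷-greatest M (s≤s z≤n) (≤-trans (≤-reflexive (rearrange (r (suc (suc (n + n)))) n))
        (÷-lower M (suc (suc (n + n))))))
      (÷-antiʳ M (s≤s z≤n) (n≤1+n _)))
    where
    rearrange : ∀ a n → (a + a) * suc n ≡ a * suc (suc (n + n))
    rearrange = solve-∀
    step : ∀ h a b g q → h ≤ M + g → a + a ≤ q → b ≤ a → h + a + b ≤ M + (g + q)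
    step h a b g q x y w = lin (x ⊹ y ⊹ w) 0 (solve (M ∷ h ∷ a ∷ b ∷ g ∷ q ∷ []))

  H-mono : ∀ {m n} → m ≤ n → H m ≤ H n
  H-mono = S-monoˡ r

  H-halve : ∀ n → H n ≤ M + H (n ÷ 2)
  H-halve n = ≤-trans (H-mono (≤-pred (≤-trans (÷-upper n {2} (s≤s z≤n)) (≤-reflexive (rearrange (n ÷ 2))))))
    (H-odd (n ÷ 2))
    where rearrange : ∀ a → suc a * 2 ≡ suc (suc (a + a))
          rearrange = solve-∀

  H≤ : ∀ k n → 1 ≤ k → k * H n ≤ M * (n + k * k)
  H≤ k n 1≤k = ≤-trans (≤-reflexive (sym (S-*ˡ n k r))) (go n)
    where
    go : ∀ n → S n (λ j → k * r j) ≤ M * (n + k * k)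
    go zero = z≤n
    go (suc n) with suc n ≤? k
    ... | yes h = ≤-trans (few (suc n) h) (≤-reflexive refl)
      where
      few : ∀ m → m ≤ k → S m (λ j → k * r j) ≤ M * (m + k * k)
      few m h = begin
        S m (λ j → k * r j) ≤⟨ S-mono m (λ j _ _ → *-monoʳ-≤ k (÷≤ M j)) ⟩
        S m (λ _ → k * M) ≡⟨ S-const m (k * M) ⟩
        m * (k * M) ≤⟨ *-monoˡ-≤ (k * M) h ⟩
        k * (k * M) ≡⟨ solve (k ∷ M ∷ []) ⟩
        M * (k * k) ≤⟨ *-monoʳ-≤ M (m≤n+m (k * k) m) ⟩
        M * (m + k * k) ∎
        where open ≤-Reasoning
    ... | no h = ≤-trans (+-mono-≤ (go n) (≤-trans (*-monoˡ-≤ (r (suc n)) (<⇒≤ (≰⇒> h))) (*r≤M (suc n))))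
      (≤-reflexive (solve (M ∷ n ∷ k ∷ [])))

  H≤Mn : ∀ n → H n ≤ n * M
  H≤Mn n = ≤-trans (S-mono n λ k _ _ → ÷≤ M k) (≤-reflexive (S-const n M))

  6L2≤ : 6 * L 2 ≤ 5 * M + 12
  6L2≤ = go (L 2) (L 3) (L 4) (r 2) (r 3) (L-*-lower {2} {2} (s≤s z≤n) (s≤s z≤n)) (L-step-upper {2} (s≤s z≤n))
    (L-step-upper {3} (s≤s z≤n)) (*r≤M 2) (*r≤M 3)
    where
    go : ∀ a b c s t → a + a ≤ c → b ≤ suc (a + s) → c ≤ suc (b + t) → 2 * s ≤ M → 3 * t ≤ M → 6 * a ≤ 5 * M +
      12
    go a b c s t h1 h2 h3 h4 h5 = lin (6 ⊛ h1 ⊹ 6 ⊛ h2 ⊹ 6 ⊛ h3 ⊹ 3 ⊛ h4 ⊹ 2 ⊛ h5) 0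
      (solve (M ∷ a ∷ b ∷ c ∷ s ∷ t ∷ []))

-- Von Mangoldt’s function

prime≥2 : ∀ {p} → Prime p → 2 ≤ p
prime≥2 {zero} pr with () ← NonZero.nonZero (prime⇒nonZero pr)
prime≥2 {suc zero} pr with () ← NonTrivial.nonTrivial (prime⇒nonTrivial pr)
prime≥2 {suc (suc p)} pr = s≤s (s≤s z≤n)

prime≥1 : ∀ {p} → Prime p → 1 ≤ p
prime≥1 pr = <⇒≤ (prime≥2 pr)

n<p^n : ∀ {p} → 2 ≤ p → ∀ n → n < p ^ n
n<p^n h zero = s≤s z≤n
n<p^n {p} h (suc n) = ≤-trans (+-mono-≤ (≤-trans (s≤s z≤n) (n<p^n h n)) (n<p^n h n))
  (≤-trans (≤-reflexive (solve-2 (p ^ n))) (*-monoˡ-≤ (p ^ n) h))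
  where solve-2 : ∀ a → a + a ≡ 2 * a
        solve-2 = solve-∀

p≤p^a : ∀ {p a} → 1 ≤ p → 1 ≤ a → p ≤ p ^ a
p≤p^a {p} {suc a} h _ = ≤-trans (≤-reflexive (sym (*-identityʳ p))) (*-monoʳ-≤ p (m^n>0 p {{>-nonZero h}} a))

multiplicative-induction : (P : ℕ → Set) → P 1 → (∀ {p n} → Prime p → 1 ≤ n → P n → P (p * n)) → ∀ n → 1 ≤ n →
  P n
multiplicative-induction P P1 step n 1≤n = subst P (sym F.isFactorisation)
  (proj₂ (go F.factors F.factorsPrime))
  where
  module F = PrimeFactorisation (factorise n {{>-nonZero 1≤n}})
  go : ∀ ps → All Prime ps → 1 ≤ product ps × P (product ps)
  go [] All.[] = ≤-refl , P1
  go (p ∷ ps) (pr All.∷ prs) with go ps prs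
  ... | pos , ih = *-mono-≤ (prime≥1 pr) pos , step pr pos ih

prime∤prime : ∀ {p q} → Prime p → Prime q → p ≢ q → ¬ p ∣ q
prime∤prime pp pq p≢q p∣q with prime⇒irreducible pq p∣q
... | inj₂ e = p≢q e
... | inj₁ refl with s≤s () ← prime≥2 pp

prime-power-∣ : ∀ {p q} → Prime p → Prime q → p ≢ q → ∀ a n → p ^ a ∣ q * n → p ^ a ∣ n
prime-power-∣ pp pq ne zero n h = divides n (sym (*-identityʳ n))
prime-power-∣ {p} {q} pp pq ne (suc a) n h with euclidsLemma q n pp (m*n∣⇒m∣ p (p ^ a) h)
... | inj₁ p∣q = ⊥-elim (prime∤prime pp pq ne p∣q)
... | inj₂ (divides m refl) = subst (λ t → p * p ^ a ∣ t) (*-comm p m)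
  (*-monoʳ-∣ p (prime-power-∣ pp pq ne a m (*-cancelˡ-∣ p {{prime⇒nonZero pp}}
    (subst (p * p ^ a ∣_) (rearrange q m p) h))))
  where rearrange : ∀ q m p → q * (m * p) ≡ p * (q * m)
        rearrange = solve-∀

S-shift : ∀ n f → S (suc n) f ≡ f 1 + S n (f ∘ suc)
S-shift zero f = +-comm 0 (f 1)
S-shift (suc n) f = trans (cong (_+ f (suc (suc n))) (S-shift n f)) (+-assoc (f 1) _ _)

when-comm : ∀ {P Q : Set} (d : Dec P) (e : Dec Q) {v : ℕ} → when d (when e v) ≡ when e (when d v)
when-comm (yes _) e = refl
when-comm (no _) (yes _) = refl
when-comm (no _) (no _) = refl

when-mono : ∀ {P Q : Set} (d : Dec P) (e : Dec Q) {v w : ℕ} → (P → Q) → (P → v ≤ w) → when d v ≤ when e w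
when-mono (no _) e f h = z≤n
when-mono (yes p) (yes q) f h = h p
when-mono (yes p) (no ¬q) f h = ⊥-elim (¬q (f p))

module VonMangoldt (M : ℕ) (1≤M : 1 ≤ M) where
  open Logarithm M 1≤M

  over-prime-powers : ℕ → (ℕ → ℕ → ℕ) → ℕ
  over-prime-powers B g = S B (λ p → when (prime? p) (S B (λ a → g p a)))

  Λ : ℕ → ℕ
  Λ n = over-prime-powers n (λ p a → when (p ^ a ≟ n) (L p))

  ℓ : ℕ → ℕ
  ℓ n = S n (λ d → when (d ∣? n) (Λ d))

  ψ T : ℕ → ℕ
  ψ n = S n Λ
  T n = S n ℓ

  Λ-bound : ∀ {n B} → n ≤ B → Λ n ≡ over-prime-powers B (λ p a → when (p ^ a ≟ n) (L p))
  Λ-bound {n} {B} n≤B = sym (trans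
    (S-extend _ n≤B λ p n<p _ → trans (when-cong (prime? p) λ pr → S-ε B λ a 1≤a _ →
      when-no (p ^ a ≟ n) λ e → <-irrefl refl (<-≤-trans n<p
        (≤-trans (p≤p^a (prime≥1 pr) 1≤a) (≤-reflexive e)))) (zero-when (prime? p)))
    (S-cong n λ p _ _ → when-cong (prime? p) λ pr → S-extend _ n≤B λ a n<a _ →
      when-no (p ^ a ≟ n) λ e → <-irrefl refl (<-trans n<a
        (<-≤-trans (n<p^n (prime≥2 pr) a) (≤-reflexive e)))))
    where
    zero-when : ∀ {P : Set} (d : Dec P) → when d 0 ≡ 0
    zero-when (yes _) = refl
    zero-when (no _) = refl

  S-Λ : ∀ {B} {P : ℕ → Set} (P? : ∀ d → Dec (P d)) → (∀ d → P d → d ≤ B) →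
    S B (λ d → when (P? d) (Λ d)) ≡ over-prime-powers B (λ p a → when (P? (p ^ a)) (L p))
  S-Λ {B} {P} P? bound = begin
    S B (λ d → when (P? d) (Λ d))
      ≡⟨ S-cong B (λ d _ d≤B → when-cong (P? d) λ _ → Λ-bound d≤B) ⟩
    S B (λ d → when (P? d) (S B (λ p → when (prime? p) (S B (λ a → G d p a)))))
      ≡⟨ S-cong B (λ d _ _ → trans (sym (S-when B (P? d) _)) (S-cong B λ p _ _ → trans
        (when-comm (P? d) (prime? p)) (when-cong (prime? p) λ _ → sym (S-when B (P? d) _)))) ⟩
    S B (λ d → S B (λ p → when (prime? p) (S B (λ a → when (P? d) (G d p a)))))
      ≡⟨ S-swap B B _ ⟩
    S B (λ p → S B (λ d → when (prime? p) (S B (λ a → when (P? d) (G d p a)))))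
      ≡⟨ S-cong B (λ p _ _ → trans (S-when B (prime? p) _) (when-cong (prime? p) λ pr → trans (S-swap B B _)
        (S-cong B λ a 1≤a _ → collapse p a pr))) ⟩
    over-prime-powers B (λ p a → when (P? (p ^ a)) (L p)) ∎
    where
    open ≡-Reasoning
    G : ℕ → ℕ → ℕ → ℕ
    G d p a = when (p ^ a ≟ d) (L p)
    collapse : ∀ p a → Prime p → S B (λ d → when (P? d) (G d p a)) ≡ when (P? (p ^ a)) (L p)
    collapse p a pr with p ^ a ≤? B
    ... | yes h = trans (S-cong B λ d _ _ → when-comm (P? d) (p ^ a ≟ d))
      (S-point B (p ^ a) (λ d → when (P? d) (L p)) (m^n>0 p {{prime⇒nonZero pr}} a) h)
    ... | no h = trans (S-ε B λ d _ d≤B → trans (when-comm (P? d) (p ^ a ≟ d))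
      (when-no (p ^ a ≟ d) λ e → h (≤-trans (≤-reflexive e) d≤B)))
      (sym (when-no (P? (p ^ a)) λ q → h (bound _ q)))

  ℓ-prime-powers : ∀ {n B} → 1 ≤ n → n ≤ B → ℓ n ≡ over-prime-powers B (λ p a → when (p ^ a ∣? n) (L p))
  ℓ-prime-powers {suc n} {B} 1≤n n≤B = trans (sym (S-divisors-bound Λ 1≤n n≤B))
    (S-Λ (_∣? suc n) λ d d∣n → ≤-trans (∣⇒≤ d∣n) n≤B)

  ℓ-one : ℓ 1 ≡ 0
  ℓ-one = trans (ℓ-prime-powers {1} {1} ≤-refl ≤-refl) (when-no (prime? 1)
    {S 1 (λ a → when (1 ^ a ∣? 1) (L 1))} λ pr → <⇒≱ (prime≥2 pr) ≤-refl)

  ℓ-prime-* : ∀ {q n} → Prime q → 1 ≤ n → ℓ (q * n) ≡ ℓ n + L q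
  ℓ-prime-* {q} {n} pq 1≤n = begin
    ℓ (q * n) ≡⟨ ℓ-prime-powers 1≤qn ≤-refl ⟩
    over-prime-powers B (λ p a → when (p ^ a ∣? q * n) (L p))
      ≡⟨ S-cong B (λ p _ _ → per-prime p) ⟩
    S B (λ p → W p n + when (q ≟ p) (L p)) ≡⟨ S-∙ B _ _ ⟩
    S B (λ p → W p n) + S B (λ p → when (q ≟ p) (L p))
      ≡⟨ cong₂ _+_ (sym (ℓ-prime-powers 1≤n n≤B)) (S-point B q L (prime≥1 pq) q≤B) ⟩
    ℓ n + L q ∎
    where
    open ≡-Reasoning
    B = q * n
    1≤qn : 1 ≤ B
    1≤qn = *-mono-≤ (prime≥1 pq) 1≤n
    n≤B : n ≤ B
    n≤B = ≤-trans (≤-reflexive (sym (*-identityˡ n))) (*-monoˡ-≤ n (prime≥1 pq))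
    q≤B : q ≤ B
    q≤B = ≤-trans (≤-reflexive (sym (*-identityʳ q))) (*-monoʳ-≤ q 1≤n)
    W : ℕ → ℕ → ℕ
    W p m = when (prime? p) (S B (λ a → when (p ^ a ∣? m) (L p)))
    qn∣ : ∀ a → q * q ^ a ∣ q * n → q ^ a ∣ n
    qn∣ a = *-cancelˡ-∣ q {{prime⇒nonZero pq}}
    shifted : ∀ {B} → 1 ≤ B → n ≤ B → S B (λ a → when (q ^ a ∣? q * n) (L q)) ≡ S B
      (λ a → when (q ^ a ∣? n) (L q)) + L q
    shifted {suc b} _ n≤b = begin
      S (suc b) (λ a → when (q ^ a ∣? q * n) (L q)) ≡⟨ S-shift b _ ⟩
      when (q ^ 1 ∣? q * n) (L q) + S b (λ a → when (q ^ suc a ∣? q * n) (L q))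
        ≡⟨ cong₂ _+_ (when-yes (q ^ 1 ∣? q * n) (subst (_∣ q * n) (sym (*-identityʳ q)) (m∣m*n n)))
             (S-cong b λ a _ _ → when-⇔ (q ^ suc a ∣? q * n) (q ^ a ∣? n) (qn∣ a) (*-monoʳ-∣ q)) ⟩
      L q + S b (λ a → when (q ^ a ∣? n) (L q)) ≡⟨ +-comm (L q) _ ⟩
      S b (λ a → when (q ^ a ∣? n) (L q)) + L q
        ≡⟨ cong (_+ L q) (sym (trans (cong (λ t → S b (λ a → when (q ^ a ∣? n) (L q)) + t)
          (when-no (q ^ suc b ∣? n) too-big)) (+-identityʳ _))) ⟩
      S (suc b) (λ a → when (q ^ a ∣? n) (L q)) + L q ∎
      where
      too-big : ¬ q ^ suc b ∣ n
      too-big h = <-irrefl refl (<-≤-trans (n<p^n (prime≥2 pq) (suc b))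
        (≤-trans (∣⇒≤ {{>-nonZero 1≤n}} h) n≤b))
    per-prime : ∀ p → W p (q * n) ≡ W p n + when (q ≟ p) (L p)
    per-prime p with prime? p
    ... | no ¬pp = sym (when-no (q ≟ p) λ { refl → ¬pp pq })
    ... | yes pp with q ≟ p in eq
    ...   | yes refl = trans (shifted 1≤qn n≤B) (cong (λ t → S B (λ a → when (q ^ a ∣? n) (L q)) + t)
      (sym (when-yes (q ≟ q) refl)))
    ...   | no q≢p = trans (S-cong B λ a _ _ → when-⇔ (p ^ a ∣? q * n) (p ^ a ∣? n)
      (prime-power-∣ pp pq (q≢p ∘ sym) a n) (λ h → ∣-trans h (n∣m*n q)))
                     (sym (trans (cong (λ t → S B (λ a → when (p ^ a ∣? n) (L p)) + t) (when-no (q ≟ p) q≢p))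
                       (+-identityʳ _)))

  ℓ-* : ∀ m n → 1 ≤ m → 1 ≤ n → ℓ (m * n) ≡ ℓ m + ℓ n
  ℓ-* m n 1≤m 1≤n = multiplicative-induction (λ m → ℓ (m * n) ≡ ℓ m + ℓ n)
    (trans (cong ℓ (*-identityˡ n)) (cong (_+ ℓ n) (sym ℓ-one)))
    (λ {p} {m} pp 1≤m ih → trans (cong ℓ (*-assoc p m n)) (trans (ℓ-prime-* pp (*-mono-≤ 1≤m 1≤n))
       (trans (cong (_+ L p) ih) (trans (rearrange (ℓ m) (ℓ n) (L p))
         (cong (_+ ℓ n) (sym (ℓ-prime-* pp 1≤m)))))))
    m 1≤m
    where rearrange : ∀ a b c → a + b + c ≡ a + c + b
          rearrange = solve-∀

  ℓ≤L : ∀ n → 1 ≤ n → ℓ n ≤ L n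
  ℓ≤L = multiplicative-induction (λ n → ℓ n ≤ L n) (≤-trans (≤-reflexive ℓ-one) z≤n)
    λ {p} {n} pp 1≤n ih → ≤-trans (≤-reflexive (ℓ-prime-* pp 1≤n)) (≤-trans (+-monoˡ-≤ (L p) ih)
      (≤-trans (≤-reflexive (+-comm (L n) (L p))) (L-*-lower (prime≥1 pp) 1≤n)))

  L≤ℓ+n : ∀ n → 1 ≤ n → L n ≤ ℓ n + n
  L≤ℓ+n = multiplicative-induction (λ n → L n ≤ ℓ n + n) (≤-trans (≤-reflexive L-one) z≤n)
    λ {p} {n} pp 1≤n ih → ≤-trans (L-*-upper (prime≥1 pp) 1≤n)
      (≤-trans (step (L p) (L n) (ℓ n) n ih 1≤n) (+-mono-≤ (≤-reflexive (sym (ℓ-prime-* pp 1≤n)))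
        (*-monoˡ-≤ n (prime≥2 pp))))
    where
    step : ∀ a b c n → b ≤ c + n → 1 ≤ n → suc (a + b) ≤ c + a + 2 * n
    step a b c n h k = lin (h ⊹ k) 0 (solve (a ∷ b ∷ c ∷ n ∷ []))

  T-floor : ∀ y → T y ≡ S y (λ d → (y ÷ d) * Λ d)
  T-floor y = trans (sym (S-hyperbola y (λ d _ → Λ d))) (S-cong y λ d _ _ → S-const (y ÷ d) (Λ d))

  T-ψ : ∀ y → S y (λ k → ψ (y ÷ k)) ≡ T y
  T-ψ y = trans (S-hyperbola-swap y (λ _ n → Λ n)) (S-hyperbola y (λ d _ → Λ d))

  L-^ : ∀ {p} → 1 ≤ p → ∀ a → a * L p ≤ L (p ^ a)
  L-^ h zero = z≤n
  L-^ {p} h (suc a) = ≤-trans (+-monoʳ-≤ (L p) (L-^ h a)) (L-*-lower h (m^n>0 p {{>-nonZero h}} a))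

  ψ-prime-free : ∀ {x X s} → x ≤ X → X < suc s * suc s → s ≤ X → (∀ p → Prime p → x < p → ¬ p ≤ X) → ψ X ≤ ψ x
    + s * L X
  ψ-prime-free {x} {X} {s} x≤X X<s² s≤X no-primes = begin
    ψ X ≡⟨ S-cong X (λ n _ n≤X → split n (Λ n) n≤X) ⟩
    S X (λ n → when (n ≤? x) (Λ n) + when (in-gap? n) (Λ n)) ≡⟨ cong₂-proof ⟩
    ψ x + over-prime-powers X (λ p a → when (in-gap? (p ^ a)) (L p)) ≤⟨ +-monoʳ-≤ (ψ x)
      (S-mono X λ p 1≤p _ → per-prime p) ⟩
    ψ x + S X (λ p → when (p ≤? s) (L X)) ≡⟨ cong (λ t → ψ x + t) (trans
      (S-extend _ s≤X λ p s<p _ → when-no (p ≤? s) (<⇒≱ s<p)) (trans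
      (S-cong s λ p _ p≤s → when-yes (p ≤? s) p≤s) (S-const s (L X)))) ⟩
    ψ x + s * L X ∎
    where
    open ≤-Reasoning
    In-gap : ℕ → Set
    In-gap n = x < n × n ≤ X
    in-gap? : ∀ n → Dec (In-gap n)
    in-gap? n with x <? n | n ≤? X
    ... | yes a | yes b = yes (a , b)
    ... | no a | _ = no (a ∘ proj₁)
    ... | _ | no b = no (b ∘ proj₂)
    split : ∀ n v → n ≤ X → v ≡ when (n ≤? x) v + when (in-gap? n) v
    split n v n≤X with ≤-<-connex n x
    ... | inj₁ n≤x = sym (trans (cong₂ _+_ (when-yes (n ≤? x) n≤x)
      (when-no (in-gap? n) λ g → <⇒≱ (proj₁ g) n≤x)) (+-identityʳ v))
    ... | inj₂ x<n = sym (cong₂ _+_ (when-no (n ≤? x) (<⇒≱ x<n)) (when-yes (in-gap? n) (x<n , n≤X)))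
    cong₂-proof = trans (S-∙ X _ _) (cong₂ _+_
      (trans (S-extend _ x≤X λ n x<n _ → when-no (n ≤? x) (<⇒≱ x<n))
        (S-cong x λ n _ n≤x → when-yes (n ≤? x) n≤x))
      (S-Λ in-gap? λ d → proj₂))
    powers : ∀ {p} → Prime p → ∀ B → S B (λ a → when (p ^ a ≤? X) (L p)) ≤ L X
    powers pp zero = z≤n
    powers {p} pp (suc B) with p ^ suc B ≤? X
    ... | no h = ≤-trans (≤-reflexive (trans
      (cong (λ t → S B (λ a → when (p ^ a ≤? X) (L p)) + t) (when-no (p ^ suc B ≤? X) h)) (+-identityʳ _)))
      (powers pp B)
    ... | yes h = ≤-trans (S-mono (suc B) λ a _ _ → when≤ (p ^ a ≤? X))
                    (≤-trans (≤-reflexive (S-const (suc B) (L p)))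
                      (≤-trans (L-^ (prime≥1 pp) (suc B)) (L-mono (m^n>0 p {{prime⇒nonZero pp}} (suc B)) h)))
      where when≤ : ∀ {P : Set} (d : Dec P) {v} → when d v ≤ v
            when≤ (yes _) = ≤-refl
            when≤ (no _) = z≤n
    large-prime : ∀ {p} a → Prime p → 1 ≤ a → s < p → ¬ In-gap (p ^ a)
    large-prime {p} (suc zero) pp _ s<p (x<p , p≤X) = no-primes p pp (subst (x <_) (*-identityʳ p) x<p)
      (subst (_≤ X) (*-identityʳ p) p≤X)
    large-prime {p} (suc (suc a)) pp _ s<p (_ , p≤X) = <-irrefl refl
      (<-≤-trans X<s² (≤-trans (*-mono-≤ s<p (≤-trans s<p (p≤p^a {a = suc a} (prime≥1 pp) (s≤s z≤n)))) p≤X))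
    per-prime : ∀ p → when (prime? p) (S X (λ a → when (in-gap? (p ^ a)) (L p))) ≤ when (p ≤? s) (L X)
    per-prime p with prime? p
    ... | no _ = z≤n
    ... | yes pp with ≤-<-connex p s
    ...   | inj₁ p≤s = ≤-trans (S-mono X λ a _ _ → when-mono (in-gap? (p ^ a)) (p ^ a ≤? X) proj₂
      (λ _ → ≤-refl)) (≤-trans (powers pp X) (≤-reflexive (sym (when-yes (p ≤? s) p≤s))))
    ...   | inj₂ s<p = ≤-trans (≤-reflexive (S-ε X λ a 1≤a _ → when-no (in-gap? (p ^ a))
      (large-prime {p} a pp 1≤a s<p))) z≤n

-- Möbius inversion by sieving

module ℤS = Sums ℤₚ.+-0-commutativeMonoid

ℤS-*ˡ : ∀ n c f → ℤS.S n (λ k → c ℤ.* f k) ≡ c ℤ.* ℤS.S n f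
ℤS-*ˡ zero c f = sym (ℤₚ.*-zeroʳ c)
ℤS-*ˡ (suc n) c f = trans (cong (ℤ._+ c ℤ.* f (suc n)) (ℤS-*ˡ n c f))
  (sym (ℤₚ.*-distribˡ-+ c (ℤS.S n f) (f (suc n))))

pos-S : ∀ n f → + S n f ≡ ℤS.S n (λ k → + f k)
pos-S zero f = refl
pos-S (suc n) f = cong (ℤ._+ + f (suc n)) (pos-S n f)

pos-when : ∀ {P : Set} (d : Dec P) v → + when d v ≡ ℤS.when d (+ v)
pos-when (yes _) v = refl
pos-when (no _) v = refl

∣S∣≤ : ∀ n f → ∣ ℤS.S n f ∣ ≤ S n (λ k → ∣ f k ∣)
∣S∣≤ zero f = z≤n
∣S∣≤ (suc n) f = ≤-trans (ℤₚ.∣i+j∣≤∣i∣+∣j∣ (ℤS.S n f) (f (suc n))) (+-monoˡ-≤ ∣ f (suc n) ∣ (∣S∣≤ n f))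

ℤS-neg : ∀ n f → ℤS.S n (λ k → ℤ.- f k) ≡ ℤ.- ℤS.S n f
ℤS-neg zero f = refl
ℤS-neg (suc n) f = trans (cong (ℤ._+ (ℤ.- f (suc n))) (ℤS-neg n f))
  (sym (ℤₚ.neg-distrib-+ (ℤS.S n f) (f (suc n))))

ℤ-when-* : ∀ {P : Set} (d : Dec P) (a b : ℤ) → ℤS.when d (a ℤ.* b) ≡ b ℤ.* ℤS.when d a
ℤ-when-* (yes _) a b = ℤₚ.*-comm a b
ℤ-when-* (no _) a b = sym (ℤₚ.*-zeroʳ b)

*÷-cancel : ∀ {p} m → 1 ≤ p → p * m ÷ p ≡ m
*÷-cancel {p} m h = ÷-unique (p * m) h (≤-reflexive (*-comm m p)) (≤-trans (s≤s (≤-reflexive (*-comm p m)))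
  (+-monoˡ-≤ (m * p) h))

-- sieve k is the coefficient sequence of the Dirichlet polynomial ∏ (1 − p⁻ˢ) over primes p ≤ k,
-- so that it agrees with the Möbius function up to k.
sieve : ℕ → ℕ → ℤ
sieve zero n = ℤS.when (1 ≟ n) (+ 1)
sieve (suc k) n = sieve k n ℤ.+ ℤ.- ℤS.when (prime? (suc k)) (ℤS.when (suc k ∣? n) (sieve k (n ÷ suc k)))

unsieved : ℕ → ℕ → ℤ
unsieved zero n = + 1
unsieved (suc k) n = unsieved k n ℤ.+ ℤ.- ℤS.when (prime? (suc k)) (ℤS.when (suc k ∣? n) (unsieved k n))

private
  -‿self : ∀ (a : ℤ) → a ℤ.+ ℤ.- a ≡ + 0
  -‿self = ℤₚ.+-inverseʳ

  prime∣÷ : ∀ {p r n} → Prime p → Prime r → r ≢ p → p ∣ n → r ∣ n → r ∣ n ÷ p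
  prime∣÷ {p} {r} pp pr ne (divides q refl) h with euclidsLemma q p pr h
  ... | inj₁ h' = subst (r ∣_) (sym (trans (cong (_÷ p) (*-comm q p)) (*÷-cancel q (prime≥1 pp)))) h'
  ... | inj₂ h' = ⊥-elim (prime∤prime pr pp ne h')

sieve-step : ∀ k n → sieve (suc k) n ≡ sieve k n ⊎
  (Prime (suc k) × suc k ∣ n × sieve (suc k) n ≡ sieve k n ℤ.+ ℤ.- sieve k (n ÷ suc k))
sieve-step k n = go (prime? (suc k)) (suc k ∣? n)
  where
  go : (d : Dec (Prime (suc k))) (e : Dec (suc k ∣ n)) →
    let v = sieve k n ℤ.+ ℤ.- ℤS.when d (ℤS.when e (sieve k (n ÷ suc k))) in
    v ≡ sieve k n ⊎ (Prime (suc k) × suc k ∣ n × v ≡ sieve k n ℤ.+ ℤ.- sieve k (n ÷ suc k))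
  go (no _) _ = inj₁ (ℤₚ.+-identityʳ (sieve k n))
  go (yes _) (no _) = inj₁ (ℤₚ.+-identityʳ (sieve k n))
  go (yes pp) (yes p∣n) = inj₂ (pp , p∣n , refl)

sieve-support : ∀ k {r n} → Prime r → k < r → r ∣ n → sieve k n ≡ + 0
sieve-support zero {r} {n} pr _ r∣n = ℤS.when-no (1 ≟ n) λ { refl → <-irrefl (sym (∣1⇒≡1 r∣n)) (prime≥2 pr) }
sieve-support (suc k) {r} {n} pr k<r r∣n with sieve-step k n
... | inj₁ e = trans e (sieve-support k pr (<⇒≤ k<r) r∣n)
... | inj₂ (pp , p∣n , e) = trans e (cong₂ (λ a b → a ℤ.+ ℤ.- b) (sieve-support k pr (<⇒≤ k<r) r∣n)
    (sieve-support k pr (<⇒≤ k<r) (prime∣÷ pp pr (λ e → <-irrefl (sym e) k<r) p∣n r∣n)))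

∣sieve∣≤1 : ∀ k n → ∣ sieve k n ∣ ≤ 1
∣sieve∣≤1 zero n = go (1 ≟ n)
  where go : ∀ {P : Set} (d : Dec P) → ∣ ℤS.when d (+ 1) ∣ ≤ 1
        go (yes _) = ≤-refl
        go (no _) = z≤n
∣sieve∣≤1 (suc k) n with sieve-step k n
... | inj₁ e = ≤-trans (≤-reflexive (cong ∣_∣ e)) (∣sieve∣≤1 k n)
... | inj₂ (pp , p∣n , e) = ≤-trans (≤-reflexive
  (trans (cong ∣_∣ e) (trans (cong (λ t → ∣ t ℤ.+ ℤ.- sieve k (n ÷ suc k) ∣) (sieve-support k pp ≤-refl p∣n))
    (trans (cong ∣_∣ (ℤₚ.+-identityˡ (ℤ.- sieve k (n ÷ suc k)))) (ℤₚ.∣-i∣≡∣i∣ (sieve k (n ÷ suc k)))))))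
      (∣sieve∣≤1 k (n ÷ suc k))

unsieved-stable : ∀ k {p} m → Prime p → k < p → unsieved k (p * m) ≡ unsieved k m
unsieved-stable zero m pp h = refl
unsieved-stable (suc k) {p} m pp h = cong₂ (λ a b → a ℤ.+ ℤ.- b) ih
  (ℤS.when-cong (prime? (suc k)) λ pr → trans
    (ℤS.when-⇔ (suc k ∣? p * m) (suc k ∣? m) (λ d → drop pr (euclidsLemma p m pr d)) (∣n⇒∣m*n p))
    (ℤS.when-cong (suc k ∣? m) λ _ → ih))
  where
  ih = unsieved-stable k m pp (<⇒≤ h)
  drop : Prime (suc k) → (suc k ∣ p) ⊎ (suc k ∣ m) → suc k ∣ m
  drop pr (inj₁ d) = ⊥-elim (prime∤prime pr pp (λ e → <-irrefl e h) d)
  drop pr (inj₂ d) = d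

unsieved-zero : ∀ k {r n} → Prime r → r ≤ k → r ∣ n → unsieved k n ≡ + 0
unsieved-zero zero pr r≤0 _ = ⊥-elim (<⇒≱ (prime≥1 pr) r≤0)
unsieved-zero (suc k) {r} {n} pr r≤k r∣n with r ≟ suc k
... | yes refl = trans (cong (λ t → unsieved k n ℤ.+ ℤ.- t) (trans (ℤS.when-yes (prime? (suc k)) pr)
  (ℤS.when-yes (suc k ∣? n) r∣n))) (-‿self (unsieved k n))
... | no ne = trans (cong (λ t → t ℤ.+ ℤ.- ℤS.when (prime? (suc k)) (ℤS.when (suc k ∣? n) t))
  (unsieved-zero k pr (≤-pred (≤∧≢⇒< r≤k ne)) r∣n)) (vanish (prime? (suc k)) (suc k ∣? n))
  where vanish : ∀ {P Q : Set} (d : Dec P) (e : Dec Q) → + 0 ℤ.+ ℤ.- ℤS.when d (ℤS.when e (+ 0)) ≡ + 0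
        vanish (yes _) (yes _) = refl
        vanish (yes _) (no _) = refl
        vanish (no _) _ = refl

unsieved-one : ∀ k → unsieved k 1 ≡ + 1
unsieved-one zero = refl
unsieved-one (suc k) = trans (cong₂ (λ a b → a ℤ.+ ℤ.- b) (unsieved-one k)
  (trans (ℤS.when-cong (prime? (suc k)) λ pr → ℤS.when-no (suc k ∣? 1) {unsieved k 1} λ d → <-irrefl
    (sym (∣1⇒≡1 d)) (prime≥2 pr)) (go (prime? (suc k))))) refl
  where go : ∀ {P : Set} (d : Dec P) → ℤS.when d (+ 0) ≡ + 0
        go (yes _) = refl
        go (no _) = refl

S-sieve : ∀ k n → 1 ≤ n → ℤS.S n (λ d → ℤS.when (d ∣? n) (sieve k d)) ≡ unsieved k n
S-sieve zero n 1≤n = trans (ℤS.S-cong n λ d _ _ → comm (d ∣? n) (1 ≟ d))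
  (trans (ℤS.S-point n 1 (λ d → ℤS.when (d ∣? n) (+ 1)) ≤-refl 1≤n)
    (ℤS.when-yes (1 ∣? n) (divides n (sym (*-identityʳ n)))))
  where comm : ∀ {P Q : Set} (d : Dec P) (e : Dec Q) → ℤS.when d (ℤS.when e (+ 1)) ≡ ℤS.when e
          (ℤS.when d (+ 1))
        comm (yes _) (yes _) = refl
        comm (yes _) (no _) = refl
        comm (no _) (yes _) = refl
        comm (no _) (no _) = refl
S-sieve (suc k) n 1≤n = begin
  ℤS.S n (λ d → ℤS.when (d ∣? n) (sieve k d ℤ.+ ℤ.- ℤS.when (prime? p) (g d)))
    ≡⟨ ℤS.S-cong n (λ d _ _ → distribute (d ∣? n) (prime? p) (p ∣? d)) ⟩
  ℤS.S n (λ d → ℤS.when (d ∣? n) (sieve k d) ℤ.+ ℤ.- ℤS.when (prime? p)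
    (ℤS.when (p ∣? d) (ℤS.when (d ∣? n) (sieve k (d ÷ p)))))
    ≡⟨ trans (ℤS.S-∙ n _ _) (cong₂ ℤ._+_ (S-sieve k n 1≤n) (ℤS-neg n _)) ⟩
  unsieved k n ℤ.+ ℤ.- ℤS.S n (λ d → ℤS.when (prime? p) (ℤS.when (p ∣? d)
    (ℤS.when (d ∣? n) (sieve k (d ÷ p)))))
    ≡⟨ cong (λ t → unsieved k n ℤ.+ ℤ.- t) (trans (ℤS.S-when n (prime? p) _)
      (ℤS.when-cong (prime? p) removed)) ⟩
  unsieved k n ℤ.+ ℤ.- ℤS.when (prime? p) (ℤS.when (p ∣? n) (unsieved k n)) ∎
  where
  open ≡-Reasoning
  p = suc k
  g : ℕ → ℤ
  g d = ℤS.when (p ∣? d) (sieve k (d ÷ p))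
  distribute : ∀ {P Q R : Set} (d : Dec P) (e : Dec Q) (f : Dec R) {a b : ℤ} →
    ℤS.when d (a ℤ.+ ℤ.- ℤS.when e (ℤS.when f b)) ≡ ℤS.when d a ℤ.+ ℤ.- ℤS.when e (ℤS.when f (ℤS.when d b))
  distribute (yes _) e f = refl
  distribute (no _) (yes _) (yes _) = refl
  distribute (no _) (yes _) (no _) = refl
  distribute (no _) (no _) f = refl
  removed : Prime p → ℤS.S n (λ d → ℤS.when (p ∣? d) (ℤS.when (d ∣? n) (sieve k (d ÷ p)))) ≡ ℤS.when (p ∣? n)
    (unsieved k n)
  removed pp = trans (ℤS.S-multiples n {p} (s≤s z≤n) (λ d → ℤS.when (d ∣? n) (sieve k (d ÷ p)))) (go (p ∣? n))
    where
    go : (d : Dec (p ∣ n)) → ℤS.S (n ÷ p) (λ m → ℤS.when (p * m ∣? n) (sieve k (p * m ÷ p))) ≡ ℤS.when d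
      (unsieved k n)
    go (no p∤n) = ℤS.S-ε (n ÷ p) λ m _ _ → ℤS.when-no (p * m ∣? n) λ h → p∤n (m*n∣⇒m∣ p m h)
    go (yes (divides q refl)) = begin
      ℤS.S (q * p ÷ p) (λ m → ℤS.when (p * m ∣? q * p) (sieve k (p * m ÷ p)))
        ≡⟨ cong (λ t → ℤS.S t (λ m → ℤS.when (p * m ∣? q * p) (sieve k (p * m ÷ p))))
          (trans (cong (_÷ p) (*-comm q p)) (*÷-cancel q (s≤s z≤n))) ⟩
      ℤS.S q (λ m → ℤS.when (p * m ∣? q * p) (sieve k (p * m ÷ p)))
        ≡⟨ ℤS.S-cong q (λ m _ _ → trans (cong (ℤS.when (p * m ∣? q * p))
          (cong (sieve k) (*÷-cancel m (s≤s z≤n))))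
             (ℤS.when-⇔ (p * m ∣? q * p) (m ∣? q) (λ h → *-cancelˡ-∣ p (subst (p * m ∣_) (*-comm q p) h))
               (λ h → subst (p * m ∣_) (*-comm p q) (*-monoʳ-∣ p h)))) ⟩
      ℤS.S q (λ m → ℤS.when (m ∣? q) (sieve k m))
        ≡⟨ S-sieve k q (pos q 1≤n) ⟩
      unsieved k q ≡⟨ sym (unsieved-stable k q pp ≤-refl) ⟩
      unsieved k (p * q) ≡⟨ cong (unsieved k) (*-comm p q) ⟩
      unsieved k (q * p) ∎
      where
      pos : ∀ q → 1 ≤ q * p → 1 ≤ q
      pos (suc q) _ = s≤s z≤n

prime-divisor : ∀ n → 1 ≤ n → n ≡ 1 ⊎ (∃[ p ] Prime p × p ∣ n)
prime-divisor = multiplicative-induction _ (inj₁ refl) λ {p} {n} pp _ _ → inj₂ (p , pp , m∣m*n n)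

unsieved-large : ∀ {k n} → 2 ≤ n → n ≤ k → unsieved k n ≡ + 0
unsieved-large {k} {n} 2≤n n≤k with prime-divisor n (<⇒≤ 2≤n)
... | inj₁ refl = ⊥-elim (<-irrefl refl 2≤n)
... | inj₂ (p , pp , p∣n) = unsieved-zero k pp (≤-trans (∣⇒≤ {{>-nonZero (<⇒≤ 2≤n)}} p∣n) n≤k) p∣n

Möbius-bound : ∀ x (h : ℕ → ℤ) → 1 ≤ x → ∣ h 1 ∣ ≤ S x (λ d → ∣ ℤS.S (x ÷ d) (λ m → h (d * m)) ∣)
Möbius-bound x h 1≤x = begin
  ∣ h 1 ∣ ≡⟨ cong ∣_∣ (sym inversion) ⟩
  ∣ ℤS.S x (λ d → sieve x d ℤ.* G d) ∣ ≤⟨ ∣S∣≤ x _ ⟩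
  S x (λ d → ∣ sieve x d ℤ.* G d ∣) ≤⟨ S-mono x (λ d _ _ → ≤-trans
    (≤-reflexive (ℤₚ.∣i*j∣≡∣i∣*∣j∣ (sieve x d) (G d)))
    (≤-trans (*-monoˡ-≤ ∣ G d ∣ (∣sieve∣≤1 x d)) (≤-reflexive (*-identityˡ ∣ G d ∣)))) ⟩
  S x (λ d → ∣ G d ∣) ∎
  where
  open ≤-Reasoning
  G : ℕ → ℤ
  G d = ℤS.S (x ÷ d) (λ m → h (d * m))
  only-one : ∀ n → 1 ≤ n → n ≤ x → h n ℤ.* unsieved x n ≡ ℤS.when (1 ≟ n) (h n)
  only-one (suc zero) _ _ = trans (cong (h 1 ℤ.*_) (unsieved-one x)) (ℤₚ.*-identityʳ (h 1))
  only-one (suc (suc n)) _ n≤x = trans (cong (h (suc (suc n)) ℤ.*_) (unsieved-large (s≤s (s≤s z≤n)) n≤x))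
    (ℤₚ.*-zeroʳ (h (suc (suc n))))
  inversion : ℤS.S x (λ d → sieve x d ℤ.* G d) ≡ h 1
  inversion = trans (ℤS.S-cong x λ d _ _ → sym (ℤS-*ˡ (x ÷ d) (sieve x d) _))
    (trans (ℤS.S-hyperbola x (λ d n → sieve x d ℤ.* h n))
    (trans (ℤS.S-cong x λ n 1≤n n≤x → trans (ℤS.S-cong n λ d _ _ → ℤ-when-* (d ∣? n) (sieve x d) (h n))
      (trans (ℤS-*ˡ n (h n) _) (trans (cong (h n ℤ.*_) (S-sieve x n 1≤n)) (only-one n 1≤n n≤x))))
    (ℤS.S-point x 1 h ≤-refl 1≤x)))

tatuzawa-iseki : ∀ (ℓ Λ : ℕ → ℕ) → (∀ m n → 1 ≤ m → 1 ≤ n → ℓ (m * n) ≡ ℓ m + ℓ n) →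
  (∀ n → 1 ≤ n → ℓ n ≡ S n (λ d → when (d ∣? n) (Λ d))) →
  ∀ x (f : ℕ → ℤ) → 1 ≤ x →
  ∣ f 1 ℤ.* + ℓ x ℤ.+ ℤS.S x (λ n → + Λ n ℤ.* f n) ∣ ≤
  S x (λ d → ∣ + ℓ x ℤ.+ ℤ.- + ℓ d ∣ * ∣ ℤS.S (x ÷ d) (λ m → f (d * m)) ∣)
tatuzawa-iseki ℓ Λ additive divisor-sum x f 1≤x = begin
  ∣ f 1 ℤ.* + ℓ x ℤ.+ ℤS.S x (λ n → + Λ n ℤ.* f n) ∣ ≡⟨ cong ∣_∣ (sym h-one) ⟩
  ∣ h 1 ∣ ≤⟨ Möbius-bound x h 1≤x ⟩
  S x (λ d → ∣ ℤS.S (x ÷ d) (λ m → h (d * m)) ∣) ≤⟨ S-mono x (λ d 1≤d d≤x → ≤-reflexive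
    (trans (cong ∣_∣ (G-formula d 1≤d)) (ℤₚ.∣i*j∣≡∣i∣*∣j∣ (+ ℓ x ℤ.+ ℤ.- + ℓ d) _))) ⟩
  S x (λ d → ∣ + ℓ x ℤ.+ ℤ.- + ℓ d ∣ * ∣ ℤS.S (x ÷ d) (λ m → f (d * m)) ∣) ∎
  where
  open ≤-Reasoning
  h : ℕ → ℤ
  h k = f k ℤ.* (+ ℓ x ℤ.+ ℤ.- + ℓ k) ℤ.+ ℤS.S (x ÷ k) (λ n → + Λ n ℤ.* f (k * n))
  ℓ-one : ℓ 1 ≡ 0
  ℓ-one = +-cancelˡ-≡ (ℓ 1) (ℓ 1) 0 (trans (sym (additive 1 1 ≤-refl ≤-refl)) (sym (+-identityʳ (ℓ 1))))
  h-one : h 1 ≡ f 1 ℤ.* + ℓ x ℤ.+ ℤS.S x (λ n → + Λ n ℤ.* f n)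
  h-one = cong₂ ℤ._+_ (cong (f 1 ℤ.*_) (trans (cong (λ t → + ℓ x ℤ.+ ℤ.- + t) ℓ-one)
    (ℤₚ.+-identityʳ (+ ℓ x))))
    (trans (cong (λ t → ℤS.S t (λ n → + Λ n ℤ.* f (1 * n))) (÷1 x))
      (ℤS.S-cong x λ n _ _ → cong (λ t → + Λ n ℤ.* f t) (*-identityˡ n)))
  ℓ-divisors : ∀ k → 1 ≤ k → ∀ v → ℤS.S k (λ n → ℤS.when (n ∣? k) (+ Λ n ℤ.* v)) ≡ v ℤ.* + ℓ k
  ℓ-divisors k 1≤k v = trans (ℤS.S-cong k λ n _ _ → ℤ-when-* (n ∣? k) (+ Λ n) v)
    (trans (ℤS-*ˡ k v _) (cong (v ℤ.*_) (sym
      (trans (cong +_ (divisor-sum k 1≤k)) (trans (pos-S k _)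
      (ℤS.S-cong k λ n _ _ → pos-when (n ∣? k) (Λ n)))))))
  G-formula : ∀ d → 1 ≤ d → ℤS.S (x ÷ d) (λ m → h (d * m)) ≡ (+ ℓ x ℤ.+ ℤ.- + ℓ d) ℤ.* ℤS.S (x ÷ d)
    (λ m → f (d * m))
  G-formula d 1≤d = trans (ℤS.S-∙ y _ _) (trans
    (cong (λ t → ℤS.S y (λ m → f (d * m) ℤ.* (+ ℓ x ℤ.+ ℤ.- + ℓ (d * m))) ℤ.+ t) second)
    (trans (sym (ℤS.S-∙ y _ _)) (trans (ℤS.S-cong y λ k 1≤k _ → combine k 1≤k)
      (ℤS-*ˡ y (+ ℓ x ℤ.+ ℤ.- + ℓ d) _))))
    where
    y = x ÷ d
    second : ℤS.S y (λ m → ℤS.S (x ÷ (d * m)) (λ n → + Λ n ℤ.* f (d * m * n))) ≡ ℤS.S y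
      (λ k → f (d * k) ℤ.* + ℓ k)
    second = trans (ℤS.S-cong y λ m 1≤m _ → trans (cong (λ t → ℤS.S t (λ n → + Λ n ℤ.* f (d * m * n)))
      (sym (÷-÷ x 1≤d 1≤m)))
        (ℤS.S-cong (y ÷ m) λ n _ _ → cong (λ t → + Λ n ℤ.* f t) (rearrange d m n)))
      (trans (ℤS.S-hyperbola-swap y (λ m n → + Λ n ℤ.* f (d * (n * m))))
      (trans (ℤS.S-hyperbola y (λ n k → + Λ n ℤ.* f (d * k)))
      (ℤS.S-cong y λ k 1≤k _ → ℓ-divisors k 1≤k (f (d * k)))))
      where rearrange : ∀ a b c → a * b * c ≡ a * (c * b)
            rearrange = solve-∀
    combine : ∀ k → 1 ≤ k → f (d * k) ℤ.* (+ ℓ x ℤ.+ ℤ.- + ℓ (d * k)) ℤ.+ f (d * k) ℤ.* + ℓ k ≡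
      (+ ℓ x ℤ.+ ℤ.- + ℓ d) ℤ.* f (d * k)
    combine k 1≤k = trans (cong (λ t → f (d * k) ℤ.* (+ ℓ x ℤ.+ ℤ.- + t) ℤ.+ f (d * k) ℤ.* + ℓ k)
      (additive d k 1≤d 1≤k))
      (algebra (f (d * k)) (+ ℓ x) (+ ℓ d) (+ ℓ k))
      where algebra : ∀ a b c e → a ℤ.* (b ℤ.+ ℤ.- (c ℤ.+ e)) ℤ.+ a ℤ.* e ≡ (b ℤ.+ ℤ.- c) ℤ.* a
            algebra = ℤ-Ring.solve-∀

-- Selberg’s formula

∣-∣≤ : ∀ {a b c} → a ≤ b + c → b ≤ a + c → ∣ + a ℤ.+ ℤ.- + b ∣ ≤ c
∣-∣≤ {a} {b} {c} h k with ≤-total b a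
... | inj₁ b≤a = ≤-trans (≤-reflexive (trans (cong ∣_∣ (trans (ℤₚ.m-n≡m⊖n a b) (ℤₚ.⊖-≥ b≤a))) refl))
  (m≤n+o⇒m∸n≤o a b h)
... | inj₂ a≤b = ≤-trans (≤-reflexive (trans (cong ∣_∣ (trans (ℤₚ.m-n≡m⊖n a b) (ℤₚ.⊖-≤ a≤b)))
  (ℤₚ.∣-i∣≡∣i∣ (+ (b ∸ a))))) (m≤n+o⇒m∸n≤o b a k)

∣-∣≤⁻¹ : ∀ a b c → ∣ + a ℤ.+ ℤ.- + b ∣ ≤ c → a ≤ b + c × b ≤ a + c
∣-∣≤⁻¹ a b c h with ≤-total b a
... | inj₁ b≤a = ≤-trans (≤-reflexive (sym (m+[n∸m]≡n b≤a))) (+-monoʳ-≤ b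
  (≤-trans (≤-reflexive (sym (cong ∣_∣ (trans (ℤₚ.m-n≡m⊖n a b) (ℤₚ.⊖-≥ b≤a))))) h))
    , ≤-trans b≤a (m≤m+n a c)
... | inj₂ a≤b = ≤-trans a≤b (m≤m+n b c)
    , ≤-trans (≤-reflexive (sym (m+[n∸m]≡n a≤b))) (+-monoʳ-≤ a
      (≤-trans (≤-reflexive (sym (trans (cong ∣_∣ (trans (ℤₚ.m-n≡m⊖n a b) (ℤₚ.⊖-≤ a≤b)))
      (ℤₚ.∣-i∣≡∣i∣ (+ (b ∸ a)))))) h))

S-tail : ∀ {h x} f v → h ≤ x → (∀ k → h < k → k ≤ x → f k ≡ v) → S x f + h * v ≡ S h f + x * v
S-tail {h} {x} f v h≤x tail with m≤n⇒m<n∨m≡n h≤x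
... | inj₂ refl = refl
S-tail {h} {suc x} f v _ tail | inj₁ (s≤s h≤x) = step (S x f) (h * v) (S h f) (x * v) (f (suc x)) v
  (S-tail f v h≤x λ k p q → tail k p (m≤n⇒m≤1+n q)) (tail (suc x) (s≤s h≤x) ≤-refl)
  where
  step : ∀ a b c e t v → a + b ≡ c + e → t ≡ v → a + t + b ≡ c + (v + e)
  step a b c e t .t h refl = trans (assoc₁ a t b) (trans (cong (λ w → t + w) h) (assoc₂ t c e))
    where assoc₁ : ∀ a t b → a + t + b ≡ t + (a + b)
          assoc₁ = solve-∀
          assoc₂ : ∀ t c e → t + (c + e) ≡ c + (t + e)
          assoc₂ = solve-∀

halves : ∀ x → 2 * (x ÷ 2) ≤ x
halves x = ≤-trans (≤-reflexive (*-comm 2 (x ÷ 2))) (÷-lower x 2)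

halves-upper : ∀ x → x ≤ 2 * (x ÷ 2) + 1
halves-upper x = ≤-pred (≤-trans (÷-upper x {2} (s≤s z≤n)) (≤-reflexive (rearrange (x ÷ 2))))
  where rearrange : ∀ a → suc a * 2 ≡ suc (2 * a + 1)
        rearrange = solve-∀

÷2÷ : ∀ x d → 1 ≤ d → x ÷ 2 ÷ d ≡ x ÷ d ÷ 2
÷2÷ x d h = trans (÷-÷ x (s≤s z≤n) h) (trans (cong (x ÷_) (*-comm 2 d)) (sym (÷-÷ x h (s≤s z≤n))))

÷≡0 : ∀ {h d} → h < d → h ÷ d ≡ 0
÷≡0 {h} {d} p = ÷-unique h (≤-trans (s≤s z≤n) p) z≤n (≤-trans p (≤-reflexive (sym (*-identityˡ d))))

1≤8N²≤M⇒1≤M : ∀ {M N} → 1 ≤ N → 8 * (N * N) ≤ M → 1 ≤ M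
1≤8N²≤M⇒1≤M {M} {N} h k = ≤-trans (*-mono-≤ {1} {8} (s≤s z≤n) (*-mono-≤ h h)) k

module Estimates (M N : ℕ) (1≤N : 1 ≤ N) (N²≤M : 8 * (N * N) ≤ M) where
  private
    1≤M : 1 ≤ M
    1≤M = 1≤8N²≤M⇒1≤M 1≤N N²≤M
  open Logarithm M 1≤M public
  open VonMangoldt M 1≤M public

  squares : ∀ {a b} → a ≤ N → b ≤ N → 8 * (a * b) ≤ M
  squares h k = ≤-trans (*-monoʳ-≤ 8 (*-mono-≤ h k)) N²≤M

  8N≤M : 8 * N ≤ M
  8N≤M = ≤-trans (*-monoʳ-≤ 8 (≤-trans (≤-reflexive (sym (*-identityʳ N))) (*-monoʳ-≤ N 1≤N))) N²≤M

  -- κ ≈ (1 + γ) M with γ Euler's constant.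
  κ : ℕ
  κ = M + H N ∸ L (suc N)

  κ-eq : κ + L (suc N) ≡ M + H N
  κ-eq = m∸n+n≡m (≤-trans (L≤H+n N) (≤-trans (+-monoʳ-≤ (H N) (≤-trans (m≤n*m N 8) 8N≤M))
    (≤-reflexive (+-comm (H N) M))))

  κ≤2M : κ ≤ 2 * M
  κ≤2M = step κ (L (suc N)) M (H N) κ-eq (≤-trans (H-mono (n≤1+n N)) (H≤L+M {suc N} (s≤s z≤n)))
    where
    step : ∀ k l m h → k + l ≡ m + h → h ≤ l + m → k ≤ 2 * m
    step k l m h e p = step' (≤-reflexive e)
      where
      step' : k + l ≤ m + h → k ≤ 2 * m
      step' e = lin (e ⊹ p) 0 (solve (k ∷ l ∷ m ∷ h ∷ []))

  private
    L-H-lower : ∀ m j → L (suc (j + m)) + H m ≤ L (suc m) + H (j + m) + j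
    L-H-lower m zero = ≤-trans (≤-reflexive refl) (m≤m+n _ 0)
    L-H-lower m (suc j) = step (L (suc (j + m))) (L (suc (suc (j + m)))) (H m) (L (suc m)) (H (j + m))
      (r (suc (j + m)))
      (L-H-lower m j) (L-step-upper {suc (j + m)} (s≤s z≤n))
      where
      step : ∀ a b h l g q → a + h ≤ l + g + j → b ≤ suc (a + q) → b + h ≤ l + (g + q) + suc j
      step a b h l g q p k = lin (p ⊹ k) 0 (solve (j ∷ a ∷ b ∷ h ∷ l ∷ g ∷ q ∷ []))

    L-H-upper : ∀ m j → L (suc m) + H (j + m) + r (suc (j + m)) ≤ L (suc (j + m)) + H m + r (suc m)
    L-H-upper m zero = ≤-refl
    L-H-upper m (suc j) = step (L (suc (j + m))) (L (suc (suc (j + m)))) (H m) (L (suc m)) (H (j + m))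
      (r (suc (j + m))) (r (suc (suc (j + m)))) (r (suc m))
      (L-H-upper m j) (L-step-lower {suc (j + m)} (s≤s z≤n))
      where
      step : ∀ a b h l g q s t → l + g + q ≤ a + h + t → a + s ≤ b → l + (g + q) + s ≤ b + h + t
      step a b h l g q s t p k = lin (p ⊹ k) 0 (solve (a ∷ b ∷ h ∷ l ∷ g ∷ q ∷ s ∷ t ∷ []))

    N-split : ∀ {m} → m ≤ N → N ∸ m + m ≡ N
    N-split = m∸n+n≡m

  H≤L+κ : ∀ {m} → m ≤ N → H m + M ≤ L (suc m) + κ + N
  H≤L+κ {m} m≤N = step (H m) (L (suc m)) κ (L (suc N)) (H N) (N ∸ m)
    (subst (λ n → L (suc n) + H m ≤ L (suc m) + H n + (N ∸ m)) (N-split m≤N) (L-H-lower m (N ∸ m)))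
    (≤-reflexive (sym κ-eq)) (m∸n≤m N m)
    where
    step : ∀ h l k a b j → a + h ≤ l + b + j → M + b ≤ k + a → j ≤ N → h + M ≤ l + k + N
    step h l k a b j p q s = lin (p ⊹ q ⊹ s) 0 (solve (M ∷ N ∷ h ∷ l ∷ k ∷ a ∷ b ∷ j ∷ []))

  L+κ≤H : ∀ {m} → m ≤ N → L (suc m) + κ ≤ H m + M + r (suc m)
  L+κ≤H {m} m≤N = step (H m) (L (suc m)) κ (L (suc N)) (H N) (r (suc m)) (r (suc N))
    (subst (λ n → L (suc m) + H n + r (suc n) ≤ L (suc n) + H m + r (suc m)) (N-split m≤N)
      (L-H-upper m (N ∸ m)))
    (≤-reflexive κ-eq)
    where
    step : ∀ h l k a b s t → l + b + t ≤ a + h + s → k + a ≤ M + b → l + k ≤ h + M + s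
    step h l k a b s t p q = lin (p ⊹ q) t (solve (M ∷ h ∷ l ∷ k ∷ a ∷ b ∷ s ∷ t ∷ []))

  T-upper : ∀ {m} → m ≤ N → T m + κ * m ≤ m * H m + H m + M
  T-upper {m} m≤N = ≤-trans (go m m≤N) (+-monoʳ-≤ (m * H m + H m)
    (≤-trans (m≤n*m (m * m) 8) (squares m≤N m≤N)))
    where
    go : ∀ m → m ≤ N → T m + κ * m ≤ m * H m + H m + m * m
    go zero _ = ≤-reflexive (trans (*-zeroʳ κ) refl)
    go (suc m) m≤N = step (T m) κ (H m) (r (suc m)) (ℓ (suc m)) (L (suc m)) (go m (<⇒≤ m≤N)) (L+κ≤H (<⇒≤ m≤N))
      (ℓ≤L (suc m) (s≤s z≤n)) (H-step-bounds m)
      where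
      step : ∀ t k h q l l' → t + k * m ≤ m * h + h + m * m → l' + k ≤ h + M + q → l ≤ l' → M ≤ suc m * q + m
        →
        t + l + k * suc m ≤ suc m * (h + q) + (h + q) + suc m * suc m
      step t k h q l l' p1 p2 p3 p4 = lin (p1 ⊹ p2 ⊹ p3 ⊹ p4) (1 + m)
        (solve (M ∷ m ∷ t ∷ k ∷ h ∷ q ∷ l ∷ l' ∷ []))

  T-lower : ∀ {m} → m ≤ N → m * H m ≤ T m + κ * m + M
  T-lower {m} m≤N = ≤-trans (go m m≤N) (+-monoʳ-≤ (T m + κ * m)
    (≤-trans (≤-reflexive (*-comm (2 * m) N)) (≤-trans (rearr (squares {N} {m} ≤-refl m≤N)) ≤-refl)))
    where
    rearr : 8 * (N * m) ≤ M → N * (2 * m) ≤ M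
    rearr h = lin/ 4 (h) (3 * M) (solve (M ∷ N ∷ m ∷ []))
    go : ∀ m → m ≤ N → m * H m ≤ T m + κ * m + 2 * m * N
    go zero _ = z≤n
    go (suc m) m≤N = step (T m) κ (H m) (r (suc m)) (ℓ (suc m)) (L (suc m)) (go m (<⇒≤ m≤N)) (H≤L+κ (<⇒≤ m≤N))
      (L≤ℓ+n (suc m) (s≤s z≤n)) (*r≤M (suc m)) m≤N
      where
      step : ∀ t k h q l l' → m * h ≤ t + k * m + 2 * m * N → h + M ≤ l' + k + N → l' ≤ l + suc m → suc m * q
        ≤ M → suc m ≤ N →
        suc m * (h + q) ≤ t + l + k * suc m + 2 * suc m * N
      step t k h q l l' p1 p2 p3 p4 p5 = lin (p1 ⊹ p2 ⊹ p3 ⊹ p4 ⊹ p5) 0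
        (solve (M ∷ N ∷ m ∷ t ∷ k ∷ h ∷ q ∷ l ∷ l' ∷ []))

  S-H² : ∀ x c → S x (λ d → (H (x ÷ d) + c * M) * (H (x ÷ d) + c * M)) ≤ M * M * x * (c * c + 4 * c + 6)
  S-H² = <-rec _ go
    where
    go : ∀ x → (∀ {y} → y < x → ∀ c → S y (λ d → (H (y ÷ d) + c * M) * (H (y ÷ d) + c * M)) ≤ M * M * y *
      (c * c + 4 * c + 6)) →
      ∀ c → S x (λ d → (H (x ÷ d) + c * M) * (H (x ÷ d) + c * M)) ≤ M * M * x * (c * c + 4 * c + 6)
    go zero _ c = z≤n
    go x@(suc _) ih c = step M x h c (S x f') (S h f') _
      (S-mono x λ d 1≤d _ → let le = bound d 1≤d in *-mono-≤ le le)
      (≤-reflexive (S-tail f' (suc c * M * (suc c * M)) (÷≤ x 2) λ k h<k _ → cong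
        (λ t → (H t + suc c * M) * (H t + suc c * M)) (÷≡0 h<k)))
      (ih (÷-half-< x (s≤s z≤n)) (suc c)) (halves x)
      where
      h = x ÷ 2
      f' : ℕ → ℕ
      f' d = (H (h ÷ d) + suc c * M) * (H (h ÷ d) + suc c * M)
      ÷-half-< : ∀ x → 1 ≤ x → x ÷ 2 < x
      ÷-half-< x 1≤x = half-< (x ÷ 2) x 1≤x (halves x)
        where half-< : ∀ h x → 1 ≤ x → 2 * h ≤ x → h < x
              half-< zero x p q = p
              half-< (suc h) x p q = lin (q) h (solve (h ∷ x ∷ []))
      bound : ∀ d → 1 ≤ d → H (x ÷ d) + c * M ≤ H (h ÷ d) + suc c * M
      bound d 1≤d = ≤-trans (+-monoˡ-≤ (c * M) (H-halve (x ÷ d))) (≤-reflexive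
        (trans (cong (λ t → M + H t + c * M) (sym (÷2÷ x d 1≤d))) (rearrange M (H (h ÷ d)) (c * M))))
        where rearrange : ∀ a b c → a + b + c ≡ b + (a + c)
              rearrange = solve-∀
      step : ∀ M x h c s s' t → t ≤ s → s + h * (suc c * M * (suc c * M)) ≤ s' + x * (suc c * M * (suc c * M))
        →
        s' ≤ M * M * h * (suc c * suc c + 4 * suc c + 6) → 2 * h ≤ x → t ≤ M * M * x * (c * c + 4 * c + 6)
      step M x h c s s' t p1 p2 p3 p4 = lin (p1 ⊹ p2 ⊹ p3 ⊹ (5 * M * M + 2 * M * M * c) ⊛ p4) 0
        (solve (M ∷ x ∷ h ∷ c ∷ s ∷ s' ∷ t ∷ []))

  module _ {x : ℕ} (1≤x : 1 ≤ x) (x≤N : x ≤ N) where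
    private
      f : ℕ → ℤ
      f k = + (ψ (x ÷ k) + κ) ℤ.+ ℤ.- + (x * r k)

      module _ (d : ℕ) (1≤d : 1 ≤ d) (d≤x : d ≤ x) where
        y = x ÷ d
        R = S y (λ m → r (d * m))

        F-formula : ℤS.S y (λ m → f (d * m)) ≡ + (T y + κ * y) ℤ.+ ℤ.- + (x * R)
        F-formula = trans (ℤS.S-∙ y _ _) (cong₂ ℤ._+_
          (trans (sym (pos-S y _)) (cong +_ (trans (S-∙ y _ _) (cong₂ _+_
            (trans (S-cong y λ m 1≤m _ → cong ψ (sym (÷-÷ x 1≤d 1≤m))) (T-ψ y))
            (trans (S-const y κ) (*-comm y κ))))))
          (trans (ℤS-neg y _) (cong ℤ.-_ (trans (sym (pos-S y _)) (cong +_ (S-*ˡ y x _))))))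

        yd≤x : y * d ≤ x
        yd≤x = ÷-lower x d

        y≤N : y ≤ N
        y≤N = ≤-trans (÷≤ x d) x≤N

        dR≤H : d * R ≤ H y
        dR≤H = ≤-trans (≤-reflexive (sym (S-*ˡ y d _))) (S-mono y λ m 1≤m _ →
          ÷-greatest M 1≤m (≤-trans (≤-reflexive (rearrange d (r (d * m)) m)) (÷-lower M (d * m))))
          where rearrange : ∀ d q m → d * q * m ≡ q * (d * m)
                rearrange = solve-∀

        H≤dR : H y ≤ d * R + y * d
        H≤dR = ≤-trans (S-mono y λ m 1≤m _ → term m 1≤m) (≤-reflexive
          (trans (S-∙ y _ _) (cong₂ _+_ (S-*ˡ y d _) (S-const y d))))
          where
          term : ∀ m → 1 ≤ m → r m ≤ d * r (d * m) + d
          term m 1≤m = ≤-trans (<⇒≤ (÷-upper (r m) 1≤d)) (≤-reflexive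
            (trans (cong (λ t → suc t * d) (trans (÷-÷ M 1≤m 1≤d) (cong (M ÷_) (*-comm m d))))
            (rearrange (r (d * m)) d)))
            where rearrange : ∀ a d → suc a * d ≡ d * a + d
                  rearrange = solve-∀

        x<dy+d : x ≤ suc y * d
        x<dy+d = <⇒≤ (÷-upper x 1≤d)

        F-bound : ∣ ℤS.S y (λ m → f (d * m)) ∣ ≤ H y + 2 * M
        F-bound = ≤-trans (≤-reflexive (cong ∣_∣ F-formula)) (∣-∣≤
          (upper (T y + κ * y) (H y) R y (T-upper y≤N) H≤dR yd≤x (squares x≤N y≤N))
          (lower (T y + κ * y) (H y) R y (T-lower y≤N) dR≤H x<dy+d))
          where
          upper : ∀ t h R y → t ≤ y * h + h + M → h ≤ d * R + y * d → y * d ≤ x → 8 * (x * y) ≤ M → t ≤ x * R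
            + (h + 2 * M)
          upper t h R y p1 p2 p3 p4 = lin/ 8 (8 ⊛ p1 ⊹ (8 * y) ⊛ p2 ⊹ (8 * R + 8 * y) ⊛ p3 ⊹ p4) (7 * M)
            (solve (M ∷ x ∷ d ∷ t ∷ h ∷ R ∷ y ∷ []))
          lower : ∀ t h R y → y * h ≤ t + M → d * R ≤ h → x ≤ suc y * d → x * R ≤ t + (h + 2 * M)
          lower t h R y p1 p2 p3 = lin (p1 ⊹ (1 + y) ⊛ p2 ⊹ R ⊛ p3) M (solve (M ∷ x ∷ d ∷ t ∷ h ∷ R ∷ y ∷ []))

        ℓ-bound : ∣ + ℓ x ℤ.+ ℤ.- + ℓ d ∣ ≤ H y + 2 * M
        ℓ-bound = ∣-∣≤
          (upper (ℓ x) (ℓ d) (L d) (L (suc y)) (H y) y (≤-trans (ℓ≤L x 1≤x)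
            (≤-trans (L-mono 1≤x x<dy+d) (L-*-upper {suc y} {d} (s≤s z≤n) 1≤d))) (L≤ℓ+n d 1≤d) (L≤H+n y)
            (≤-trans d≤x x≤N) y≤N 1≤N)
          (lower (ℓ x) (ℓ d) (H y) (≤-trans (ℓ≤L d 1≤d) (≤-trans (L-mono 1≤d d≤x) (L≤ℓ+n x 1≤x))))
          where
          upper : ∀ a b l l' h y → a ≤ suc (l' + l) → l ≤ b + d → l' ≤ h + y → d ≤ N → y ≤ N → 1 ≤ N → a ≤ b +
            (h + 2 * M)
          upper a b l l' h y p1 p2 p3 p4 p5 p6 = go 8N≤M
            where
            go : 8 * N ≤ M → a ≤ b + (h + 2 * M)
            go p7 = lin/ 8 (8 ⊛ p1 ⊹ 8 ⊛ p2 ⊹ 8 ⊛ p3 ⊹ 8 ⊛ p4 ⊹ 8 ⊛ p5 ⊹ 8 ⊛ p6 ⊹ 3 ⊛ p7) (13 * M)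
              (solve (M ∷ N ∷ d ∷ a ∷ b ∷ l ∷ l' ∷ h ∷ y ∷ []))
          lower : ∀ a b h → b ≤ a + x → b ≤ a + (h + 2 * M)
          lower a b h p1 = go 8N≤M x≤N
            where
            go : 8 * N ≤ M → x ≤ N → b ≤ a + (h + 2 * M)
            go p2 p3 = lin/ 8 (8 ⊛ p1 ⊹ p2 ⊹ 8 ⊛ p3) (15 * M + 8 * h) (solve (M ∷ N ∷ x ∷ a ∷ b ∷ h ∷ []))

    private
      A B : ℕ
      A = (ψ x + κ) * ℓ x + S x (λ n → Λ n * (ψ (x ÷ n) + κ))
      B = x * M * ℓ x + x * S x (λ n → Λ n * r n)

      A-B : f 1 ℤ.* + ℓ x ℤ.+ ℤS.S x (λ n → + Λ n ℤ.* f n) ≡ + A ℤ.+ ℤ.- + B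
      A-B = trans (cong₂ ℤ._+_
          (trans (ℤ-distrib (ψ (x ÷ 1) + κ) (x * r 1) (ℓ x)) (cong₂
            (λ a b → + ((ψ a + κ) * ℓ x) ℤ.+ ℤ.- + (x * b * ℓ x)) (÷1 x) r-one))
          (trans (ℤS.S-cong x λ n _ _ → ℤ-distribˡ (Λ n) (ψ (x ÷ n) + κ) (x * r n))
            (trans (ℤS.S-∙ x _ _) (cong₂ ℤ._+_ (sym (pos-S x _))
            (trans (ℤS-neg x _) (cong ℤ.-_ (trans (sym (pos-S x _))
              (cong +_ (trans (S-cong x λ n _ _ → rearrange (Λ n) x (r n)) (S-*ˡ x x _))))))))))
        (regroup (+ ((ψ x + κ) * ℓ x)) (+ (x * M * ℓ x)) (+ S x (λ n → Λ n * (ψ (x ÷ n) + κ)))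
          (+ (x * S x (λ n → Λ n * r n))))
        where
        rearrange : ∀ a b c → a * (b * c) ≡ b * (a * c)
        rearrange = solve-∀
        ring₁ : ∀ a b c → (a ℤ.+ ℤ.- b) ℤ.* c ≡ a ℤ.* c ℤ.+ ℤ.- (b ℤ.* c)
        ring₁ = ℤ-Ring.solve-∀
        ℤ-distrib : ∀ a b c → (+ a ℤ.+ ℤ.- + b) ℤ.* + c ≡ + (a * c) ℤ.+ ℤ.- + (b * c)
        ℤ-distrib a b c = trans (ring₁ (+ a) (+ b) (+ c)) (cong₂ (λ u v → u ℤ.+ ℤ.- v) (sym (ℤₚ.pos-* a c))
          (sym (ℤₚ.pos-* b c)))
        ring₂ : ∀ a b c → c ℤ.* (a ℤ.+ ℤ.- b) ≡ c ℤ.* a ℤ.+ ℤ.- (c ℤ.* b)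
        ring₂ = ℤ-Ring.solve-∀
        ℤ-distribˡ : ∀ c a b → + c ℤ.* (+ a ℤ.+ ℤ.- + b) ≡ + (c * a) ℤ.+ ℤ.- + (c * b)
        ℤ-distribˡ c a b = trans (ring₂ (+ a) (+ b) (+ c)) (cong₂ (λ u v → u ℤ.+ ℤ.- v) (sym (ℤₚ.pos-* c a))
          (sym (ℤₚ.pos-* c b)))
        regroup : ∀ a b c e → (a ℤ.+ ℤ.- b) ℤ.+ (c ℤ.+ ℤ.- e) ≡ (a ℤ.+ c) ℤ.+ ℤ.- (b ℤ.+ e)
        regroup = ℤ-Ring.solve-∀

    selberg-raw : A ≤ B + 18 * (M * M * x) × B ≤ A + 18 * (M * M * x)
    selberg-raw = ∣-∣≤⁻¹ A B _ (≤-trans (≤-reflexive (cong ∣_∣ (sym A-B)))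
      (≤-trans (tatuzawa-iseki ℓ Λ ℓ-* (λ _ _ → refl) x f 1≤x)
      (≤-trans (S-mono x λ d 1≤d d≤x → *-mono-≤ (ℓ-bound d 1≤d d≤x) (F-bound d 1≤d d≤x))
      (≤-trans (S-H² x 2) (≤-reflexive (*-comm (M * M * x) 18))))))

half-< : ∀ x → 1 ≤ x → x ÷ 2 < x
half-< x 1≤x = step (x ÷ 2) x 1≤x (halves x)
  where step : ∀ h x → 1 ≤ x → 2 * h ≤ x → h < x
        step zero x p q = p
        step (suc h) x p q = lin (q) h (solve (h ∷ x ∷ []))

÷-half-upper : ∀ x n → 1 ≤ n → x ÷ n ≤ 2 * (x ÷ 2 ÷ n) + 1
÷-half-upper x n 1≤n = subst (λ t → x ÷ n ≤ 2 * t + 1) (sym (÷2÷ x n 1≤n)) (halves-upper (x ÷ n))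

÷-half-lower : ∀ x n → 1 ≤ n → 2 * (x ÷ 2 ÷ n) ≤ x ÷ n
÷-half-lower x n 1≤n = subst (λ t → 2 * t ≤ x ÷ n) (sym (÷2÷ x n 1≤n)) (halves (x ÷ n))

module Chebyshev (M N : ℕ) (1≤N : 1 ≤ N) (N²≤M : 8 * (N * N) ≤ M) where
  open Estimates M N 1≤N N²≤M public

  private
    T-half : ∀ x → 2 * T (x ÷ 2) ≡ S x (λ n → 2 * (x ÷ 2 ÷ n) * Λ n)
    T-half x = trans (cong (2 *_) (T-floor (x ÷ 2))) (trans (sym (S-*ˡ (x ÷ 2) 2 _))
      (trans (S-cong (x ÷ 2) λ n _ _ → sym (*-assoc 2 (x ÷ 2 ÷ n) (Λ n)))
      (sym (S-extend _ (÷≤ x 2) λ n h<n _ → cong (λ t → 2 * t * Λ n) (÷≡0 h<n)))))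

  ψ+T-half≤ : ∀ x → ψ x + 2 * T (x ÷ 2) ≤ ψ (x ÷ 2) + T x
  ψ+T-half≤ x = begin
    ψ x + 2 * T h ≡⟨ cong (λ t → ψ x + t) (T-half x) ⟩
    ψ x + S x (λ n → 2 * (h ÷ n) * Λ n) ≡⟨ sym (S-∙ x _ _) ⟩
    S x (λ n → Λ n + 2 * (h ÷ n) * Λ n) ≤⟨ S-mono x (λ n 1≤n n≤x → term n 1≤n n≤x) ⟩
    S x (λ n → when (n ≤? h) (Λ n) + (x ÷ n) * Λ n) ≡⟨ S-∙ x _ _ ⟩
    S x (λ n → when (n ≤? h) (Λ n)) + S x (λ n → (x ÷ n) * Λ n)
      ≡⟨ cong₂ _+_ (trans (S-extend _ (÷≤ x 2) λ n h<n _ → when-no (n ≤? h) (<⇒≱ h<n))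
        (S-cong h λ n _ n≤h → when-yes (n ≤? h) n≤h)) (sym (T-floor x)) ⟩
    ψ h + T x ∎
    where
    open ≤-Reasoning
    h = x ÷ 2
    term : ∀ n → 1 ≤ n → n ≤ x → Λ n + 2 * (h ÷ n) * Λ n ≤ when (n ≤? h) (Λ n) + (x ÷ n) * Λ n
    term n 1≤n n≤x with ≤-<-connex n h
    ... | inj₁ n≤h = ≤-trans (+-monoʳ-≤ (Λ n) (*-monoˡ-≤ (Λ n) (÷-half-lower x n 1≤n)))
      (≤-reflexive (cong (_+ x ÷ n * Λ n) (sym (when-yes (n ≤? h) n≤h))))
    ... | inj₂ h<n = ≤-trans (≤-reflexive (trans (cong (λ t → Λ n + 2 * t * Λ n) (÷≡0 h<n))
      (trans (+-identityʳ (Λ n)) (sym (*-identityˡ (Λ n))))))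
                      (≤-trans (*-monoˡ-≤ (Λ n) (÷-pos 1≤n n≤x)) (m≤n+m _ _))

  T≤T-half+ψ : ∀ x → T x ≤ 2 * T (x ÷ 2) + ψ x
  T≤T-half+ψ x = begin
    T x ≡⟨ T-floor x ⟩
    S x (λ n → (x ÷ n) * Λ n) ≤⟨ S-mono x (λ n 1≤n _ → ≤-trans (*-monoˡ-≤ (Λ n) (÷-half-upper x n 1≤n))
      (≤-reflexive (expand (2 * (x ÷ 2 ÷ n)) (Λ n)))) ⟩
    S x (λ n → 2 * (x ÷ 2 ÷ n) * Λ n + Λ n) ≡⟨ S-∙ x _ _ ⟩
    S x (λ n → 2 * (x ÷ 2 ÷ n) * Λ n) + ψ x ≡⟨ cong (_+ ψ x) (sym (T-half x)) ⟩
    2 * T (x ÷ 2) + ψ x ∎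
    where open ≤-Reasoning
          expand : ∀ a b → (a + 1) * b ≡ a * b + b
          expand = solve-∀

  T-drop : ∀ {x} → x ≤ N → 6 * T x ≤ 12 * T (x ÷ 2) + 5 * M * x + 12 * H x + 38 * M
  T-drop {x} x≤N = final x h M N (T x) (T h) κ (H x) (H h) (L 2) (L (suc h)) (L (suc x)) (r (suc h))
    (T-upper x≤N) (T-lower h≤N) (H≤L+κ x≤N) (≤-trans
      (L-mono (s≤s z≤n) (≤-trans (s≤s (halves-upper x)) (≤-reflexive (double h))))
      (L-*-upper {2} {suc h} (s≤s z≤n) (s≤s z≤n))) (L+κ≤H h≤N)
    6L2≤ (halves x) (halves-upper x) (*r≤M (suc h)) (squares h≤N ≤-refl) 8N≤M x≤N
    where
    h = x ÷ 2
    h≤N : h ≤ N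
    h≤N = ≤-trans (÷≤ x 2) x≤N
    double : ∀ h → suc (2 * h + 1) ≡ 2 * suc h
    double = solve-∀
    difference : ∀ x h M N k hx hh l2 lh lx q → hx + M ≤ lx + k + N → lx ≤ suc (l2 + lh) → lh + k ≤ hh + M + q
      → hx ≤ hh + l2 + q + N + 1
    difference x h M N k hx hh l2 lh lx q p3 p4 p5 = lin (p3 ⊹ p4 ⊹ p5) 0
      (solve (M ∷ N ∷ k ∷ hx ∷ hh ∷ l2 ∷ lh ∷ lx ∷ q ∷ []))
    spread : ∀ x h M N hx hh l2 q → hx ≤ hh + l2 + q + N + 1 → 6 * l2 ≤ 5 * M + 12 → suc h * q ≤ M → 2 * h ≤ x
      → x ≤ 2 * h + 1 →
      8 * (h * N) ≤ M → 8 * N ≤ M → x ≤ N → 6 * (x * hx) ≤ 12 * (h * hh) + 5 * M * x + 6 * hx + 20 * M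
    spread x h M N hx hh l2 q p1 p2 p3 p4 p5 p6 p7 p8 = lin/ 4 ((48 * h) ⊛ p1 ⊹ (8 * h) ⊛ p2 ⊹ 48 ⊛ p3 ⊹
      (72 + 20 * M) ⊛ p4 ⊹ (24 * hx) ⊛ p5 ⊹ 6 ⊛ p6 ⊹ 9 ⊛ p7 ⊹ 72 ⊛ p8) (17 * M + 48 * q)
      (solve (x ∷ h ∷ M ∷ N ∷ hx ∷ hh ∷ l2 ∷ q ∷ []))
    final : ∀ x h M N t u k hx hh l2 lh lx q → t + k * x ≤ x * hx + hx + M → h * hh ≤ u + k * h + M → hx + M ≤
      lx + k + N →
      lx ≤ suc (l2 + lh) → lh + k ≤ hh + M + q → 6 * l2 ≤ 5 * M + 12 → 2 * h ≤ x → x ≤ 2 * h + 1 → suc h * q ≤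
        M →
      8 * (h * N) ≤ M → 8 * N ≤ M → x ≤ N → 6 * t ≤ 12 * u + 5 * M * x + 12 * hx + 38 * M
    final x h M N t u k hx hh l2 lh lx q p1 p2 p3 p4 p5 p6 p7 p8 p9 p11 p12 p13 =
      combine (spread x h M N hx hh l2 q (difference x h M N k hx hh l2 lh lx q p3 p4 p5) p6 p9 p7 p8 p11 p12
        p13)
      where
      combine : 6 * (x * hx) ≤ 12 * (h * hh) + 5 * M * x + 6 * hx + 20 * M → 6 * t ≤ 12 * u + 5 * M * x + 12 *
        hx + 38 * M
      combine c = lin (c ⊹ 6 ⊛ p1 ⊹ 12 ⊛ p2 ⊹ (6 * k) ⊛ p7) 0 (solve (x ∷ h ∷ M ∷ t ∷ u ∷ k ∷ hx ∷ hh ∷ []))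

  ψ-halving : ∀ {x} → x ≤ N → 6 * ψ x ≤ 6 * ψ (x ÷ 2) + 5 * M * x + 12 * H x + 38 * M
  ψ-halving {x} x≤N = step (ψ x) (ψ (x ÷ 2)) (T x) (T (x ÷ 2)) (5 * M * x) (12 * H x) (38 * M) (ψ+T-half≤ x)
    (T-drop x≤N)
    where
    step : ∀ p q t u a b c → p + 2 * u ≤ q + t → 6 * t ≤ 12 * u + a + b + c → 6 * p ≤ 6 * q + a + b + c
    step p q t u a b c h1 h2 = lin (6 ⊛ h1 ⊹ h2) 0 (solve (p ∷ q ∷ t ∷ u ∷ a ∷ b ∷ c ∷ []))

  ψ≤20Mx : ∀ x → x ≤ N → ψ x ≤ 20 * M * x
  ψ≤20Mx = <-rec _ go
    where
    go : ∀ x → (∀ {y} → y < x → y ≤ N → ψ y ≤ 20 * M * y) → x ≤ N → ψ x ≤ 20 * M * x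
    go zero _ _ = z≤n
    go x@(suc x') ih x≤N = step M (ψ x) (ψ (x ÷ 2)) (H x) x (x ÷ 2) (ψ-halving x≤N)
      (ih (half-< x (s≤s z≤n)) (≤-trans (÷≤ x 2) x≤N)) (H≤Mn x) (halves x) (s≤s z≤n)
      where
      step : ∀ M p q h x y → 6 * p ≤ 6 * q + 5 * M * x + 12 * h + 38 * M → q ≤ 20 * M * y → h ≤ x * M → 2 * y
        ≤ x → 1 ≤ x → p ≤ 20 * M * x
      step M p q h x y h1 h2 h3 h4 h5 = lin/ 6 (h1 ⊹ 6 ⊛ h2 ⊹ 12 ⊛ h3 ⊹ (60 * M) ⊛ h4 ⊹ (38 * M) ⊛ h5)
        (5 * M * x) (solve (M ∷ p ∷ q ∷ h ∷ x ∷ y ∷ []))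

  ψ-chebyshev : ∀ w → 190 + 60 * 60 ≤ w → ∀ x → x ≤ N → 10 * ψ x ≤ 18 * M * x + 200 * w * M
  ψ-chebyshev w w-large = <-rec _ go
    where
    absorb : ∀ M x w g a b → g ≤ M * (x + a) → b + a ≤ w → g + b * M ≤ M * (x + w)
    absorb M x w g a b h k = lin (h ⊹ M ⊛ k) 0 (solve (M ∷ x ∷ w ∷ g ∷ a ∷ b ∷ []))
    go : ∀ x → (∀ {y} → y < x → y ≤ N → 10 * ψ y ≤ 18 * M * y + 200 * w * M) → x ≤ N → 10 * ψ x ≤ 18 * M * x +
      200 * w * M
    go x ih x≤N with ≤-<-connex x w
    ... | inj₁ small = step M x w (ψ x) (ψ≤20Mx x x≤N) small
      where
      step : ∀ M x w p → p ≤ 20 * M * x → x ≤ w → 10 * p ≤ 18 * M * x + 200 * w * M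
      step M x w p h1 h2 = lin (10 ⊛ h1 ⊹ (182 * M) ⊛ h2) (18 * M * w) (solve (M ∷ x ∷ w ∷ p ∷ []))
    ... | inj₂ large = step M x w (ψ x) (ψ (x ÷ 2)) (H x) (x ÷ 2) (ψ-halving x≤N)
      (ih (half-< x (≤-trans (s≤s z≤n) large)) (≤-trans (÷≤ x 2) x≤N))
        (absorb M x w (60 * H x) (60 * 60) 190 (H≤ 60 x (s≤s z≤n)) w-large) (halves x) (<⇒≤ large)
      where
      step : ∀ M x w p q h y → 6 * p ≤ 6 * q + 5 * M * x + 12 * h + 38 * M → 10 * q ≤ 18 * M * y + 200 * w * M
        → 60 * h + 190 * M ≤ M * (x + w) → 2 * y ≤ x → w ≤ x → 10 * p ≤ 18 * M * x + 200 * w * M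
      step M x w p q h y h1 h2 h3 h4 h5 = lin/ 3 (5 ⊛ h1 ⊹ 3 ⊛ h2 ⊹ h3 ⊹ (27 * M) ⊛ h4 ⊹ M ⊛ h5) 0
        (solve (M ∷ x ∷ w ∷ p ∷ q ∷ h ∷ y ∷ []))

  ψ-lower : ∀ {x} → x ≤ N → (x ÷ 2) * M ≤ ψ x + 2 * H (x ÷ 2) + 6 * M
  ψ-lower {x} x≤N = final (x ÷ 2) refl (halves x) (halves-upper x)
    where
    step : ∀ M x h' t u k hx hh h2 q p → let h = suc h' in x * hx ≤ t + k * x + M → u + k * h ≤ h * hh + hh +
                                               M → t ≤ 2 * u + p → h2 ≤ hx → hh + h * q ≤ h2 →
      M ≤ suc (h' + suc (h' + 0)) * q + (h' + suc (h' + 0)) → k ≤ 2 * M → 2 * h ≤ x → x ≤ 2 * h + 1 → 8 *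
        (h * h) ≤ M → h * M ≤ p + 2 * hh + 6 * M
    step M x h' t u k hx hh h2 q p p1 p2 p3 p4 p5 p6 p7 p8 p9 p10 = lin/ 4
      (4 ⊛ p1 ⊹ 8 ⊛ p2 ⊹ 4 ⊛ p3 ⊹ (8 + 8 * h') ⊛ p4 ⊹ (8 + 8 * h') ⊛ p5 ⊹ (1 + 4 * h') ⊛ p6 ⊹ 4 ⊛ p7 ⊹
      (4 * hx) ⊛ p8 ⊹ (4 * k) ⊛ p9 ⊹ p10) (7 + 10 * h' + 6 * q + 6 * h' * q)
      (solve (M ∷ x ∷ h' ∷ t ∷ u ∷ k ∷ hx ∷ hh ∷ h2 ∷ q ∷ p ∷ []))
    doubling : ∀ h → H h + h * r (2 * h) ≤ H (2 * h)
    doubling h = ≤-trans (go h ≤-refl) (≤-reflexive (cong (λ t → H (h + t)) (sym (+-identityʳ h))))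
      where
      go : ∀ j → j ≤ h → H h + j * r (2 * h) ≤ H (h + j)
      go zero _ = ≤-reflexive (trans (+-identityʳ (H h)) (cong H (sym (+-identityʳ h))))
      go (suc j) j≤h = ≤-trans (≤-reflexive (rearrange (H h) (r (2 * h)) (j * r (2 * h))))
        (≤-trans (+-mono-≤ (go j (<⇒≤ j≤h)) (÷-antiʳ M (s≤s z≤n)
          (≤-trans (≤-reflexive (sym (+-suc h j))) (≤-trans (+-monoʳ-≤ h j≤h)
          (≤-reflexive (cong (λ t → h + t) (sym (+-identityʳ h))))))))
        (≤-reflexive (cong H (sym (+-suc h j)))))
        where rearrange : ∀ a b c → a + (b + c) ≡ a + c + b
              rearrange = solve-∀
    final : ∀ h → h ≡ x ÷ 2 → 2 * h ≤ x → x ≤ 2 * h + 1 → h * M ≤ ψ x + 2 * H h + 6 * M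
    final zero _ _ _ = z≤n
    final h@(suc h') e p7 p8 = step M x h' (T x) (T h) κ (H x) (H h) (H (2 * h)) (r (2 * h)) (ψ x)
      (T-lower x≤N) (T-upper h≤N) (subst (λ t → T x ≤ 2 * T t + ψ x) (sym e) (T≤T-half+ψ x)) (H-mono p7)
        (doubling h)
      (H-step-bounds (h' + suc (h' + 0))) κ≤2M p7 p8 (squares h≤N h≤N)
      where
      h≤N : h ≤ N
      h≤N = ≤-trans (≤-trans (m≤m+n h (h + 0)) p7) x≤N

module Selberg (M N : ℕ) (1≤N : 1 ≤ N) (N²≤M : 8 * (N * N) ≤ M) where
  open Chebyshev M N 1≤N N²≤M public

  T≤ : ∀ {x} → 1 ≤ x → x ≤ N → T x ≤ x * ℓ x + M
  T≤ {x} 1≤x x≤N = step M x (T x) (ℓ x) (L x) (≤-trans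
    (S-mono x λ n 1≤n n≤x → ≤-trans (ℓ≤L n 1≤n) (L-mono 1≤n n≤x)) (≤-reflexive (S-const x (L x))))
    (L≤ℓ+n x 1≤x) (squares x≤N x≤N)
    where
    step : ∀ M x t l l' → t ≤ x * l' → l' ≤ l + x → 8 * (x * x) ≤ M → t ≤ x * l + M
    step M x t l l' h1 h2 h3 = lin/ 8 (8 ⊛ h1 ⊹ (8 * x) ⊛ h2 ⊹ h3) (7 * M) (solve (M ∷ x ∷ t ∷ l ∷ l' ∷ []))

  T≥ : ∀ {x} → 1 ≤ x → x ≤ N → x * ℓ x ≤ T x + 2 * M * x + 2 * M
  T≥ {x} 1≤x x≤N = step M x (T x) (ℓ x) (H x) κ (T-lower x≤N) (≤-trans (ℓ≤L x 1≤x)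
    (≤-trans (L-mono 1≤x (n≤1+n x)) (L≤H+n x))) κ≤2M (squares x≤N x≤N)
    where
    step : ∀ M x t l h k → x * h ≤ t + k * x + M → l ≤ h + x → k ≤ 2 * M → 8 * (x * x) ≤ M → x * l ≤ t + 2 * M
      * x + 2 * M
    step M x t l h k h1 h2 h4 h3 = lin/ 8 (8 ⊛ h1 ⊹ (8 * x) ⊛ h2 ⊹ h3 ⊹ (8 * x) ⊛ h4) (7 * M)
      (solve (M ∷ x ∷ t ∷ l ∷ h ∷ k ∷ []))

  ΣΛr : ℕ → ℕ
  ΣΛr x = S x (λ n → Λ n * r n)

  ΣΛψ : ℕ → ℕ
  ΣΛψ x = S x (λ n → Λ n * ψ (x ÷ n))

  mertens-upper : ∀ x → x * ΣΛr x ≤ M * T x + M * ψ x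
  mertens-upper x = begin
    x * ΣΛr x ≡⟨ sym (S-*ˡ x x _) ⟩
    S x (λ n → x * (Λ n * r n)) ≤⟨ S-mono x (λ n 1≤n _ → term M x (Λ n) (r n) (x ÷ n) n (÷-lower M n)
      (<⇒≤ (÷-upper x 1≤n))) ⟩
    S x (λ n → M * (x ÷ n * Λ n) + M * Λ n) ≡⟨ trans (S-∙ x _ _) (cong₂ _+_ (S-*ˡ x M _) (S-*ˡ x M _)) ⟩
    M * S x (λ n → x ÷ n * Λ n) + M * ψ x ≡⟨ cong (λ t → M * t + M * ψ x) (sym (T-floor x)) ⟩
    M * T x + M * ψ x ∎
    where
    open ≤-Reasoning
    term : ∀ M x l q y n → q * n ≤ M → x ≤ suc y * n → x * (l * q) ≤ M * (y * l) + M * l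
    term M x l q y n h1 h2 = lin ((l + l * y) ⊛ h1 ⊹ (l * q) ⊛ h2) 0 (solve (M ∷ x ∷ l ∷ q ∷ y ∷ n ∷ []))

  mertens-lower : ∀ x → M * T x ≤ x * ΣΛr x + x * ψ x
  mertens-lower x = begin
    M * T x ≡⟨ cong (M *_) (T-floor x) ⟩
    M * S x (λ n → x ÷ n * Λ n) ≡⟨ sym (S-*ˡ x M _) ⟩
    S x (λ n → M * (x ÷ n * Λ n)) ≤⟨ S-mono x (λ n 1≤n _ → term M x (Λ n) (r n) (x ÷ n) n
      (<⇒≤ (÷-upper M 1≤n)) (÷-lower x n)) ⟩
    S x (λ n → x * (Λ n * r n) + x * Λ n) ≡⟨ trans (S-∙ x _ _) (cong₂ _+_ (S-*ˡ x x _) (S-*ˡ x x _)) ⟩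
    x * ΣΛr x + x * ψ x ∎
    where
    open ≤-Reasoning
    term : ∀ M x l q y n → M ≤ suc q * n → y * n ≤ x → M * (y * l) ≤ x * (l * q) + x * l
    term M x l q y n h1 h2 = lin ((l * y) ⊛ h1 ⊹ (l + l * q) ⊛ h2) 0 (solve (M ∷ x ∷ l ∷ q ∷ y ∷ n ∷ []))

  ΣΛr≤ : ∀ {x} → 1 ≤ x → x ≤ N → ΣΛr x ≤ M * ℓ x + 21 * (M * M)
  ΣΛr≤ {x} 1≤x x≤N = *-cancelˡ-≤ x {{>-nonZero 1≤x}} (step M x (ΣΛr x) (T x) (ψ x) (ℓ x) (mertens-upper x)
    (T≤ 1≤x x≤N) (ψ≤20Mx x x≤N) 1≤x)
    where
    step : ∀ M x s t p l → x * s ≤ M * t + M * p → t ≤ x * l + M → p ≤ 20 * M * x → 1 ≤ x → x * s ≤ x *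
      (M * l + 21 * (M * M))
    step M x s t p l h1 h2 h3 h4 = lin (h1 ⊹ M ⊛ h2 ⊹ M ⊛ h3 ⊹ (M * M) ⊛ h4) 0
      (solve (M ∷ x ∷ s ∷ t ∷ p ∷ l ∷ []))

  private
    A-split : ∀ x → S x (λ n → Λ n * (ψ (x ÷ n) + κ)) ≡ ΣΛψ x + ψ x * κ
    A-split x = trans (S-cong x λ n _ _ → *-distribˡ-+ (Λ n) (ψ (x ÷ n)) κ) (trans (S-∙ x _ _)
      (cong (λ t → ΣΛψ x + t) (trans (S-cong x λ n _ _ → *-comm (Λ n) κ)
        (trans (S-*ˡ x κ Λ) (*-comm κ (ψ x))))))

  selberg-upper : ∀ {x} → 1 ≤ x → x ≤ N → ψ x * ℓ x + ΣΛψ x ≤ 2 * M * x * ℓ x + 100 * (M * M * x)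
  selberg-upper {x} 1≤x x≤N = step M x (ψ x) (ℓ x) κ _ (ΣΛψ x) (ΣΛr x) (T x) (proj₁ (selberg-raw 1≤x x≤N))
    (≤-reflexive (sym (A-split x))) (mertens-upper x) (T≤ 1≤x x≤N) (ψ≤20Mx x x≤N) 1≤x
    where
    step : ∀ M x p l k s u v t → (p + k) * l + s ≤ (x * M * l + x * v) + 18 * (M * M * x) → u + p * k ≤ s → x
      * v ≤ M * t + M * p → t ≤ x * l + M → p ≤ 20 * M * x → 1 ≤ x →
      p * l + u ≤ 2 * M * x * l + 100 * (M * M * x)
    step M x p l k s u v t h1 h2 h3 h4 h5 h6 = lin (h1 ⊹ h2 ⊹ h3 ⊹ M ⊛ h4 ⊹ M ⊛ h5 ⊹ (M * M) ⊛ h6)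
      (k * l + k * p + 61 * M * M * x) (solve (M ∷ x ∷ p ∷ l ∷ k ∷ s ∷ u ∷ v ∷ t ∷ []))

  selberg-lower : ∀ {x} → 1 ≤ x → x ≤ N → 2 * M * x * ℓ x ≤ ψ x * ℓ x + ΣΛψ x + 100 * (M * M * x)
  selberg-lower {x} 1≤x x≤N = step M x (ψ x) (ℓ x) κ _ (ΣΛψ x) (ΣΛr x) (T x) (proj₂ (selberg-raw 1≤x x≤N))
    (≤-reflexive (A-split x)) (mertens-lower x) (T≥ 1≤x x≤N) (ψ≤20Mx x x≤N) 1≤x κ≤2M
      (≤-trans (ℓ≤L x 1≤x) (≤-trans (m≤n+m (L x) M) (L-bound 1≤x))) (≤-trans x≤N (≤-trans (m≤n*m N 8) 8N≤M))
    where
    step : ∀ M x p l k s u v t → (x * M * l + x * v) ≤ ((p + k) * l + s) + 18 * (M * M * x) → s ≤ u + p * k →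
      M * t ≤ x * v + x * p → x * l ≤ t + 2 * M * x + 2 * M → p ≤ 20 * M * x → 1 ≤ x →
      k ≤ 2 * M → l ≤ x * M → x ≤ M → 2 * M * x * l ≤ p * l + u + 100 * (M * M * x)
    step M x p l k s u v t h1 h2 h3 h4 h5 h6 h7 h8 h9 = lin (h1 ⊹ h2 ⊹ h3 ⊹ M ⊛ h4 ⊹ (3 * M) ⊛ h5 ⊹
      (2 * M * M) ⊛ h6 ⊹ (l + p) ⊛ h7 ⊹ (2 * M) ⊛ h8 ⊹ p ⊛ h9) (16 * M * M * x)
      (solve (M ∷ x ∷ p ∷ l ∷ k ∷ s ∷ u ∷ v ∷ t ∷ []))

  L-difference : ∀ {a} → 1 ≤ a → ∀ j → a * L (a + j) ≤ a * L a + j * M + a * j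
  L-difference {a} 1≤a zero = ≤-trans (≤-reflexive (cong (λ t → a * L t) (+-identityʳ a)))
    (≤-trans (m≤m+n _ 0) (m≤m+n _ (a * 0)))
  L-difference {a} 1≤a (suc j) = subst (λ t → a * L t ≤ a * L a + suc j * M + a * suc j) (sym (+-suc a j))
    (step M a j (L (suc (a + j))) (L (a + j)) (r (a + j)) (L a) (L-step-upper {a + j}
      (≤-trans 1≤a (m≤m+n a j))) (L-difference 1≤a j) (*r≤M (a + j)))
    where
    step : ∀ M a j l l' q l0 → l ≤ suc (l' + q) → a * l' ≤ a * l0 + j * M + a * j → (a + j) * q ≤ M → a * l ≤
      a * l0 + suc j * M + a * suc j
    step M a j l l' q l0 h1 h2 h3 = lin (a ⊛ h1 ⊹ h2 ⊹ h3) (j * q) (solve (M ∷ a ∷ j ∷ l ∷ l' ∷ q ∷ l0 ∷ []))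

  ℓ-quasi-mono : ∀ {a b} → 1 ≤ a → a ≤ b → ℓ a ≤ ℓ b + b
  ℓ-quasi-mono {a} {b} 1≤a a≤b = ≤-trans (ℓ≤L a 1≤a) (≤-trans (L-mono 1≤a a≤b) (L≤ℓ+n b (≤-trans 1≤a a≤b)))

  aℓb≤ : ∀ {a b} → 1 ≤ a → a ≤ b → b ≤ N → a * ℓ b ≤ a * ℓ a + M * (b ∸ a) + M
  aℓb≤ {a} {b} 1≤a a≤b b≤N = step M a b (b ∸ a) (ℓ a) (ℓ b) (L a) (L b) (ℓ≤L b (≤-trans 1≤a a≤b))
    (L≤ℓ+n a 1≤a)
      (subst (λ t → a * L t ≤ a * L a + (b ∸ a) * M + a * (b ∸ a)) (m+[n∸m]≡n a≤b) (L-difference 1≤a (b ∸ a)))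
        (m∸n≤m b a) (squares (≤-trans a≤b b≤N) b≤N) a≤b
    where
    step : ∀ M a b j l l' m m' → l' ≤ m' → m ≤ l + a → a * m' ≤ a * m + j * M + a * j → j ≤ b → 8 * (a * b) ≤
      M → a ≤ b → a * l' ≤ a * l + M * j + M
    step M a b j l l' m m' h1 h2 h3 h4 h5 h6 = lin/ 4 ((4 * a) ⊛ h1 ⊹ (4 * a) ⊛ h2 ⊹ 4 ⊛ h3 ⊹ (4 * a) ⊛ h4 ⊹
      h5 ⊹ (4 * a) ⊛ h6) (3 * M) (solve (M ∷ a ∷ b ∷ j ∷ l ∷ l' ∷ m ∷ m' ∷ []))

  ΣΛψ-mono : ∀ {a b} → a ≤ b → ΣΛψ a ≤ ΣΛψ b
  ΣΛψ-mono {a} {b} h = ≤-trans (S-mono a λ n _ _ → *-monoʳ-≤ (Λ n) (S-monoˡ Λ (÷-monoˡ n h)))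
    (S-monoˡ (λ n → Λ n * ψ (b ÷ n)) h)

  brun-titchmarsh : ∀ {a b} e → 1 ≤ a → a ≤ b → b ≤ N → 207 * (e * M) ≤ ℓ b → e * ψ b + 2 * e * M * a ≤ e * ψ
    a + 2 * e * M * b + M * b
  brun-titchmarsh {a} {b} zero 1≤a a≤b b≤N big = z≤n
  brun-titchmarsh {a} {b} e@(suc _) 1≤a a≤b b≤N big =
    *-cancelʳ-≤ _ _ (ℓ b) {{>-nonZero (≤-trans
      (*-mono-≤ {1} {207} (s≤s z≤n) (*-mono-≤ {1} {e} (s≤s z≤n) (1≤8N²≤M⇒1≤M 1≤N N²≤M))) big)}}
      (step M a b (b ∸ a) e (ψ a) (ψ b) (ℓ a) (ℓ b) (ΣΛψ a) (ΣΛψ b) (selberg-upper 1≤b b≤N)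
        (selberg-lower 1≤a a≤N) (ΣΛψ-mono a≤b) (ℓ-quasi-mono 1≤a a≤b) (ψ≤20Mx a a≤N) (aℓb≤ 1≤a a≤b b≤N)
        (squares a≤N b≤N) a≤b 1≤b big (m∸n≤m b a))
    where
    1≤b = ≤-trans 1≤a a≤b
    a≤N = ≤-trans a≤b b≤N
    step : ∀ M a b j e p q l l' s s' → q * l' + s' ≤ 2 * M * b * l' + 100 * (M * M * b) → 2 * M * a * l ≤ p *
      l + s + 100 * (M * M * a) → s ≤ s' → l ≤ l' + b → p ≤ 20 * M * a →
      a * l' ≤ a * l + M * j + M → 8 * (a * b) ≤ M → a ≤ b → 1 ≤ b → 207 * (e * M) ≤ l' → j ≤ b →
      (e * q + 2 * e * M * a) * l' ≤ (e * p + 2 * e * M * b + M * b) * l'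
    step M a b j e p q l l' s s' h1 h2 h3 h4 h5 h6 h7 h8 h9 h10 h11 = lin/ 414
      ((414 * e) ⊛ h1 ⊹ (414 * e) ⊛ h2 ⊹ (414 * e) ⊛ h3 ⊹ (414 * e * p) ⊛ h4 ⊹ (414 * b * e) ⊛ h5 ⊹
      (828 * M * e) ⊛ h6 ⊹ (1035 * M * e) ⊛ h7 ⊹ (41400 * M * M * e) ⊛ h8 ⊹ (1863 * M * M * e) ⊛ h9 ⊹
      (413 * M * b) ⊛ h10 ⊹ (828 * M * M * e) ⊛ h11) (M * b * l') (solve
      (M ∷ a ∷ b ∷ j ∷ e ∷ p ∷ q ∷ l ∷ l' ∷ s ∷ s' ∷ []))

  ℓ-lower : ∀ {b} c → 2 ^ suc (2 * c) ≤ b → b ≤ N → c * M ≤ ℓ b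
  ℓ-lower {b} c h b≤N = step M N b j c (L 2) (L (2 ^ j)) (ℓ b) (r 2) (L-^ {2} (s≤s z≤n) j)
    (≤-trans (m≤n+m (r 2) (L 1)) (L-step-lower {1} ≤-refl)) (H-step-bounds 1)
      (≤-trans (L-mono (m^n>0 2 j) h) (L≤ℓ+n b (≤-trans (m^n>0 2 j) h))) refl
        (<⇒≤ (≤-trans (n<p^n (s≤s (s≤s z≤n)) j) (≤-trans h b≤N))) b≤N 8N≤M
    where
    j = suc (2 * c)
    step : ∀ M N b j c l2 lj l q → j * l2 ≤ lj → q ≤ l2 → M ≤ 2 * q + 1 → lj ≤ l + b → j ≡ suc (2 * c) → j ≤ N
      → b ≤ N → 8 * N ≤ M → c * M ≤ l
    step M N b j c l2 lj l q h1 h2 h3 h4 refl h5 h6 h7 = lin/ 16 (16 ⊛ h1 ⊹ (6 + 32 * c) ⊛ h2 ⊹ (3 + 16 * c) ⊛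
      h3 ⊹ 16 ⊛ h4 ⊹ 8 ⊛ h5 ⊹ 16 ⊛ h6 ⊹ 3 ⊛ h7) (5 + 10 * l2) (solve (M ∷ N ∷ b ∷ c ∷ l2 ∷ lj ∷ l ∷ q ∷ []))

  ℓ-upper : ∀ {x} j → 1 ≤ x → x ≤ 2 ^ j → ℓ x ≤ 2 * j * M
  ℓ-upper {x} j 1≤x x≤2^j = ≤-trans (ℓ≤L x 1≤x) (≤-trans (L-mono 1≤x x≤2^j) (go j))
    where
    L2≤M : L 2 ≤ M
    L2≤M = +-cancelˡ-≤ M _ _ (≤-trans (L-bound {2} (s≤s z≤n)) (≤-reflexive
      (cong (λ t → M + t) (+-identityʳ M))))
    go : ∀ j → L (2 ^ j) ≤ 2 * j * M
    go zero = ≤-reflexive L-one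
    go (suc j) = ≤-trans (L-*-upper {2} {2 ^ j} (s≤s z≤n) (m^n>0 2 j))
      (step M j (L 2) (L (2 ^ j)) L2≤M (go j) (1≤8N²≤M⇒1≤M 1≤N N²≤M))
      where
      step : ∀ M j a b → a ≤ M → b ≤ 2 * j * M → 1 ≤ M → suc (a + b) ≤ 2 * suc j * M
      step M j a b h1 h2 h3 = lin (h1 ⊹ h2 ⊹ h3) 0 (solve (M ∷ j ∷ a ∷ b ∷ []))

-- Primes in short intervals

S-tail-≤ : ∀ {z x} (f g : ℕ → ℕ) → z ≤ x → (∀ n → z < n → n ≤ x → f n ≤ g n) → S x f ≤ S z f + S x g
S-tail-≤ {z} {x} f g z≤x h with m≤n⇒m<n∨m≡n z≤x
... | inj₂ refl = m≤m+n (S z f) (S z g)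
S-tail-≤ {z} {suc x} f g _ h | inj₁ (s≤s z≤x) = ≤-trans (+-mono-≤
  (S-tail-≤ f g z≤x λ n p q → h n p (m≤n⇒m≤1+n q)) (h (suc x) (s≤s z≤x) ≤-refl))
  (≤-reflexive (+-assoc (S z f) (S x g) (g (suc x))))

-- M is the unit of ℓ and ψ, and N bounds their arguments.  The gap has relative length 1 / k, all estimates have a
-- relative error of order 1 / e, and the asymptotic ones are used above Y only.
record Scale : Set where
  field
    M N k e G w Y x : ℕ
    1≤N : 1 ≤ N
    N²≤M : 8 * (N * N) ≤ M
    1≤k : 1 ≤ k
    e-large : 160 * (k * suc G) ≤ e
    w-large : 190 + 60 * 60 ≤ w
    Y-large : 2 ^ suc (2 * (207 * e)) ≤ Y
    2e≤Y : 2 * e ≤ Y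
    4w≤Y : 4 * w ≤ Y
    72k≤Y : 72 * k ≤ Y
    Y≤x : Y ≤ x
    2x≤N : 2 * x ≤ N

-- The interval (x , X] is compared with its dilates (x / n , X / n].  Δ n measures how far ψ (X ÷ n) − ψ (x ÷ n) is
-- below its maximal possible size, and n is good if this deficiency is relatively small.
module Gap (scale : Scale) where
  open Scale scale public
  open Selberg M N 1≤N N²≤M public

  δ X W Z : ℕ
  δ = x ÷ k
  X = x + δ
  W = 2 * e * δ + 5 * x
  Z = x ÷ Y

  δ≤x : δ ≤ x
  δ≤x = ÷≤ x k

  X≤N : X ≤ N
  X≤N = ≤-trans (+-monoʳ-≤ x (≤-trans δ≤x (m≤m+n x 0))) 2x≤N

  1≤e : 1 ≤ e
  1≤e = ≤-trans (*-mono-≤ {1} {160} (s≤s z≤n) (*-mono-≤ {1} {k} {1} {suc G} 1≤k (s≤s z≤n))) e-large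

  1≤Y : 1 ≤ Y
  1≤Y = ≤-trans (m^n>0 2 (suc (2 * (207 * e)))) Y-large

  1≤x : 1 ≤ x
  1≤x = ≤-trans 1≤Y Y≤x

  x≤N' : x ≤ N
  x≤N' = ≤-trans (m≤m+n x (x + 0)) 2x≤N

  e≤N : e ≤ N
  e≤N = ≤-trans (≤-trans (m≤m+n e (e + 0)) 2e≤Y) (≤-trans Y≤x x≤N')

  density≤2 : ∀ {a b} → 1 ≤ a → a ≤ b → Y ≤ b → b ≤ N → e * ψ b + 2 * e * M * a ≤ e * ψ a + 2 * e * M * b + M
    * b
  density≤2 1≤a a≤b Y≤b b≤N = brun-titchmarsh e 1≤a a≤b b≤N
    (≤-trans (≤-reflexive (sym (*-assoc 207 e M))) (ℓ-lower (207 * e) (≤-trans Y-large Y≤b) b≤N))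

  Δ : ℕ → ℕ
  Δ n = (W * r n + e * ψ (x ÷ n)) ∸ e * ψ (X ÷ n)

  V : ℕ → ℕ
  V a = S a (λ n → Λ n * Δ n)

  V-mono : ∀ {a b} → a ≤ b → V a ≤ V b
  V-mono = S-monoˡ (λ n → Λ n * Δ n)

  Good : ℕ → Set
  Good n = n * Δ n ≤ G * x * M

  module _ {n : ℕ} (1≤n : 1 ≤ n) (n≤Z : n ≤ Z) where
    Y≤x÷n : Y ≤ x ÷ n
    Y≤x÷n = ÷-greatest x 1≤n (≤-trans (≤-reflexive (*-comm Y n)) (≤-trans (*-monoˡ-≤ Y n≤Z) (÷-lower x Y)))

    x÷n≤X÷n : x ÷ n ≤ X ÷ n
    x÷n≤X÷n = ÷-monoˡ n (m≤m+n x δ)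

    X÷n≤N : X ÷ n ≤ N
    X÷n≤N = ≤-trans (÷≤ X n) X≤N

    2en≤x : 2 * e * n ≤ x
    2en≤x = ≤-trans (≤-trans (*-monoˡ-≤ n 2e≤Y) (≤-trans (≤-reflexive (*-comm Y n)) (*-monoˡ-≤ Y n≤Z)))
      (÷-lower x Y)

    n≤N : n ≤ N
    n≤N = ≤-trans n≤Z (≤-trans (÷≤ x Y) x≤N')

    Wn≤xM : W * n ≤ x * M
    Wn≤xM = step x δ e n M (squares e≤N n≤N) δ≤x 1≤e
      where
      step : ∀ x δ e n M → 8 * (e * n) ≤ M → δ ≤ x → 1 ≤ e → (2 * e * δ + 5 * x) * n ≤ x * M
      step x δ e n M h1 h2 h3 = lin/ 8 ((7 * x) ⊛ h1 ⊹ (16 * e * n) ⊛ h2 ⊹ (40 * n * x) ⊛ h3) (M * x)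
        (solve (x ∷ δ ∷ e ∷ n ∷ M ∷ []))

    Δ-exact : Δ n + e * ψ (X ÷ n) ≡ W * r n + e * ψ (x ÷ n)
    Δ-exact = m∸n+n≡m (*-cancelˡ-≤ n {{>-nonZero 1≤n}} (step x δ e n M (x ÷ n) (X ÷ n) (r n) (ψ (x ÷ n))
      (ψ (X ÷ n))
      (density≤2 (≤-trans 1≤Y Y≤x÷n) x÷n≤X÷n (≤-trans Y≤x÷n x÷n≤X÷n) X÷n≤N) (<⇒≤ (÷-upper M 1≤n))
        (÷-lower X n) (<⇒≤ (÷-upper x 1≤n)) δ≤x Wn≤xM 2en≤x))
      where
      step : ∀ x δ e n M u v q pu pv → e * pv + 2 * e * M * u ≤ e * pu + 2 * e * M * v + M * v → M ≤ suc q * n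
        → v * n ≤ x + δ → x ≤ suc u * n → δ ≤ x →
        (2 * e * δ + 5 * x) * n ≤ x * M → 2 * e * n ≤ x → n * (e * pv) ≤ n *
          ((2 * e * δ + 5 * x) * q + e * pu)
      step x δ e n M u v q pu pv h1 h2 h3 h4 h5 h6 h7 = lin (n ⊛ h1 ⊹ (4 * x + 2 * e * δ) ⊛ h2 ⊹
        (M + 2 * M * e) ⊛ h3 ⊹ (2 * M * e) ⊛ h4 ⊹ M ⊛ h5 ⊹ h6 ⊹ M ⊛ h7) (n * x + n * q * x)
        (solve (x ∷ δ ∷ e ∷ n ∷ M ∷ u ∷ v ∷ q ∷ pu ∷ pv ∷ []))

    -- A good n forces Λ to have density close to 2 on every part of (x / n , X / n].
    saturated : ∀ {a b} → Good n → x ÷ n ≤ a → a ≤ b → b ≤ X ÷ n →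
      n * (e * ψ a) + 2 * e * M * (n * b) ≤ n * (e * ψ b) + 2 * e * M * (n * a) + suc G * x * M
    saturated {a} {b} good u≤a a≤b b≤v = step x δ e n M G (x ÷ n) (X ÷ n) a b (r n) (Δ n) (ψ (x ÷ n))
      (ψ (X ÷ n)) (ψ a) (ψ b)
      (≤-reflexive (sym Δ-exact)) (<⇒≤ (÷-upper M 1≤n)) good
      (density≤2 (≤-trans 1≤Y Y≤x÷n) u≤a (≤-trans Y≤x÷n u≤a) (≤-trans a≤b (≤-trans b≤v X÷n≤N)))
      (density≤2 (≤-trans 1≤Y (≤-trans Y≤x÷n (≤-trans u≤a a≤b))) b≤v (≤-trans Y≤x÷n x÷n≤X÷n) X÷n≤N)
      (÷-lower X n) (<⇒≤ (÷-upper x 1≤n)) (≤-trans a≤b b≤v) δ≤x Wn≤xM 2en≤x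
      where
      step : ∀ x δ e n M G u v a b q D pu pv pa pb → (2 * e * δ + 5 * x) * q + e * pu ≤ D + e * pv → M ≤ suc q
        * n → n * D ≤ G * x * M →
        e * pa + 2 * e * M * u ≤ e * pu + 2 * e * M * a + M * a → e * pv + 2 * e * M * b ≤ e * pb + 2 * e * M
          * v + M * v →
        v * n ≤ x + δ → x ≤ suc u * n → a ≤ v → δ ≤ x → (2 * e * δ + 5 * x) * n ≤ x * M → 2 * e * n ≤ x →
        n * (e * pa) + 2 * e * M * (n * b) ≤ n * (e * pb) + 2 * e * M * (n * a) + suc G * x * M
      step x δ e n M G u v a b q D pu pv pa pb h1 h2 h3 h4 h5 h6 h7 h8 h9 h10 h11 = lin
        (n ⊛ h1 ⊹ (5 * x + 2 * e * δ) ⊛ h2 ⊹ h3 ⊹ n ⊛ h4 ⊹ n ⊛ h5 ⊹ (2 * M + 2 * M * e) ⊛ h6 ⊹ (2 * M * e) ⊛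
        h7 ⊹ (M * n) ⊛ h8 ⊹ (2 * M) ⊛ h9 ⊹ h10 ⊹ M ⊛ h11) 0 (solve
        (x ∷ δ ∷ e ∷ n ∷ M ∷ G ∷ u ∷ v ∷ a ∷ b ∷ q ∷ D ∷ pu ∷ pv ∷ pa ∷ pb ∷ []))

  Λ-one : Λ 1 ≡ 0
  Λ-one = trans (sym (when-yes (1 ∣? 1) {Λ 1} ∣-refl)) ℓ-one

  private
    ΣΛψX : S x (λ n → Λ n * ψ (X ÷ n)) ≡ ΣΛψ X
    ΣΛψX = sym (S-extend _ (m≤m+n x δ) λ n x<n n≤X → trans (cong (λ t → Λ n * ψ t)
      (÷-unique X {n} {1} (≤-trans (s≤s z≤n) x<n) (≤-trans (≤-reflexive (*-identityˡ n)) n≤X)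
      (≤-trans (+-mono-≤ x<n (≤-trans δ≤x (<⇒≤ x<n))) (≤-reflexive
        (cong (λ t → n + t) (sym (+-identityʳ n))))))) (trans (cong (Λ n *_) Λ-one) (*-zeroʳ (Λ n))))

    V-sum : V Z + e * S Z (λ n → Λ n * ψ (X ÷ n)) ≡ W * S Z (λ n → Λ n * r n) + e * S Z
      (λ n → Λ n * ψ (x ÷ n))
    V-sum = trans (cong (λ t → V Z + t) (sym (S-*ˡ Z e _))) (trans (sym (S-∙ Z _ _))
      (trans (S-cong Z λ n 1≤n n≤Z → trans (gather (Λ n) (Δ n) e (ψ (X ÷ n)))
        (trans (cong (Λ n *_) (Δ-exact 1≤n n≤Z)) (spread (Λ n) W (r n) e (ψ (x ÷ n)))))
      (trans (S-∙ Z _ _) (cong₂ _+_ (S-*ˡ Z W _) (S-*ˡ Z e _)))))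
      where
      gather : ∀ l d e p → l * d + e * (l * p) ≡ l * (d + e * p)
      gather = solve-∀
      spread : ∀ l W q e p → l * (W * q + e * p) ≡ W * (l * q) + e * (l * p)
      spread = solve-∀

    tail : S x (λ n → Λ n * ψ (X ÷ n)) ≤ S Z (λ n → Λ n * ψ (X ÷ n)) + 40 * M * Y * ψ x
    tail = ≤-trans (S-tail-≤ _ (λ n → 40 * M * Y * Λ n) (÷≤ x Y) λ n Z<n n≤x → ≤-trans
      (*-monoʳ-≤ (Λ n) (term n Z<n)) (≤-reflexive (*-comm (Λ n) (40 * M * Y))))
      (+-monoʳ-≤ (S Z (λ n → Λ n * ψ (X ÷ n))) (≤-reflexive (S-*ˡ x (40 * M * Y) Λ)))
      where
      term : ∀ n → Z < n → ψ (X ÷ n) ≤ 40 * M * Y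
      term n Z<n = ≤-trans (ψ≤20Mx (X ÷ n) (≤-trans (÷≤ X n) X≤N))
        (≤-trans (*-monoʳ-≤ (20 * M) small) (≤-reflexive (rearrange M Y)))
        where
        rearrange : ∀ M Y → 20 * M * (2 * Y) ≡ 40 * M * Y
        rearrange = solve-∀
        x≤Yn : x ≤ Y * n
        x≤Yn = ≤-trans (<⇒≤ (÷-upper x 1≤Y)) (≤-trans (*-monoˡ-≤ Y Z<n) (≤-reflexive (*-comm n Y)))
        small : X ÷ n ≤ 2 * Y
        small = *-cancelʳ-≤ (X ÷ n) (2 * Y) n {{>-nonZero (≤-trans (s≤s z≤n) Z<n)}}
          (go (X ÷ n * n) (÷-lower X n) δ≤x x≤Yn)
          where
          go : ∀ t → t ≤ x + δ → δ ≤ x → x ≤ Y * n → t ≤ 2 * Y * n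
          go t h1 h2 h3 = go' x δ Y n t h1 h2 h3
            where
            go' : ∀ x δ Y n t → t ≤ x + δ → δ ≤ x → x ≤ Y * n → t ≤ 2 * Y * n
            go' x δ Y n t h1 h2 h3 = lin (h1 ⊹ h2 ⊹ 2 ⊛ h3) 0 (solve (x ∷ δ ∷ Y ∷ n ∷ t ∷ []))

  V-bound : e * ψ X ≤ e * ψ x + M * x → V Z ≤ 6 * x * M * ℓ x + 1300 * (e * Y * M * M * x)
  V-bound sparse = final x δ e M Y (V Z) (ψ x) (ℓ x) (ΣΛψ X) (ΣΛψ x) (ΣΛr x) combined
      (eliminate x δ e M (ψ X) (ψ x) (ℓ X) (ℓ x) (ℓ X ∸ ℓ x) (ΣΛψ X)
        (selberg-lower (≤-trans 1≤x (m≤m+n x δ)) X≤N) (ψ≤20Mx x x≤N') sparse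
        (m≤n+m∸n (ℓ X) (ℓ x)) xu (ℓ-quasi-mono 1≤x (m≤m+n x δ)) (≤-trans (m≤n*m _ 8) (squares X≤N X≤N)) δ≤x
          1≤x 1≤e)
      (selberg-upper 1≤x x≤N') (ΣΛr≤ 1≤x x≤N') (ψ≤20Mx x x≤N') δ≤x 1≤e 1≤Y
    where
    xu : x * (ℓ X ∸ ℓ x) ≤ M * δ + M
    xu = ≤-trans (≤-reflexive (*-distribˡ-∸ x (ℓ X) (ℓ x))) (m≤n+o⇒m∸n≤o (x * ℓ X) (x * ℓ x)
      (≤-trans (aℓb≤ 1≤x (m≤m+n x δ) X≤N) (≤-reflexive
        (trans (+-assoc (x * ℓ x) _ M) (cong (λ t → x * ℓ x + (M * t + M)) (m+n∸m≡n x δ))))))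
    combined : V Z + e * ΣΛψ X ≤ W * ΣΛr x + e * ΣΛψ x + e * (40 * M * Y * ψ x)
    combined = go (V Z) e W _ _ _ (ΣΛψ X) (ΣΛr x) (ΣΛψ x) (40 * M * Y * ψ x) (≤-reflexive V-sum)
      (≤-trans (≤-reflexive (sym ΣΛψX)) tail) (S-monoˡ _ (÷≤ x Y)) (S-monoˡ _ (÷≤ x Y))
      where
      go : ∀ v e W a b c a' b' c' t → v + e * a ≤ W * b + e * c → a' ≤ a + t → b ≤ b' → c ≤ c' → v + e * a' ≤
        W * b' + e * c' + e * t
      go v e W a b c a' b' c' t h1 h2 h3 h4 = lin (h1 ⊹ e ⊛ h2 ⊹ W ⊛ h3 ⊹ e ⊛ h4) 0
        (solve (v ∷ e ∷ W ∷ a ∷ b ∷ c ∷ a' ∷ b' ∷ c' ∷ t ∷ []))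
    eliminate : ∀ x δ e M pX px lX lx u sX → 2 * M * (x + δ) * lX ≤ pX * lX + sX + 100 * (M * M * (x + δ)) →
      px ≤ 20 * M * x → e * pX ≤ e * px + M * x → lX ≤ lx + u → x * u ≤ M * δ + M → lx ≤ lX + (x + δ) →
        (x + δ) * (x + δ) ≤ M →
      δ ≤ x → 1 ≤ x → 1 ≤ e → 2 * e * M * (x + δ) * lx ≤ e * px * lx + M * x * lx + e * sX + 250 *
        (e * M * M * x)
    eliminate x δ e M pX px lX lx u sX h2 h5 h6 h7 h8 h9 h10 h11 h12 h13 = lin
      (e ⊛ h2 ⊹ (e * u) ⊛ h5 ⊹ lX ⊛ h6 ⊹ (M * x + e * px) ⊛ h7 ⊹ (M + 20 * M * e) ⊛ h8 ⊹
      (2 * M * e * x + 2 * M * e * δ) ⊛ h9 ⊹ (2 * M * e) ⊛ h10 ⊹ (M * M + 120 * M * M * e) ⊛ h11 ⊹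
      (M * M + 22 * M * M * e) ⊛ h12 ⊹ (2 * M * M * x) ⊛ h13) (6 * M * M * e * x)
      (solve (x ∷ δ ∷ e ∷ M ∷ pX ∷ px ∷ lX ∷ lx ∷ u ∷ sX ∷ []))
    final : ∀ x δ e M Y v px lx sX sx sr → v + e * sX ≤ (2 * e * δ + 5 * x) * sr + e * sx + e *
      (40 * M * Y * px) →
      2 * e * M * (x + δ) * lx ≤ e * px * lx + M * x * lx + e * sX + 250 * (e * M * M * x) → px * lx + sx ≤ 2
        * M * x * lx + 100 * (M * M * x) →
      sr ≤ M * lx + 21 * (M * M) → px ≤ 20 * M * x → δ ≤ x → 1 ≤ e → 1 ≤ Y → v ≤ 6 * x * M * lx + 1300 *
        (e * Y * M * M * x)
    final x δ e M Y v px lx sX sx sr h1 h2 h3 h4 h5 h11 h13 h14 = lin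
      (h1 ⊹ h2 ⊹ e ⊛ h3 ⊹ (5 * x + 2 * e * δ) ⊛ h4 ⊹ (40 * M * Y * e) ⊛ h5 ⊹ (42 * M * M * e) ⊛ h11 ⊹
      (105 * M * M * x) ⊛ h13 ⊹ (497 * M * M * e * x) ⊛ h14) (3 * M * M * Y * e * x)
      (solve (x ∷ δ ∷ e ∷ M ∷ Y ∷ v ∷ px ∷ lx ∷ sX ∷ sx ∷ sr ∷ []))

search : ∀ {P : ℕ → Set} (P? : ∀ n → Dec (P n)) a j →
  (∃[ n ] (a < n × n ≤ a + j × P n)) ⊎ (∀ n → a < n → n ≤ a + j → ¬ P n)
search P? a zero = inj₂ λ n a<n n≤a → ⊥-elim (<⇒≱ a<n (≤-trans n≤a (≤-reflexive (+-identityʳ a))))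
search P? a (suc j) with search P? a j
... | inj₁ (n , a<n , n≤ , p) = inj₁ (n , a<n , ≤-trans n≤ (+-monoʳ-≤ a (n≤1+n j)) , p)
... | inj₂ none with P? (a + suc j)
...   | yes p = inj₁ (a + suc j , ≤-trans (s≤s (m≤m+n a j)) (≤-reflexive (sym (+-suc a j))) , ≤-refl , p)
...   | no ¬p = inj₂ λ n a<n n≤ → case n ≟ a + suc j of λ where
          (yes refl) → ¬p
          (no ne) → none n a<n (≤-pred (≤-trans (≤∧≢⇒< n≤ ne) (≤-reflexive (+-suc a j))))

module Region (scale : Scale) where
  open Gap scale

  module Block (A K U c : ℕ) (c-G : 12 * (c * k) ≤ G) (K-large : 128 * 64 ≤ K)
    (Y≤A : Y ≤ A) (KA≤Z : K * A ≤ Z) (U-small : suc U ≤ c * (x * M * M))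
    (few-low : V (K * A) ≤ V A + U) (few-high : V (x ÷ A) ≤ V (x ÷ (K * A)) + U) where

    scale-up : ∀ a b {n} → n ≤ b * A → a * b ≤ K → a * n ≤ K * A
    scale-up a b {n} h k = ≤-trans (*-monoʳ-≤ a h) (≤-trans (≤-reflexive (sym (*-assoc a b A)))
      (*-monoˡ-≤ A k))

    64≤K : 64 ≤ K
    64≤K = ≤-trans (m≤n*m 64 128) K-large

    good? : ∀ n → Dec (Good n)
    good? n = n * Δ n ≤? G * x * M

    find : ∀ {a b} → a ≤ b → 1 ≤ b → V b ≤ V a + U → c * b * M + G * ψ a ≤ G * ψ b → ∃[ n ]
      (a < n × n ≤ b × Good n)
    find {a} {b} a≤b 1≤b few many = conclude (search good? a (b ∸ a))
      where
      a+b∸a : a + (b ∸ a) ≡ b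
      a+b∸a = m+[n∸m]≡n a≤b
      finish : ∀ G x M c b U pa pb va vb → G * x * M * pb + b * va ≤ G * x * M * pa + b * vb → vb ≤ va + U → c
        * b * M + G * pa ≤ G * pb →
        suc U ≤ c * (x * M * M) → 1 ≤ b → suc U ≤ U
      finish G x M c b U pa pb va vb h1 h2 h3 h4 h5 = *-cancelˡ-≤ b {{>-nonZero h5}}
        (lin (h1 ⊹ b ⊛ h2 ⊹ (M * x) ⊛ h3 ⊹ b ⊛ h4) 0 (solve (G ∷ x ∷ M ∷ c ∷ b ∷ U ∷ pa ∷ pb ∷ va ∷ vb ∷ [])))
      conclude : (∃[ n ] (a < n × n ≤ a + (b ∸ a) × Good n)) ⊎ (∀ n → a < n → n ≤ a + (b ∸ a) → ¬ Good n) → ∃[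
        n ] (a < n × n ≤ b × Good n)
      conclude (inj₁ (n , a<n , n≤ , good)) = n , a<n , ≤-trans n≤ (≤-reflexive a+b∸a) , good
      conclude (inj₂ none) = ⊥-elim (<-irrefl refl (finish G x M c b U (ψ a) (ψ b) (V a) (V b)
            (subst (λ t → G * x * M * ψ t + b * V a ≤ G * x * M * ψ a + b * V t) a+b∸a
              (spread (b ∸ a) ≤-refl)) few many U-small 1≤b))
        where
        bad : ∀ n → a < n → n ≤ b → G * x * M ≤ b * Δ n
        bad n a<n n≤b = ≤-trans (<⇒≤ (≰⇒> (none n a<n (≤-trans n≤b (≤-reflexive (sym a+b∸a))))))
          (*-monoˡ-≤ (Δ n) n≤b)
        spread : ∀ j → j ≤ b ∸ a → G * x * M * ψ (a + j) + b * V a ≤ G * x * M * ψ a + b * V (a + j)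
        spread zero _ = ≤-reflexive (trans (cong (λ t → G * x * M * ψ t + b * V a) (+-identityʳ a))
          (cong (λ t → G * x * M * ψ a + b * V t) (sym (+-identityʳ a))))
        spread (suc j) j< = subst (λ t → G * x * M * ψ t + b * V a ≤ G * x * M * ψ a + b * V t)
          (sym (+-suc a j))
          (extend (G * x * M) b (ψ (a + j)) (V a) (ψ a) (V (a + j)) (Λ (suc (a + j))) (Δ (suc (a + j)))
            (spread j (<⇒≤ j<))
            (bad (suc (a + j)) (s≤s (m≤m+n a j)) (≤-trans (≤-reflexive (sym (+-suc a j)))
              (≤-trans (+-monoʳ-≤ a j<) (≤-reflexive a+b∸a)))))
          where
          extend : ∀ g b p va pa v l d → g * p + b * va ≤ g * pa + b * v → g ≤ b * d → g * (p + l) + b * va ≤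
            g * pa + b * (v + l * d)
          extend g b p va pa v l d h1 h2 = lin (h1 ⊹ l ⊛ h2) 0 (solve (g ∷ b ∷ p ∷ va ∷ pa ∷ v ∷ l ∷ d ∷ []))

    1≤A : 1 ≤ A
    1≤A = ≤-trans 1≤Y Y≤A

    quarter≤δ : ∀ t → t * (4 * k) ≤ x → 4 * t ≤ δ
    quarter≤δ t h = ÷-greatest x 1≤k (≤-trans (≤-reflexive (rearrange t k)) h)
      where rearrange : ∀ t k → 4 * t * k ≡ t * (4 * k)
            rearrange = solve-∀

    1≤4k : 1 ≤ 4 * k
    1≤4k = *-mono-≤ {1} {4} (s≤s z≤n) 1≤k

    1≤8k : 1 ≤ 8 * k
    1≤8k = *-mono-≤ {1} {8} (s≤s z≤n) 1≤k

    -- From a good n one gets a good m near x / n, and from m a good n′ slightly larger than n, with Λ of density ≈ 2 on (n , n′].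
    step : ∀ {n} → 2 * A ≤ n → 2 * n ≤ K * A → Good n →
      ∃[ n' ] (n < n' × n' ≤ 2 * n × Good n' × 20 * ψ n + 39 * M * n' ≤ 20 * ψ n' + 39 * M * n)
    step {n} 2A≤n 2n≤KA good = n' , ≤-trans (s≤s (m≤m+n n p')) n+p'<n' , ≤-trans n'≤n+p n+p≤2n , good' , dense
      where
      A≤n : A ≤ n
      A≤n = ≤-trans (m≤m+n A (A + 0)) 2A≤n
      1≤n : 1 ≤ n
      1≤n = ≤-trans 1≤A A≤n
      n≤KA : n ≤ K * A
      n≤KA = ≤-trans (m≤m+n n (n + 0)) 2n≤KA
      n≤Z : n ≤ Z
      n≤Z = ≤-trans n≤KA KA≤Z
      u q p p' : ℕ
      u = x ÷ n
      q = u ÷ (4 * k)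
      p = n ÷ (4 * k)
      p' = n ÷ (8 * k)
      Y≤u : Y ≤ u
      Y≤u = Y≤x÷n 1≤n n≤Z
      1≤u = ≤-trans 1≤Y Y≤u
      un≤x : u * n ≤ x
      un≤x = ÷-lower x n
      x<un+n : x ≤ suc u * n
      x<un+n = <⇒≤ (÷-upper x 1≤n)
      q4k≤u : q * (4 * k) ≤ u
      q4k≤u = ÷-lower u (4 * k)
      p4k≤n : p * (4 * k) ≤ n
      p4k≤n = ÷-lower n (4 * k)
      4qn≤δ : 4 * (q * n) ≤ δ
      4qn≤δ = quarter≤δ (q * n) (≤-trans (≤-trans (≤-reflexive (rearrange q n (4 * k))) (*-monoˡ-≤ n q4k≤u))
        un≤x)
        where rearrange : ∀ a b c → a * b * c ≡ a * c * b
              rearrange = solve-∀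
      4pu≤δ : 4 * (p * u) ≤ δ
      4pu≤δ = quarter≤δ (p * u) (≤-trans (≤-trans (≤-reflexive (rearrange p u (4 * k))) (*-monoˡ-≤ u p4k≤n))
        (≤-trans (≤-reflexive (*-comm n u)) un≤x))
        where rearrange : ∀ a b c → a * b * c ≡ a * c * b
              rearrange = solve-∀
      q≤u : q ≤ u
      q≤u = ÷≤ u (4 * k)
      b≤X÷n : u + q ≤ X ÷ n
      b≤X÷n = ÷-greatest X 1≤n (arith x δ u q n un≤x 4qn≤δ)
        where
        arith : ∀ x δ u q n → u * n ≤ x → 4 * (q * n) ≤ δ → (u + q) * n ≤ x + δ
        arith x δ u q n h1 h2 = lin/ 4 (4 ⊛ h1 ⊹ h2) (3 * δ) (solve (x ∷ δ ∷ u ∷ q ∷ n ∷ []))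
      dual : ∃[ m ] (u < m × m ≤ u + q × Good m)
      dual = find (m≤m+n u q) (≤-trans 1≤u (m≤m+n u q))
        (≤-trans (V-mono u+q≤x÷A) (≤-trans few-high (+-monoˡ-≤ U (V-mono (÷-antiʳ x 1≤n n≤KA)))))
        (*-cancelˡ-≤ e {{>-nonZero 1≤e}} (arith k e G c n M x u q (ψ u) (ψ (u + q))
          (saturated 1≤n n≤Z good ≤-refl (m≤m+n u q) b≤X÷n) x<un+n (<⇒≤ (÷-upper u 1≤4k)) q≤u
          (≤-trans 72k≤Y Y≤u) c-G e-large 1≤n 1≤k))
        where
        u+q≤x÷A : u + q ≤ x ÷ A
        u+q≤x÷A = ÷-greatest x 1≤A (go u q A n x q≤u 2A≤n un≤x)
          where
          go : ∀ u q A n x → q ≤ u → 2 * A ≤ n → u * n ≤ x → (u + q) * A ≤ x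
          go u q A n x h1 h2 h3 = lin (A ⊛ h1 ⊹ u ⊛ h2 ⊹ h3) 0 (solve (u ∷ q ∷ A ∷ n ∷ x ∷ []))
        arith : ∀ k e G c n M x u q pa pb → n * (e * pa) + 2 * e * M * (n * (u + q)) ≤ n * (e * pb) + 2 * e *
          M * (n * u) + suc G * x * M → x ≤ suc u * n →
          u ≤ suc q * (4 * k) → q ≤ u → 72 * k ≤ u → 12 * (c * k) ≤ G → 160 * (k * suc G) ≤ e → 1 ≤ n → 1 ≤ k
            → e * (c * (u + q) * M + G * pa) ≤ e * (G * pb)
        arith k e G c n M x u q pa pb h1 h2 h3 h4 h5 h6 h7 h8 h9 = compare
          (*-cancelˡ-≤ n {{>-nonZero h8}} per-n) u≤5kq
          where
          u≤5kq : u ≤ 5 * k * q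
          u≤5kq = lin/ 17 (18 ⊛ h3 ⊹ h5) (13 * k * q) (solve (k ∷ u ∷ q ∷ []))
          1≤u' : 1 ≤ u
          1≤u' = ≤-trans (*-mono-≤ {1} {72} (s≤s z≤n) h9) h5
          per-n : n * (e * pa + 2 * e * M * q) ≤ n * (e * pb + 2 * suc G * u * M)
          per-n = lin (h1 ⊹ (M + G * M) ⊛ h2 ⊹ (M * n + G * M * n) ⊛ 1≤u') 0
            (solve (e ∷ G ∷ n ∷ M ∷ x ∷ u ∷ q ∷ pa ∷ pb ∷ []))
          compare : e * pa + 2 * e * M * q ≤ e * pb + 2 * suc G * u * M → u ≤ 5 * k * q → e *
            (c * (u + q) * M + G * pa) ≤ e * (G * pb)
          compare i1 i2 = lin/ 48 ((48 * G) ⊛ i1 ⊹ (96 * G * M + 96 * G * G * M + 96 * M * c * e) ⊛ i2 ⊹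
            (48 * M * c * e) ⊛ h4 ⊹ (40 * M * e * q) ⊛ h6 ⊹ (3 * G * M * q) ⊛ h7) (53 * G * M * e * q)
            (solve (k ∷ e ∷ G ∷ c ∷ M ∷ u ∷ q ∷ pa ∷ pb ∷ []))
      m = proj₁ dual
      u<m = proj₁ (proj₂ dual)
      m≤u+q = proj₁ (proj₂ (proj₂ dual))
      good-m = proj₂ (proj₂ (proj₂ dual))
      1≤m : 1 ≤ m
      1≤m = ≤-trans (s≤s z≤n) u<m
      x≤mn : x ≤ m * n
      x≤mn = ≤-trans x<un+n (*-monoˡ-≤ n u<m)
      m≤Z : m ≤ Z
      m≤Z = ÷-greatest x 1≤Y (go m u q Y A n x m≤u+q q≤u un≤x 2A≤n Y≤A)
        where
        go : ∀ m u q Y A n x → m ≤ u + q → q ≤ u → u * n ≤ x → 2 * A ≤ n → Y ≤ A → m * Y ≤ x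
        go m u q Y A n x h1 h2 h3 h4 h5 = lin (Y ⊛ h1 ⊹ Y ⊛ h2 ⊹ h3 ⊹ u ⊛ h4 ⊹ (2 * u) ⊛ h5) 0
          (solve (m ∷ u ∷ q ∷ Y ∷ A ∷ n ∷ x ∷ []))
      x÷m≤n : x ÷ m ≤ n
      x÷m≤n = *-cancelʳ-≤ (x ÷ m) n m {{>-nonZero 1≤m}} (≤-trans (÷-lower x m)
        (≤-trans x≤mn (≤-reflexive (*-comm m n))))
      n+p≤X÷m : n + p ≤ X ÷ m
      n+p≤X÷m = ÷-greatest X 1≤m (arith x δ u q n p m un≤x 4qn≤δ 4pu≤δ q≤u m≤u+q)
        where
        arith : ∀ x δ u q n p m → u * n ≤ x → 4 * (q * n) ≤ δ → 4 * (p * u) ≤ δ → q ≤ u → m ≤ u + q → (n + p)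
          * m ≤ x + δ
        arith x δ u q n p m h1 h2 h3 h4 h5 = lin/ 4 (4 ⊛ h1 ⊹ h2 ⊹ 2 ⊛ h3 ⊹ (4 * p) ⊛ h4 ⊹ (4 * n + 4 * p) ⊛
          h5) δ (solve (x ∷ δ ∷ u ∷ q ∷ n ∷ p ∷ m ∷ []))
      p'≤p : p' ≤ p
      p'≤p = ÷-antiʳ n 1≤4k (*-monoˡ-≤ k {4} {8} (s≤s (s≤s (s≤s (s≤s z≤n)))))
      n+p≤2n : n + p ≤ 2 * n
      n+p≤2n = +-monoʳ-≤ n (≤-trans (÷≤ n (4 * k)) (≤-reflexive (sym (+-identityʳ n))))
      saturated-m : ∀ {a b} → n ≤ a → a ≤ b → b ≤ n + p → e * ψ a + 2 * e * M * b ≤ e * ψ b + 2 * e * M * a +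
        suc G * n * M
      saturated-m {a} {b} n≤a a≤b b≤ = *-cancelˡ-≤ m {{>-nonZero 1≤m}} (arith e G m M x n a b (ψ a) (ψ b)
        (saturated 1≤m m≤Z good-m (≤-trans x÷m≤n n≤a) a≤b (≤-trans b≤ n+p≤X÷m)) x≤mn)
        where
        arith : ∀ e G m M x n a b pa pb → m * (e * pa) + 2 * e * M * (m * b) ≤ m * (e * pb) + 2 * e * M *
          (m * a) + suc G * x * M → x ≤ m * n →
          m * (e * pa + 2 * e * M * b) ≤ m * (e * pb + 2 * e * M * a + suc G * n * M)
        arith e G m M x n a b pa pb h1 h2 = lin (h1 ⊹ (M + G * M) ⊛ h2) 0
          (solve (e ∷ G ∷ m ∷ M ∷ x ∷ n ∷ a ∷ b ∷ pa ∷ pb ∷ []))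
      next : ∃[ n' ] (n + p' < n' × n' ≤ n + p × Good n')
      next = find (+-monoʳ-≤ n p'≤p) (≤-trans 1≤n (m≤m+n n p))
        (≤-trans (V-mono (≤-trans n+p≤2n 2n≤KA)) (≤-trans few-low
          (+-monoˡ-≤ U (V-mono (≤-trans A≤n (m≤m+n n p'))))))
        (*-cancelˡ-≤ e {{>-nonZero 1≤e}} (arith k e G c M n p' (p ∸ p') p (sym (m+[n∸m]≡n p'≤p)) (ψ (n + p'))
          (ψ (n + p))
          (saturated-m (m≤m+n n p') (+-monoʳ-≤ n p'≤p) ≤-refl) p4k≤n (<⇒≤ (÷-upper n 1≤4k))
            (÷-lower n (8 * k)) (≤-trans 72k≤Y (≤-trans Y≤A A≤n)) c-G e-large 1≤k))
        where
        arith : ∀ k e G c M n p' s p → p ≡ p' + s → ∀ pa pb → e * pa + 2 * e * M * (n + p) ≤ e * pb + 2 * e *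
          M * (n + p') + suc G * n * M → p * (4 * k) ≤ n → n ≤ suc p * (4 * k) →
          p' * (8 * k) ≤ n → 72 * k ≤ n → 12 * (c * k) ≤ G → 160 * (k * suc G) ≤ e → 1 ≤ k → e *
            (c * (n + p) * M + G * pa) ≤ e * (G * pb)
        arith k e G c M n p' s p refl pa pb h1 h2 h3 h4 h5 h6 h7 h8 = compare n≤9ks 4p≤n
          where
          n≤9ks : n ≤ 9 * k * s
          n≤9ks = lin/ 8 (18 ⊛ h3 ⊹ 9 ⊛ h4 ⊹ h5) 0 (solve (k ∷ n ∷ p' ∷ s ∷ []))
          4p≤n : 4 * (p' + s) ≤ n
          4p≤n = lin (h2 ⊹ (4 * p' + 4 * s) ⊛ h8) 0 (solve (k ∷ n ∷ p' ∷ s ∷ []))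
          compare : n ≤ 9 * k * s → 4 * (p' + s) ≤ n → e * (c * (n + (p' + s)) * M + G * pa) ≤ e * (G * pb)
          compare i1 i2 = lin/ 160 ((160 * G) ⊛ h1 ⊹ (160 * G * M + 160 * G * G * M + 200 * M * c * e) ⊛ i1 ⊹
            (40 * M * c * e) ⊛ i2 ⊹ (150 * M * e * s) ⊛ h6 ⊹ (9 * G * M * s) ⊛ h7) (161 * G * M * e * s)
            (solve (k ∷ e ∷ G ∷ c ∷ M ∷ n ∷ p' ∷ s ∷ pa ∷ pb ∷ []))
      n' = proj₁ next
      n+p'<n' = proj₁ (proj₂ next)
      n'≤n+p = proj₁ (proj₂ (proj₂ next))
      good' = proj₂ (proj₂ (proj₂ next))
      dense : 20 * ψ n + 39 * M * n' ≤ 20 * ψ n' + 39 * M * n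
      dense = *-cancelˡ-≤ e {{>-nonZero 1≤e}} (arith k e G M n p' n' (ψ n) (ψ n')
        (saturated-m ≤-refl (≤-trans (m≤m+n n p') (<⇒≤ n+p'<n')) n'≤n+p) (<⇒≤ (÷-upper n 1≤8k)) n+p'<n'
        e-large)
        where
        arith : ∀ k e G M n p' n' pa pb → e * pa + 2 * e * M * n' ≤ e * pb + 2 * e * M * n + suc G * n * M → n
          ≤ suc p' * (8 * k) → suc (n + p') ≤ n' → 160 * (k * suc G) ≤ e →
          e * (20 * pa + 39 * M * n') ≤ e * (20 * pb + 39 * M * n)
        arith k e G M n p' n' pa pb h1 h2 h3 h4 = go (n' ∸ n) (m+[n∸m]≡n (≤-trans (m≤m+n n p') (<⇒≤ h3)))
          where
          go : ∀ s → n + s ≡ n' → e * (20 * pa + 39 * M * n') ≤ e * (20 * pb + 39 * M * n)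
          go s refl = lin (20 ⊛ h1 ⊹ (20 * M + 20 * G * M) ⊛ h2 ⊹ (160 * M * k + 160 * G * M * k) ⊛ h3 ⊹
            (M * s) ⊛ h4) 0 (solve (k ∷ e ∷ G ∷ M ∷ n ∷ p' ∷ s ∷ pa ∷ pb ∷ []))

    module _ {n₀ : ℕ} (2A≤n₀ : 2 * A ≤ n₀) (room : 128 * n₀ ≤ K * A) where
      chain : ∀ fuel n → n₀ ≤ n → n ≤ 128 * n₀ → 64 * n₀ ≤ n + fuel → Good n → 20 * ψ n₀ + 39 * M * n ≤ 20 * ψ
        n + 39 * M * n₀ →
        ∃[ n' ] (64 * n₀ ≤ n' × n' ≤ 128 * n₀ × 20 * ψ n₀ + 39 * M * n' ≤ 20 * ψ n' + 39 * M * n₀)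
      chain fuel n n₀≤n n≤ enough good dense = go fuel enough (≤-<-connex (64 * n₀) n)
        where
        Goal : Set
        Goal = ∃[ n' ] (64 * n₀ ≤ n' × n' ≤ 128 * n₀ × 20 * ψ n₀ + 39 * M * n' ≤ 20 * ψ n' + 39 * M * n₀)
        go : ∀ fuel → 64 * n₀ ≤ n + fuel → (64 * n₀ ≤ n) ⊎ (n < 64 * n₀) → Goal
        continue : ∀ fuel → 64 * n₀ ≤ n + suc fuel → 2 * n ≤ 128 * n₀ →
          ∃[ n' ] (n < n' × n' ≤ 2 * n × Good n' × 20 * ψ n + 39 * M * n' ≤ 20 * ψ n' + 39 * M * n) → Goal
        go fuel enough (inj₁ done) = n , done , n≤ , dense
        go zero enough (inj₂ n<) = ⊥-elim (<⇒≱ n< (≤-trans enough (≤-reflexive (+-identityʳ n))))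
        go (suc fuel) enough (inj₂ n<) = continue fuel enough 2n≤128n₀
          (step (≤-trans 2A≤n₀ n₀≤n) (≤-trans 2n≤128n₀ room) good)
          where
          2n≤128n₀ : 2 * n ≤ 128 * n₀
          2n≤128n₀ = ≤-trans (*-monoʳ-≤ 2 (<⇒≤ n<)) (≤-reflexive (sym (*-assoc 2 64 n₀)))
        continue fuel enough 2n≤ (n' , n<n' , n'≤2n , good' , dense') = chain fuel n'
          (≤-trans n₀≤n (<⇒≤ n<n')) (≤-trans n'≤2n 2n≤)
          (≤-trans enough (≤-trans (≤-reflexive (+-suc n fuel)) (+-monoˡ-≤ fuel n<n'))) good'
          (glue (20 * ψ n₀) (20 * ψ n) (20 * ψ n') (39 * M * n₀) (39 * M * n) (39 * M * n') dense dense')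
          where
          glue : ∀ a b c d e f → a + e ≤ b + d → b + f ≤ c + e → a + f ≤ c + d
          glue a b c d e f h1 h2 = lin (h1 ⊹ h2) 0 (solve (a ∷ b ∷ c ∷ d ∷ e ∷ f ∷ []))

      too-dense : Good n₀ → ⊥
      too-dense good = conclude (chain (64 * n₀) n₀ ≤-refl (m≤n*m n₀ 128) (m≤n+m (64 * n₀) n₀) good ≤-refl)
        where
        conclude : ∃[ n' ] (64 * n₀ ≤ n' × n' ≤ 128 * n₀ × 20 * ψ n₀ + 39 * M * n' ≤ 20 * ψ n' + 39 * M * n₀)
          → ⊥
        impossible : ∀ a → a ≤ 0 → 1 ≤ a → ⊥
        impossible a h1 h2 = <⇒≱ h2 h1
        arith : ∀ M w n n₀ p q → 20 * p + 39 * M * n ≤ 20 * q + 39 * M * n₀ → 10 * q ≤ 18 * M * n + 200 * w *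
          M → 64 * n₀ ≤ n → 4 * w ≤ n₀ → 1 ≤ M → n₀ ≤ 0
        arith M w n n₀ p q h1 h2 h3 h4 h5 = *-cancelˡ-≤ M {{>-nonZero h5}}
          (lin/ 53 (h1 ⊹ 2 ⊛ h2 ⊹ (3 * M) ⊛ h3 ⊹ (100 * M) ⊛ h4) (20 * p)
          (solve (M ∷ w ∷ n ∷ n₀ ∷ p ∷ q ∷ [])))
        conclude (n , 64n₀≤n , n≤128n₀ , dense) = impossible n₀ (arith M w n n₀ (ψ n₀) (ψ n) dense
          (ψ-chebyshev w w-large n (≤-trans n≤128n₀ (≤-trans room (≤-trans KA≤Z (≤-trans (÷≤ x Y) x≤N')))))
            64n₀≤n
          (≤-trans 4w≤Y (≤-trans Y≤A (≤-trans (m≤m+n A (A + 0)) 2A≤n₀))) (1≤8N²≤M⇒1≤M 1≤N N²≤M))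
            (≤-trans 1≤A (≤-trans (m≤m+n A (A + 0)) 2A≤n₀))

    start : ∃[ n ] (2 * A < n × n ≤ 64 * A × Good n)
    start = find (*-monoˡ-≤ A {2} {64} (s≤s (s≤s z≤n))) (*-mono-≤ {1} {64} (s≤s z≤n) 1≤A)
      (≤-trans (V-mono (*-monoˡ-≤ A 64≤K)) (≤-trans few-low (+-monoˡ-≤ U (V-mono (m≤m+n A (A + 0))))))
      (arith k G c M w A (H (32 * A)) (ψ (2 * A)) (ψ (64 * A)) many (H≤ 6 (32 * A) (s≤s z≤n))
         (ψ-chebyshev w w-large (2 * A) (≤-trans (*-monoˡ-≤ A {2} {64} (s≤s (s≤s z≤n))) 64A≤N))
           (≤-trans 4w≤Y Y≤A) (≤-trans (m≤n+m 36 154) (≤-trans (m≤m+n 190 (60 * 60)) w-large)) 190≤w c-G 1≤k)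
      where
      190≤w : 190 ≤ w
      190≤w = ≤-trans (m≤m+n 190 (60 * 60)) w-large
      64A≤N : 64 * A ≤ N
      64A≤N = ≤-trans (*-monoˡ-≤ A 64≤K) (≤-trans KA≤Z (≤-trans (÷≤ x Y) x≤N'))
      half : 64 * A ÷ 2 ≡ 32 * A
      half = trans (cong (_÷ 2) (*-assoc 2 32 A)) (*÷-cancel (32 * A) (s≤s z≤n))
      many : 32 * A * M ≤ ψ (64 * A) + 2 * H (32 * A) + 6 * M
      many = subst (λ t → t * M ≤ ψ (64 * A) + 2 * H t + 6 * M) half (ψ-lower 64A≤N)
      arith : ∀ k G c M w A h pa pb → 32 * A * M ≤ pb + 2 * h + 6 * M → 6 * h ≤ M * (32 * A + 6 * 6) → 10 * pa
        ≤ 18 * M * (2 * A) + 200 * w * M → 4 * w ≤ A →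
        36 ≤ w → 190 ≤ w → 12 * (c * k) ≤ G → 1 ≤ k → c * (64 * A) * M + G * pa ≤ G * pb
      arith k G c M w A h pa pb h1 h2 h3 h4 h5 h6 h7 h8 = compare density
        where
        density : 10 * pa + 100 * A * M ≤ 10 * pb
        density = lin/ 3 (30 ⊛ h1 ⊹ 10 ⊛ h2 ⊹ 3 ⊛ h3 ⊹ (151 * M) ⊛ h4 ⊹ (3 * M) ⊛ h6)
          (81 * A * M + w * M + 30 * M) (solve (M ∷ w ∷ A ∷ h ∷ pa ∷ pb ∷ []))
        compare : 10 * pa + 100 * A * M ≤ 10 * pb → c * (64 * A) * M + G * pa ≤ G * pb
        compare i = lin/ 30 ((3 * G) ⊛ i ⊹ (160 * A * M) ⊛ h7 ⊹ (1920 * A * M * c) ⊛ h8) (140 * A * G * M)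
          (solve (k ∷ G ∷ c ∷ M ∷ A ∷ pa ∷ pb ∷ []))

    absurd : ⊥
    absurd = conclude start
      where
      conclude : ∃[ n ] (2 * A < n × n ≤ 64 * A × Good n) → ⊥
      conclude (n , 2A<n , n≤64A , good) = too-dense (<⇒≤ 2A<n) (scale-up 128 64 n≤64A K-large) good

pigeonhole-increments : ∀ B (Φ : ℕ → ℕ) → 1 ≤ B → ∃[ j ] (j < B × B * Φ (suc j) ≤ B * Φ j + Φ B)
pigeonhole-increments B Φ 1≤B = conclude (search (λ n → B * Φ n ≤? B * Φ (n ∸ 1) + Φ B) 0 B)
  where
  conclude : (∃[ n ] (0 < n × n ≤ B × B * Φ n ≤ B * Φ (n ∸ 1) + Φ B)) ⊎
    (∀ n → 0 < n → n ≤ B → ¬ B * Φ n ≤ B * Φ (n ∸ 1) + Φ B) →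
    ∃[ j ] (j < B × B * Φ (suc j) ≤ B * Φ j + Φ B)
  conclude (inj₁ (suc j , _ , j<B , h)) = j , j<B , h
  conclude (inj₂ none) = ⊥-elim (<-irrefl refl (<-≤-trans (m<m+n (B * Φ B) 1≤B) (go B ≤-refl)))
    where
    go : ∀ j → j ≤ B → j * Φ B + j ≤ B * Φ j
    go zero _ = z≤n
    go (suc j) j<B = ≤-trans (arith j (Φ B) (B * Φ j) (go j (<⇒≤ j<B))) (≰⇒> (none (suc j) (s≤s z≤n) j<B))
      where
      arith : ∀ j f b → j * f + j ≤ b → suc j * f + suc j ≤ suc (b + f)
      arith j f b h = lin (h) 0 (solve (j ∷ f ∷ b ∷ []))

exponent : ∀ c K x → 1 ≤ c → 2 ≤ K → c ≤ x → ∃[ B ] (c * K ^ B ≤ x × x < c * K ^ suc B)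
exponent c K x 1≤c 2≤K c≤x = B , holds , fails
  where
  P? : ∀ j → Dec (c * K ^ j ≤ x)
  P? j = c * K ^ j ≤? x
  B = greatest P? x
  holds : c * K ^ B ≤ x
  holds = greatest-holds P? (≤-trans (≤-reflexive (*-identityʳ c)) c≤x) x
  fails : x < c * K ^ suc B
  fails = ≰⇒> λ h → <-irrefl refl (greatest-max P? x
    (<⇒≤ (<-≤-trans (n<p^n 2≤K (suc B)) (≤-trans (m≤n*m (K ^ suc B) c {{>-nonZero 1≤c}}) h))) h)

square-root : ∀ X → ∃[ s ] (s * s ≤ X × X < suc s * suc s)
square-root X = s , greatest-holds P? z≤n X , ≰⇒> λ h → <-irrefl refl
  (greatest-max P? X (≤-trans (m≤m*n (suc s) (suc s)) h) h)
  where
  P? : ∀ j → Dec (j * j ≤ X)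
  P? j = j * j ≤? X
  s = greatest P? X

module NoPrimes (scale : Scale)
  (large : 16 * Scale.e scale * (16 * Scale.e scale) * (16 * Scale.e scale * (16 * Scale.e scale)) ≤ Scale.x
    scale)
  (none : ∀ p → Prime p → Scale.x scale < p → ¬ p ≤ Gap.X scale) where
  open Gap scale

  sparse : e * ψ X ≤ e * ψ x + M * x
  sparse = conclude (square-root X)
    where
    conclude : ∃[ s ] (s * s ≤ X × X < suc s * suc s) → e * ψ X ≤ e * ψ x + M * x
    conclude (s , s²≤X , X<s²) = arith e M x δ s (ψ X) (ψ x) (L X) (L (suc s)) (H s)
        (ψ-prime-free (m≤m+n x δ) X<s² (≤-trans (s≤s² s) s²≤X) none)
        (≤-trans (L-mono (≤-trans 1≤x (m≤m+n x δ)) (<⇒≤ X<s²)) (L-*-upper {suc s} {suc s} (s≤s z≤n)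
          (s≤s z≤n))) (L≤H+n s)
        (≤-trans (H≤ (16 * e) s (*-mono-≤ {1} {16} (s≤s z≤n) 1≤e)) (*-monoʳ-≤ M (+-monoʳ-≤ s t≤s))) s²≤X δ≤x
        16e≤M (s≤s² s)
      where
      s≤s² : ∀ s → s ≤ s * s
      s≤s² zero = z≤n
      s≤s² (suc s) = m≤m*n (suc s) (suc s)
      16e≤M : 16 * e ≤ M
      16e≤M = go e N M (squares e≤N ≤-refl) (≤-trans (*-monoʳ-≤ 2 1≤x) 2x≤N)
        where
        go : ∀ e N M → 8 * (e * N) ≤ M → 2 * 1 ≤ N → 16 * e ≤ M
        go e N M h1 h2 = lin (h1 ⊹ (8 * e) ⊛ h2) 0 (solve (e ∷ N ∷ M ∷ []))
      t≤s : 16 * e * (16 * e) ≤ s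
      t≤s with ≤-<-connex (16 * e * (16 * e)) s
      ... | inj₁ h = h
      ... | inj₂ h = ⊥-elim (<⇒≱ X<s² (≤-trans (*-mono-≤ h h) (≤-trans large (m≤m+n x δ))))
      arith : ∀ e M x δ s pX px lX ls h → pX ≤ px + s * lX → lX ≤ suc (ls + ls) → ls ≤ h + s → 16 * e * h ≤ M
        * (s + s) → s * s ≤ x + δ → δ ≤ x → 16 * e ≤ M → s ≤ s * s →
        e * pX ≤ e * px + M * x
      arith e M x δ s pX px lX ls h h1 h2 h3 h4 h5 h6 h7 h8 = lin/ 16
        ((16 * e) ⊛ h1 ⊹ (16 * e * s) ⊛ h2 ⊹ (32 * e * s) ⊛ h3 ⊹ (2 * s) ⊛ h4 ⊹ (4 * M + 48 * e) ⊛ h5 ⊹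
        (7 * M) ⊛ h6 ⊹ (3 * x + 3 * δ) ⊛ h7 ⊹ (16 * e) ⊛ h8) (2 * M * x)
        (solve (e ∷ M ∷ x ∷ δ ∷ s ∷ pX ∷ px ∷ lX ∷ ls ∷ h ∷ []))

  module Pigeonhole (y κ B c' : ℕ) (Y-power : Y ≡ 2 ^ y) (1≤κ : 1 ≤ κ) (K-large : 128 * 64 ≤ 2 ^ κ) (c'-eq : c' ≡ 25 * κ) (c-G : 12 * (suc c' * k) ≤ G)
    (B-large : 48 * y + 24 * κ + 2 * (1300 * (e * Y)) ≤ B) (B-lower : Y * Y * (2 ^ κ) ^ B ≤ x)
      (B-upper : x < Y * Y * (2 ^ κ) ^ suc B) where
    K U : ℕ
    K = 2 ^ κ
    U = c' * (x * M * M)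

    1≤M : 1 ≤ M
    1≤M = 1≤8N²≤M⇒1≤M 1≤N N²≤M

    1≤xMM : 1 ≤ x * M * M
    1≤xMM = *-mono-≤ (*-mono-≤ 1≤x 1≤M) 1≤M

    U-small : suc U ≤ suc c' * (x * M * M)
    U-small = +-monoˡ-≤ U 1≤xMM

    1≤B : 1 ≤ B
    1≤B = ≤-trans (≤-trans (*-mono-≤ {1} {24} (s≤s z≤n) 1≤κ) (≤-trans (m≤n+m (24 * κ) (48 * y))
      (m≤m+n _ (2 * (1300 * (e * Y)))))) B-large

    1≤K : 1 ≤ K
    1≤K = m^n>0 2 κ

    A : ℕ → ℕ
    A j = Y * K ^ j

    Y≤A : ∀ j → Y ≤ A j
    Y≤A j = ≤-trans (≤-reflexive (sym (*-identityʳ Y))) (*-monoʳ-≤ Y (m^n>0 K {{>-nonZero 1≤K}} j))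

    A≤Z : ∀ {j} → j ≤ B → A j ≤ Z
    A≤Z {j} j≤B = ÷-greatest x 1≤Y (≤-trans
      (≤-trans (*-monoˡ-≤ Y (*-monoʳ-≤ Y (^-monoʳ-≤ K {{>-nonZero 1≤K}} j≤B)))
      (≤-reflexive (rearrange Y (K ^ B)))) B-lower)
      where rearrange : ∀ a b → a * b * a ≡ a * a * b
            rearrange = solve-∀

    A-suc : ∀ j → A (suc j) ≡ K * A j
    A-suc j = rearrange Y K (K ^ j)
      where rearrange : ∀ a b c → a * (b * c) ≡ b * (a * c)
            rearrange = solve-∀

    Φ : ℕ → ℕ
    Φ j = V (A j) + (V Z ∸ V (x ÷ A j))

    Φ≤ : Φ B ≤ V Z + V Z
    Φ≤ = +-mono-≤ (V-mono (A≤Z ≤-refl)) (m∸n≤m (V Z) (V (x ÷ A B)))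

    2V≤BU : V Z + V Z ≤ B * U
    2V≤BU = subst (λ t → V Z + V Z ≤ B * (t * (x * M * M))) (sym c'-eq)
        (arith x M y κ B (V Z) (ℓ x) (1300 * (e * Y)) (≤-trans (V-bound sparse)
          (≤-reflexive (cong (λ t → 6 * x * M * ℓ x + t) (rearrange 1300 e Y M x)))) ℓ-small B-large 1≤κ)
      where
      rearrange : ∀ a e Y M x → a * (e * Y * M * M * x) ≡ a * (e * Y) * (x * M * M)
      rearrange = solve-∀
      ℓ-small : ℓ x ≤ 2 * (y + y + κ * suc B) * M
      ℓ-small = ℓ-upper (y + y + κ * suc B) 1≤x (≤-trans (<⇒≤ B-upper) (≤-reflexive
        (trans (cong₂ (λ a b → a * a * b) Y-power (^-*-assoc 2 κ (suc B)))
          (trans (cong (_* 2 ^ (κ * suc B)) (sym (^-distribˡ-+-* 2 y y)))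
          (sym (^-distribˡ-+-* 2 (y + y) (κ * suc B)))))))
      arith : ∀ x M y κ B v l D → v ≤ 6 * x * M * l + D * (x * M * M) → l ≤ 2 * (y + y + κ * suc B) * M → 48 *
        y + 24 * κ + 2 * D ≤ B → 1 ≤ κ → v + v ≤ B * (25 * κ * (x * M * M))
      arith x M y κ B v l D h1 h2 h3 h4 = lin (2 ⊛ h1 ⊹ (12 * M * x) ⊛ h2 ⊹ (M * M * x) ⊛ h3 ⊹ (B * M * M * x)
        ⊛ h4) 0 (solve (x ∷ M ∷ y ∷ κ ∷ B ∷ v ∷ l ∷ D ∷ []))

    absurd : ⊥
    absurd = conclude (pigeonhole-increments B Φ 1≤B)
      where
      conclude : ∃[ j ] (j < B × B * Φ (suc j) ≤ B * Φ j + Φ B) → ⊥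
      conclude (j , j<B , h) = Region.Block.absurd scale (A j) K U (suc c') c-G K-large (Y≤A j) KA≤Z U-small
          (subst (λ t → V t ≤ V (A j) + U) (A-suc j) (proj₁ both))
            (subst (λ t → V (x ÷ A j) ≤ V (x ÷ t) + U) (A-suc j) (proj₂ both))
        where
        KA≤Z : K * A j ≤ Z
        KA≤Z = subst (_≤ Z) (A-suc j) (A≤Z j<B)
        increment : Φ (suc j) ≤ Φ j + U
        increment = *-cancelˡ-≤ B {{>-nonZero 1≤B}} (≤-trans h
          (≤-trans (+-monoʳ-≤ (B * Φ j) (≤-trans Φ≤ 2V≤BU)) (≤-reflexive (sym (*-distribˡ-+ B (Φ j) U)))))
        A≤A' : A j ≤ A (suc j)
        A≤A' = ≤-trans (m≤n*m (A j) K {{>-nonZero 1≤K}}) (≤-reflexive (sym (A-suc j)))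
        1≤Aj = ≤-trans 1≤Y (Y≤A j)
        split : ∀ a a' b b' v u → a ≤ a' → b' ≤ b → b ≤ v → a' + (v ∸ b') ≤ a + (v ∸ b) + u → a' ≤ a + u × b ≤
          b' + u
        split a a' b b' v u a≤a' b'≤b b≤v h = part₁ (v ∸ b) (v ∸ b') (m∸n+n≡m b≤v)
          (m∸n+n≡m (≤-trans b'≤b b≤v)) h
          where
          part₁ : ∀ s s' → s + b ≡ v → s' + b' ≡ v → a' + s' ≤ a + s + u → a' ≤ a + u × b ≤ b' + u
          part₁ s s' refl e h = go₁ a a' b b' s s' u a≤a' b'≤b (≤-reflexive (sym e)) h , go₂ a a' b b' s s' u
            a≤a' (≤-reflexive (sym e)) h
            where
            go₁ : ∀ a a' b b' s s' u → a ≤ a' → b' ≤ b → s + b ≤ s' + b' → a' + s' ≤ a + s + u → a' ≤ a + u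
            go₁ a a' b b' s s' u h1 h2 h3 h4 = lin (h2 ⊹ h3 ⊹ h4) 0
              (solve (a ∷ a' ∷ b ∷ b' ∷ s ∷ s' ∷ u ∷ []))
            go₂ : ∀ a a' b b' s s' u → a ≤ a' → s + b ≤ s' + b' → a' + s' ≤ a + s + u → b ≤ b' + u
            go₂ a a' b b' s s' u h1 h3 h4 = lin (h1 ⊹ h3 ⊹ h4) 0 (solve (a ∷ a' ∷ b ∷ b' ∷ s ∷ s' ∷ u ∷ []))
        both : V (A (suc j)) ≤ V (A j) + U × V (x ÷ A j) ≤ V (x ÷ A (suc j)) + U
        both = split (V (A j)) (V (A (suc j))) (V (x ÷ A j)) (V (x ÷ A (suc j))) (V Z) U (V-mono A≤A')
          (V-mono (÷-antiʳ x 1≤Aj A≤A')) (V-mono (÷-antiʳ x 1≤Y (Y≤A j))) increment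

prime-gap : ∀ k → 1 ≤ k → ∃[ X₀ ] (∀ x → X₀ ≤ x → ∃[ p ] (Prime p × x < p × p ≤ x + x ÷ k))
prime-gap k 1≤k = from 13 (190 + 60 * 60) (s≤s z≤n) ≤-refl ≤-refl
  where
  from : ∀ κ w → 1 ≤ κ → 128 * 64 ≤ 2 ^ κ → 190 + 60 * 60 ≤ w → ∃[ X₀ ]
    (∀ x → X₀ ≤ x → ∃[ p ] (Prime p × x < p × p ≤ x + x ÷ k))
  from κ w 1≤κ K-large w-large = X₀ , λ x X₀≤x → decide x X₀≤x (search prime? x (x ÷ k))
    where
    c' G e y₀ y Y B₀ t X₀ : ℕ
    c' = 25 * κ
    G = 12 * (suc c' * k)
    e = 160 * (k * suc G)
    y₀ = suc (2 * (207 * e))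
    y = y₀ + (2 * e + 4 * w + 72 * k)
    Y = 2 ^ y
    B₀ = 48 * y + 24 * κ + 2 * (1300 * (e * Y))
    t = 16 * e * (16 * e)
    X₀ = Y * Y * (2 ^ κ) ^ B₀ + t * t
    n≤2^n : ∀ n → n ≤ 2 ^ n
    n≤2^n n = <⇒≤ (n<p^n ≤-refl n)
    extra≤Y : 2 * e + 4 * w + 72 * k ≤ Y
    extra≤Y = ≤-trans (m≤n+m _ y₀) (n≤2^n y)
    1≤Y : 1 ≤ Y
    1≤Y = m^n>0 2 y
    2≤K : 2 ≤ 2 ^ κ
    2≤K = ≤-trans (s≤s (s≤s z≤n)) K-large
    1≤Y² : 1 ≤ Y * Y
    1≤Y² = *-mono-≤ 1≤Y 1≤Y
    decide : ∀ x → X₀ ≤ x → (∃[ p ] (x < p × p ≤ x + x ÷ k × Prime p)) ⊎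
      (∀ p → x < p → p ≤ x + x ÷ k → ¬ Prime p) → ∃[ p ] (Prime p × x < p × p ≤ x + x ÷ k)
    decide x X₀≤x (inj₁ (p , x<p , p≤ , pp)) = p , pp , x<p , p≤
    decide x X₀≤x (inj₂ none) = ⊥-elim (impossible (exponent (Y * Y) (2 ^ κ) x 1≤Y² 2≤K Y²≤x))
      where
      main≤x : Y * Y * (2 ^ κ) ^ B₀ ≤ x
      main≤x = ≤-trans (m≤m+n _ (t * t)) X₀≤x
      Y²≤x : Y * Y ≤ x
      Y²≤x = ≤-trans (m≤m*n (Y * Y) ((2 ^ κ) ^ B₀) {{m^n≢0 (2 ^ κ) B₀ {{m^n≢0 2 κ}}}}) main≤x
      Y≤x : Y ≤ x
      Y≤x = ≤-trans (m≤m*n Y Y {{>-nonZero 1≤Y}}) Y²≤x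
      1≤x : 1 ≤ x
      1≤x = ≤-trans 1≤Y Y≤x
      scale : Scale
      scale = record
        { M = 8 * (2 * x * (2 * x)) ; N = 2 * x ; k = k ; e = e ; G = G ; w = w ; Y = Y ; x = x
        ; 1≤N = *-mono-≤ {1} {2} (s≤s z≤n) 1≤x ; N²≤M = ≤-refl ; 1≤k = 1≤k ; e-large = ≤-refl ; w-large =
          w-large
        ; Y-large = ^-monoʳ-≤ 2 (m≤m+n y₀ _) ; 2e≤Y = ≤-trans (≤-trans (m≤m+n (2 * e) (4 * w))
          (m≤m+n _ (72 * k))) extra≤Y
        ; 4w≤Y = ≤-trans (≤-trans (m≤n+m (4 * w) (2 * e)) (m≤m+n _ (72 * k))) extra≤Y
        ; 72k≤Y = ≤-trans (m≤n+m (72 * k) (2 * e + 4 * w)) extra≤Y ; Y≤x = Y≤x ; 2x≤N = ≤-refl }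
      impossible : ∃[ B ] (Y * Y * (2 ^ κ) ^ B ≤ x × x < Y * Y * (2 ^ κ) ^ suc B) → ⊥
      impossible (B , lower , upper) = NoPrimes.Pigeonhole.absurd scale (≤-trans (m≤n+m (t * t) _) X₀≤x)
        (λ p pp x<p p≤ → none p x<p p≤ pp)
          y κ B c' refl 1≤κ K-large refl ≤-refl B₀≤B lower upper
        where
        B₀≤B : B₀ ≤ B
        B₀≤B = ≮⇒≥ λ B<B₀ → <⇒≱ upper (≤-trans (*-monoʳ-≤ (Y * Y) (^-monoʳ-≤ (2 ^ κ) {{m^n≢0 2 κ}} B<B₀))
          main≤x)

-- Graphs and embeddings

all-true : ∀ {A : Set} (p : A → Bool) xs → (∀ x → x ∈ xs → p x ≡ true) → List.all p xs ≡ true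
all-true p [] h = refl
all-true p (x ∷ xs) h = cong₂ _∧_ (h x (here refl)) (all-true p xs λ y y∈ → h y (there y∈))

all-true⁻¹ : ∀ {A : Set} (p : A → Bool) xs → List.all p xs ≡ true → ∀ x → x ∈ xs → p x ≡ true
all-true⁻¹ p (x ∷ xs) h y y∈ with p x in eq
all-true⁻¹ p (x ∷ xs) h .x (here refl) | true = eq
all-true⁻¹ p (x ∷ xs) h y (there y∈) | true = all-true⁻¹ p xs h y y∈

any-true : ∀ {A : Set} (p : A → Bool) xs {x} → x ∈ xs → p x ≡ true → List.any p xs ≡ true
any-true p (x ∷ xs) (here refl) h = cong (_∨ List.any p xs) h
any-true p (x ∷ xs) (there x∈) h = trans (cong (p x ∨_) (any-true p xs x∈ h)) (∨-zeroʳ (p x))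

any-true⁻¹ : ∀ {A : Set} (p : A → Bool) xs → List.any p xs ≡ true → ∃[ x ] (x ∈ xs × p x ≡ true)
any-true⁻¹ p (x ∷ xs) h with p x in eq
... | true = x , here refl , eq
... | false with any-true⁻¹ p xs h
...   | y , y∈ , py = y , there y∈ , py

allV-true : ∀ {n} (p : Fin n → Bool) → (∀ i → p i ≡ true) → allV p ≡ true
allV-true {n} p h = all-true p (allFin n) λ i _ → h i

allV-true⁻¹ : ∀ {n} (p : Fin n → Bool) → allV p ≡ true → ∀ i → p i ≡ true
allV-true⁻¹ {n} p h i = all-true⁻¹ p (allFin n) h i (∈-allFin i)

∧-true : ∀ {a b} → a ∧ b ≡ true → a ≡ true × b ≡ true
∧-true {true} {true} _ = refl , refl

∈-allFuns : ∀ {A : Set} (R : A → A → Set) k xs (f : Fin k → A) → (∀ i → ∃[ x ] (x ∈ xs × R x (f i))) →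
  ∃[ g ] (g ∈ allFuns k xs × ∀ i → R (g i) (f i))
∈-allFuns R zero xs f h = (λ ()) , here refl , λ ()
∈-allFuns R (suc k) xs f h with h Fin.zero | ∈-allFuns R k xs (f ∘ Fin.suc) (h ∘ Fin.suc)
... | x , x∈ , Rx | g , g∈ , Rg = x VF.∷ g
  , ∈-concat⁺′ (∈-map⁺ (λ f → x VF.∷ f) g∈) (∈-map⁺ (λ x → map (λ f → x VF.∷ f) (allFuns k xs)) x∈)
  , λ { Fin.zero → Rx ; (Fin.suc i) → Rg i }

∈-allFuns-≗ : ∀ {A : Set} k xs (f : Fin k → A) → (∀ i → f i ∈ xs) → ∃[ g ]
  (g ∈ allFuns k xs × ∀ i → g i ≡ f i)
∈-allFuns-≗ k xs f h = ∈-allFuns _≡_ k xs f λ i → f i , h i , refl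

∈-allGraphs : ∀ {n} (G : Graph n) → ∃[ G' ] (G' ∈ allGraphs n × ∀ i j → G' i j ≡ G i j)
∈-allGraphs {n} G = ∈-allFuns (λ f g → ∀ j → f j ≡ g j) n _ G λ i → ∈-allFuns-≗ n (true ∷ false ∷ []) (G i)
  (λ j → bool (G i j))
  where
  bool : ∀ b → b ∈ true ∷ false ∷ []
  bool true = here refl
  bool false = there (here refl)

adj-cong : ∀ {n} {G G' : Graph n} → (∀ i j → G i j ≡ G' i j) → ∀ i j → adj G i j ≡ adj G' i j
adj-cong h i j rewrite h i j | h j i = refl

adj-sym : ∀ {n} (G : Graph n) i j → adj G i j ≡ adj G j i
adj-sym G i j with toℕ i <ᵇ toℕ j in p | toℕ j <ᵇ toℕ i in q
... | true | true = ⊥-elim (<-asym (<ᵇ⇒< (toℕ i) (toℕ j) (subst Bool.T (sym p) _))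
  (<ᵇ⇒< (toℕ j) (toℕ i) (subst Bool.T (sym q) _)))
... | true | false = refl
... | false | true = refl
... | false | false = refl

adj⇒ : ∀ {n} (G : Graph n) i j → adj G i j ≡ true → (toℕ i < toℕ j × G i j ≡ true) ⊎
  (toℕ j < toℕ i × G j i ≡ true)
adj⇒ G i j h with toℕ i <ᵇ toℕ j in p | toℕ j <ᵇ toℕ i in q
... | true | _ = inj₁ (<ᵇ⇒< (toℕ i) (toℕ j) (subst Bool.T (sym p) _) , h)
... | false | true = inj₂ (<ᵇ⇒< (toℕ j) (toℕ i) (subst Bool.T (sym q) _) , h)

adj-irrefl : ∀ {n} (G : Graph n) i → adj G i i ≡ false
adj-irrefl G i with toℕ i <ᵇ toℕ i in p
... | true = ⊥-elim (<-irrefl refl (<ᵇ⇒< (toℕ i) (toℕ i) (subst Bool.T (sym p) _)))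
... | false = refl

Embeds : ∀ {n h} → Graph n → Graph h → Set
Embeds {n} {h} G H = Σ (Fin h → Fin n) λ f → (∀ i j → f i ≡ f j → i ≡ j) ×
  (∀ i j → adj H i j ≡ true → adj G (f i) (f j) ≡ true)

Embeds-cong : ∀ {n h} {G G' : Graph n} (H : Graph h) → (∀ i j → G i j ≡ G' i j) → Embeds G H → Embeds G' H
Embeds-cong H e (f , inj , hom) = f , inj , λ i j a → trans (sym (adj-cong e (f i) (f j))) (hom i j a)

private
  not∨ : ∀ {a b} → (a ≡ true → b ≡ true) → not a ∨ b ≡ true
  not∨ {true} h = h refl
  not∨ {false} h = refl

  not∨⁻¹ : ∀ {a b} → not a ∨ b ≡ true → a ≡ true → b ≡ true
  not∨⁻¹ {true} h refl = h

  ≡ᵇ-true : ∀ {m n} → (m ≡ᵇ n) ≡ true → m ≡ n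
  ≡ᵇ-true {m} {n} h = ≡ᵇ⇒≡ m n (subst Bool.T (sym h) _)

  ≡ᵇ-refl : ∀ m → (m ≡ᵇ m) ≡ true
  ≡ᵇ-refl zero = refl
  ≡ᵇ-refl (suc m) = ≡ᵇ-refl m

contains-complete : ∀ {n h} (G : Graph n) (H : Graph h) → Embeds G H → contains G H ≡ true
contains-complete {n} {h} G H (f , inj , hom) with ∈-allFuns-≗ h (allFin n) f (λ i → ∈-allFin (f i))
... | g , g∈ , g≗f = any-true _ (allFuns h (allFin n)) g∈ (cong₂ _∧_
  (allV-true _ λ i → allV-true _ λ j → injective i j)
  (allV-true _ λ i → allV-true _ λ j → not∨ λ a → trans (cong₂ (adj G) (g≗f i) (g≗f j)) (hom i j a)))
  where
  injective : ∀ i j → (toℕ i ≡ᵇ toℕ j) ∨ not (toℕ (g i) ≡ᵇ toℕ (g j)) ≡ true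
  injective i j with toℕ (g i) ≡ᵇ toℕ (g j) in eq
  ... | false = ∨-zeroʳ (toℕ i ≡ᵇ toℕ j)
  ... | true with refl ← inj i j (trans (sym (g≗f i)) (trans (Finₚ.toℕ-injective (≡ᵇ-true eq)) (g≗f j))) =
    cong (_∨ false) (≡ᵇ-refl (toℕ i))

contains-sound : ∀ {n h} (G : Graph n) (H : Graph h) → contains G H ≡ true → Embeds G H
contains-sound {n} {h} G H c with any-true⁻¹ _ (allFuns h (allFin n)) c
... | f , _ , pf with ∧-true {injᵇ f} pf
...   | inj , hom = f , injective , λ i j → not∨⁻¹ (allV-true⁻¹ _ (allV-true⁻¹ _ hom i) j)
  where
  injective : ∀ i j → f i ≡ f j → i ≡ j
  injective i j e with allV-true⁻¹ _ (allV-true⁻¹ _ inj i) j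
  ... | b rewrite e | ≡ᵇ-refl (toℕ (f j)) with toℕ i ≡ᵇ toℕ j in eq
  ...   | true = Finₚ.toℕ-injective (≡ᵇ-true eq)

maxList-property : (P : ℕ → Set) → P 0 → ∀ xs → (∀ x → x ∈ xs → P x) → P (maxList xs)
maxList-property P p0 [] h = p0
maxList-property P p0 (x ∷ xs) h with ≤-total x (maxList xs)
... | inj₁ x≤m = subst P (sym (m≤n⇒m⊔n≡n x≤m)) (maxList-property P p0 xs λ y y∈ → h y (there y∈))
... | inj₂ m≤x = subst P (sym (m≥n⇒m⊔n≡m m≤x)) (h x (here refl))

maxList-upper : ∀ {x xs} → x ∈ xs → x ≤ maxList xs
maxList-upper {xs = y ∷ xs} (here refl) = m≤m⊔n y (maxList xs)
maxList-upper {xs = y ∷ xs} (there x∈) = ≤-trans (maxList-upper x∈) (m≤n⊔m y (maxList xs))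

⟦_⟧ : Bool → ℕ
⟦ b ⟧ = if b then 1 else 0

sum-allFin : ∀ {n} (f : Fin n → ℕ) → List.sum (map f (allFin n)) ≡ ∑ f
sum-allFin {n} f = trans (cong List.sum (map-tabulate {n = n} (λ i → i) f)) (go f)
  where
  go : ∀ {n} (f : Fin n → ℕ) → List.sum (tabulate f) ≡ ∑ f
  go {zero} f = refl
  go {suc n} f = cong (λ w → f Fin.zero + w) (go (f ∘ Fin.suc))

edges-∑ : ∀ {n} (G : Graph n) → edges G ≡ ∑ (λ i → ∑ (λ j → ⟦ (toℕ i <ᵇ toℕ j) ∧ adj G i j ⟧))
edges-∑ {n} G = trans (sum-allFin {n} _) (sum-cong-≗ {n} λ i → sum-allFin {n} _)

∑-mono : ∀ {n} {f g : Fin n → ℕ} → (∀ i → f i ≤ g i) → ∑ f ≤ ∑ g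
∑-mono {zero} h = z≤n
∑-mono {suc n} h = +-mono-≤ (h Fin.zero) (∑-mono (h ∘ Fin.suc))

∑-const : ∀ n c → ∑ {n} (λ _ → c) ≡ n * c
∑-const zero c = refl
∑-const (suc n) c = cong (λ w → c + w) (∑-const n c)

∑-point : ∀ {n} (f : Fin n → ℕ) i → (∀ j → j ≢ i → f j ≡ 0) → ∑ f ≡ f i
∑-point {suc n} f Fin.zero h = trans (cong (λ w → f Fin.zero + w)
  (trans (sum-cong-≗ {n} λ j → h (Fin.suc j) λ ()) (trans (∑-const n 0) (*-zeroʳ n))))
  (+-identityʳ (f Fin.zero))
∑-point {suc n} f (Fin.suc i) h = cong₂ _+_ (h Fin.zero λ ()) (∑-point (f ∘ Fin.suc) i λ j ne → h (Fin.suc j)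
  (ne ∘ Finₚ.suc-injective))

count-enumerate : ∀ {n} (P : Fin n → Bool) s → s ≤ ∑ (λ i → ⟦ P i ⟧) → Σ (Fin s → Fin n) λ g →
  (∀ i j → g i ≡ g j → i ≡ j) × (∀ i → P (g i) ≡ true)
count-enumerate P zero _ = (λ ()) , (λ ()) , λ ()
count-enumerate {suc n} P (suc s) h with P Fin.zero in eq
... | false with count-enumerate (P ∘ Fin.suc) (suc s) h
...   | g , inj , hits = Fin.suc ∘ g , (λ i j e → inj i j (Finₚ.suc-injective e)) , hits
count-enumerate {suc n} P (suc s) (s≤s h) | true with count-enumerate (P ∘ Fin.suc) s h
...   | g , inj , hits = f , inj' , λ { Fin.zero → eq ; (Fin.suc i) → hits i }
  where
  f : Fin (suc s) → Fin (suc n)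
  f Fin.zero = Fin.zero
  f (Fin.suc i) = Fin.suc (g i)
  inj' : ∀ i j → f i ≡ f j → i ≡ j
  inj' Fin.zero Fin.zero _ = refl
  inj' (Fin.suc i) (Fin.suc j) e = cong Fin.suc (inj i j (Finₚ.suc-injective e))

K2-adj : ∀ s (i j : Fin (2 + s)) → adj (K2 s) i j ≡ true → K2 s i j ≡ true
K2-adj s i j h with adj⇒ (K2 s) i j h
... | inj₁ (_ , e) = e
... | inj₂ (_ , e) = trans (xor-comm (toℕ i <ᵇ 2) (toℕ j <ᵇ 2)) e

K2-embeds : ∀ {n} (G : Graph n) s u v → u ≢ v → s ≤ ∑ (λ w → ⟦ adj G w u ∧ adj G w v ⟧) → Embeds G (K2 s)
K2-embeds {n} G s u v u≢v many with count-enumerate (λ w → adj G w u ∧ adj G w v) s many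
... | g , g-inj , g-adj = f , f-inj , λ i j a → f-adj i j (K2-adj s i j a)
  where
  f : Fin (2 + s) → Fin n
  f Fin.zero = u
  f (Fin.suc Fin.zero) = v
  f (Fin.suc (Fin.suc i)) = g i
  gu : ∀ i → adj G (g i) u ≡ true
  gu i = proj₁ (∧-true (g-adj i))
  gv : ∀ i → adj G (g i) v ≡ true
  gv i = proj₂ (∧-true {adj G (g i) u} (g-adj i))
  ≢-adj : ∀ {a b} → adj G a b ≡ true → a ≢ b
  ≢-adj {a} h refl with () ← trans (sym h) (adj-irrefl G a)
  f-inj : ∀ i j → f i ≡ f j → i ≡ j
  f-inj Fin.zero Fin.zero _ = refl
  f-inj Fin.zero (Fin.suc Fin.zero) e = ⊥-elim (u≢v e)
  f-inj Fin.zero (Fin.suc (Fin.suc j)) e = ⊥-elim (≢-adj (gu j) (sym e))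
  f-inj (Fin.suc Fin.zero) Fin.zero e = ⊥-elim (u≢v (sym e))
  f-inj (Fin.suc Fin.zero) (Fin.suc Fin.zero) e = refl
  f-inj (Fin.suc Fin.zero) (Fin.suc (Fin.suc j)) e = ⊥-elim (≢-adj (gv j) (sym e))
  f-inj (Fin.suc (Fin.suc i)) Fin.zero e = ⊥-elim (≢-adj (gu i) e)
  f-inj (Fin.suc (Fin.suc i)) (Fin.suc Fin.zero) e = ⊥-elim (≢-adj (gv i) e)
  f-inj (Fin.suc (Fin.suc i)) (Fin.suc (Fin.suc j)) e = cong (Fin.suc ∘ Fin.suc) (g-inj i j e)
  f-adj : ∀ i j → K2 s i j ≡ true → adj G (f i) (f j) ≡ true
  f-adj Fin.zero (Fin.suc (Fin.suc j)) _ = trans (adj-sym G u (g j)) (gu j)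
  f-adj (Fin.suc Fin.zero) (Fin.suc (Fin.suc j)) _ = trans (adj-sym G v (g j)) (gv j)
  f-adj (Fin.suc (Fin.suc i)) Fin.zero _ = gu i
  f-adj (Fin.suc (Fin.suc i)) (Fin.suc Fin.zero) _ = gv i

-- The upper bound for bipartite graphs

2ab≤a²+b² : ∀ a b → 2 * (a * b) ≤ a * a + b * b
2ab≤a²+b² a b with ≤-total a b
... | inj₁ a≤b = go a (b ∸ a) b (m+[n∸m]≡n a≤b)
  where
  go : ∀ a d b → a + d ≡ b → 2 * (a * b) ≤ a * a + b * b
  go a d .(a + d) refl = lin (z≤n {0}) (d * d) (solve (a ∷ d ∷ []))
... | inj₂ b≤a = go b (a ∸ b) a (m+[n∸m]≡n b≤a)
  where
  go : ∀ b d a → b + d ≡ a → 2 * (a * b) ≤ a * a + b * b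
  go b d .(b + d) refl = lin (z≤n {0}) (d * d) (solve (b ∷ d ∷ []))

∑-product : ∀ {m n} (f : Fin m → ℕ) (g : Fin n → ℕ) → ∑ (λ i → ∑ (λ j → f i * g j)) ≡ ∑ f * ∑ g
∑-product {m} {n} f g = trans (sum-cong-≗ {m} λ i → sym (*-distribˡ-sum {n} (f i) g))
  (sym (*-distribʳ-sum {m} (∑ g) f))

cauchy-schwarz : ∀ {n} (x y : Fin n → ℕ) → ∑ (λ i → x i * y i) * ∑ (λ i → x i * y i) ≤ ∑ (λ i → x i * x i) * ∑
  (λ i → y i * y i)
cauchy-schwarz {n} x y = *-cancelˡ-≤ 2 (begin
  2 * (∑ xy * ∑ xy) ≡⟨ cong (2 *_) (sym (∑-product xy xy)) ⟩
  2 * ∑ (λ i → ∑ (λ j → xy i * xy j)) ≡⟨ trans (*-distribˡ-sum {n} 2 _)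
    (sum-cong-≗ {n} λ i → *-distribˡ-sum {n} 2 _) ⟩
  ∑ (λ i → ∑ (λ j → 2 * (xy i * xy j))) ≤⟨ ∑-mono (λ i → ∑-mono λ j → ≤-trans
    (≤-reflexive (regroup (x i) (y i) (x j) (y j))) (≤-trans (2ab≤a²+b² (x i * y j) (x j * y i))
    (≤-reflexive (expand (x i) (y i) (x j) (y j))))) ⟩
  ∑ (λ i → ∑ (λ j → xx i * yy j + yy i * xx j)) ≡⟨ trans (sum-cong-≗ {n} λ i → ∑-distrib-+ {n} _ _)
    (∑-distrib-+ {n} _ _) ⟩
  ∑ (λ i → ∑ (λ j → xx i * yy j)) + ∑ (λ i → ∑ (λ j → yy i * xx j)) ≡⟨ cong₂ _+_ (∑-product xx yy)
    (∑-product yy xx) ⟩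
  ∑ xx * ∑ yy + ∑ yy * ∑ xx ≡⟨ double (∑ xx) (∑ yy) ⟩
  2 * (∑ xx * ∑ yy) ∎)
  where
  open ≤-Reasoning
  xy xx yy : Fin n → ℕ
  xy i = x i * y i
  xx i = x i * x i
  yy i = y i * y i
  regroup : ∀ a b c d → 2 * (a * b * (c * d)) ≡ 2 * (a * d * (c * b))
  regroup = solve-∀
  expand : ∀ a b c d → a * d * (a * d) + c * b * (c * b) ≡ a * a * (d * d) + b * b * (c * c)
  expand = solve-∀
  double : ∀ a b → a * b + b * a ≡ 2 * (a * b)
  double = solve-∀

kővári-sós-turán : ∀ {p q} (m : Fin p → Fin q → ℕ) (ρ : Fin p → ℕ) (σ : Fin q → ℕ) κ →
  (∀ w u → m w u * m w u ≡ m w u) → (∀ w u → ρ w * m w u ≡ m w u) → (∀ w → ρ w * ρ w ≡ ρ w) →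
  (∀ u v → u ≢ v → ∑ (λ w → m w u * m w v) ≤ κ * (σ u * σ v)) →
  let e = ∑ (λ w → ∑ (m w)) in e * e ≤ ∑ ρ * (e + κ * (∑ σ * ∑ σ))
kővári-sós-turán {p} {q} m ρ σ κ m² ρm ρ² codegree = begin
  e * e ≡⟨ cong₂ _*_ e-formula e-formula ⟩
  ∑ (λ w → ρ w * d w) * ∑ (λ w → ρ w * d w) ≤⟨ cauchy-schwarz ρ d ⟩
  ∑ (λ w → ρ w * ρ w) * ∑ (λ w → d w * d w) ≡⟨ cong₂ _*_ (sum-cong-≗ {p} ρ²)
    (trans (sum-cong-≗ {p} λ w → sym (∑-product (m w) (m w))) (trans (∑-comm {p} {q} _)
    (sum-cong-≗ {q} λ u → ∑-comm {p} {q} _))) ⟩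
  ∑ ρ * ∑ (λ u → ∑ (λ v → ∑ (λ w → m w u * m w v))) ≤⟨ *-monoʳ-≤ (∑ ρ)
    (∑-mono λ u → ∑-mono λ v → pair u v (u Finₚ.≟ v)) ⟩
  ∑ ρ * ∑ (λ u → ∑ (λ v → diagonal u v (u Finₚ.≟ v) + κ * (σ u * σ v)))
    ≡⟨ cong (∑ ρ *_) (trans (sum-cong-≗ {q} λ u → ∑-distrib-+ {q} _ _)
      (trans (∑-distrib-+ {q} _ _) (cong₂ _+_ diagonal-sum off-diagonal))) ⟩
  ∑ ρ * (e + κ * (∑ σ * ∑ σ)) ∎
  where
  open ≤-Reasoning
  d : Fin p → ℕ
  d w = ∑ (m w)
  e = ∑ d
  e-formula : e ≡ ∑ (λ w → ρ w * d w)
  e-formula = sum-cong-≗ {p} λ w → trans (sum-cong-≗ {q} λ u → sym (ρm w u))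
    (sym (*-distribˡ-sum {q} (ρ w) (m w)))
  diagonal : ∀ u v → Dec (u ≡ v) → ℕ
  diagonal u v (yes _) = ∑ (λ w → m w u)
  diagonal u v (no _) = 0
  pair : ∀ u v (eq : Dec (u ≡ v)) → ∑ (λ w → m w u * m w v) ≤ diagonal u v eq + κ * (σ u * σ v)
  pair u .u (yes refl) = ≤-trans (≤-reflexive (sum-cong-≗ {p} λ w → m² w u)) (m≤m+n _ _)
  pair u v (no ne) = codegree u v ne
  diagonal-sum : ∑ (λ u → ∑ (λ v → diagonal u v (u Finₚ.≟ v))) ≡ e
  diagonal-sum = trans (sum-cong-≗ {q} λ u → trans (∑-point _ u λ v ne → off u v ne (u Finₚ.≟ v))
    (on u (u Finₚ.≟ u))) (sym (∑-comm {p} {q} m))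
    where
    off : ∀ u v → v ≢ u → (eq : Dec (u ≡ v)) → diagonal u v eq ≡ 0
    off u v ne (yes refl) = ⊥-elim (ne refl)
    off u v ne (no _) = refl
    on : ∀ u (eq : Dec (u ≡ u)) → diagonal u u eq ≡ ∑ (λ w → m w u)
    on u (yes _) = refl
    on u (no ne) = ⊥-elim (ne refl)
  off-diagonal : ∑ (λ u → ∑ (λ v → κ * (σ u * σ v))) ≡ κ * (∑ σ * ∑ σ)
  off-diagonal = trans (sum-cong-≗ {q} λ u → sym (*-distribˡ-sum {q} κ _))
    (trans (sym (*-distribˡ-sum {q} κ _)) (cong (κ *_) (∑-product σ σ)))

⟦⟧² : ∀ b → ⟦ b ⟧ * ⟦ b ⟧ ≡ ⟦ b ⟧
⟦⟧² true = refl
⟦⟧² false = refl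

⟦∧⟧ : ∀ a b → ⟦ a ∧ b ⟧ ≡ ⟦ a ⟧ * ⟦ b ⟧
⟦∧⟧ true b = sym (+-identityʳ ⟦ b ⟧)
⟦∧⟧ false b = refl

codegree-bound : ∀ {n} (G : Graph n) s u v → u ≢ v → contains G (K2 (suc s)) ≡ false → ∑
  (λ w → ⟦ adj G w u ∧ adj G w v ⟧) ≤ s
codegree-bound G s u v u≢v free with ≤-<-connex (∑ (λ w → ⟦ adj G w u ∧ adj G w v ⟧)) s
... | inj₁ h = h
... | inj₂ h with () ← trans (sym free) (contains-complete G (K2 (suc s)) (K2-embeds G (suc s) u v u≢v h))

module _ {n : ℕ} (G : Graph n) (c : Fin n → Bool) (coloring : ∀ i j → adj G i j ≡ true → c i xor c j ≡ true) where
  private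
    ρ σ : Fin n → ℕ
    ρ w = ⟦ c w ⟧
    σ u = ⟦ not (c u) ⟧
    m : Fin n → Fin n → ℕ
    m w u = ρ w * σ u * ⟦ adj G w u ⟧
    E : Fin n → Fin n → ℕ
    E i j = ⟦ (toℕ i <ᵇ toℕ j) ∧ adj G i j ⟧

    split : ∀ i j → E i j ≡ E i j * (ρ i * σ j) + E i j * (ρ j * σ i)
    split i j with adj G i j in eq
    ... | false rewrite ∧-zeroʳ (toℕ i <ᵇ toℕ j) = refl
    ... | true = go (⟦ (toℕ i <ᵇ toℕ j) ∧ true ⟧) (c i) (c j) (coloring i j eq)
      where
      go : ∀ b x y → x xor y ≡ true → b ≡ b * (⟦ x ⟧ * ⟦ not y ⟧) + b * (⟦ y ⟧ * ⟦ not x ⟧)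
      go b true false _ = solve (b ∷ [])
      go b false true _ = solve (b ∷ [])

    orient : ∀ i j → E i j + E j i ≡ ⟦ adj G i j ⟧
    orient i j = trans (cong (λ t → E i j + ⟦ (toℕ j <ᵇ toℕ i) ∧ t ⟧) (adj-sym G j i))
      (go (toℕ i <ᵇ toℕ j) (toℕ j <ᵇ toℕ i) (adj G i j) refl refl refl)
      where
      go : ∀ a b e → (toℕ i <ᵇ toℕ j) ≡ a → (toℕ j <ᵇ toℕ i) ≡ b → adj G i j ≡ e → ⟦ a ∧ e ⟧ + ⟦ b ∧ e ⟧ ≡ ⟦ e
        ⟧
      go true true e p q r = ⊥-elim (<-asym (<ᵇ⇒< (toℕ i) (toℕ j) (subst Bool.T (sym p) _))
        (<ᵇ⇒< (toℕ j) (toℕ i) (subst Bool.T (sym q) _)))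
      go true false e p q r = +-identityʳ ⟦ e ⟧
      go false true e p q r = refl
      go false false false p q r = refl
      go false false true p q r with adj⇒ G i j r
      ... | inj₁ (h , _) with () ← subst Bool.T p (<⇒<ᵇ h)
      ... | inj₂ (h , _) with () ← subst Bool.T q (<⇒<ᵇ h)

  edges-bipartite : edges G ≡ ∑ (λ w → ∑ (m w))
  edges-bipartite = begin
    edges G ≡⟨ edges-∑ G ⟩
    ∑ (λ i → ∑ (λ j → E i j)) ≡⟨ sum-cong-≗ {n} (λ i → sum-cong-≗ {n} λ j → split i j) ⟩
    ∑ (λ i → ∑ (λ j → E i j * (ρ i * σ j) + E i j * (ρ j * σ i))) ≡⟨ trans
      (sum-cong-≗ {n} λ i → ∑-distrib-+ {n} _ _) (∑-distrib-+ {n} _ _) ⟩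
    ∑ (λ i → ∑ (λ j → E i j * (ρ i * σ j))) + ∑ (λ i → ∑ (λ j → E i j * (ρ j * σ i))) ≡⟨ cong
      (λ t → ∑ (λ i → ∑ (λ j → E i j * (ρ i * σ j))) + t) (∑-comm {n} {n} _) ⟩
    ∑ (λ i → ∑ (λ j → E i j * (ρ i * σ j))) + ∑ (λ i → ∑ (λ j → E j i * (ρ i * σ j))) ≡⟨ sym
      (trans (sum-cong-≗ {n} λ i → ∑-distrib-+ {n} _ _) (∑-distrib-+ {n} _ _)) ⟩
    ∑ (λ i → ∑ (λ j → E i j * (ρ i * σ j) + E j i * (ρ i * σ j))) ≡⟨ sum-cong-≗ {n}
      (λ i → sum-cong-≗ {n} λ j → trans (factor (E i j) (E j i) (ρ i * σ j))
      (cong (ρ i * σ j *_) (orient i j))) ⟩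
    ∑ (λ w → ∑ (m w)) ∎
    where
    open ≡-Reasoning
    factor : ∀ a b x → a * x + b * x ≡ x * (a + b)
    factor = solve-∀

  bipartite-bound : ∀ t → contains G (K2 (suc (2 * t))) ≡ false → 4 * (edges G * edges G) ≤ t * (n * n * n) +
    2 * (n * edges G)
  bipartite-bound t free = subst (λ e → 4 * (e * e) ≤ t * (n * n * n) + 2 * (n * e)) (sym edges-bipartite)
    (combine (∑ ρ) (∑ σ) t e parts
      (kővári-sós-turán m ρ σ (2 * t) m² ρm (λ w → ⟦⟧² (c w)) columns)
      (subst (λ e → e * e ≤ ∑ σ * (e + 2 * t * (∑ ρ * ∑ ρ))) (sym (∑-comm {n} {n} m))
        (kővári-sós-turán (λ u w → m w u) σ ρ (2 * t) (λ u w → m² w u) (λ u w → σm w u)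
        (λ u → ⟦⟧² (not (c u))) rows)))
    where
    e = ∑ (λ w → ∑ (m w))
    m² : ∀ w u → m w u * m w u ≡ m w u
    m² w u = trans (rearrange (ρ w) (σ u) ⟦ adj G w u ⟧) (cong₂ _*_ (cong₂ _*_ (⟦⟧² (c w)) (⟦⟧² (not (c u))))
      (⟦⟧² (adj G w u)))
      where rearrange : ∀ a b c → a * b * c * (a * b * c) ≡ a * a * (b * b) * (c * c)
            rearrange = solve-∀
    ρm : ∀ w u → ρ w * m w u ≡ m w u
    ρm w u = trans (rearrange (ρ w) (σ u) ⟦ adj G w u ⟧) (cong (λ t → t * σ u * ⟦ adj G w u ⟧) (⟦⟧² (c w)))
      where rearrange : ∀ a b c → a * (a * b * c) ≡ a * a * b * c
            rearrange = solve-∀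
    σm : ∀ w u → σ u * m w u ≡ m w u
    σm w u = trans (rearrange (ρ w) (σ u) ⟦ adj G w u ⟧) (cong (λ t → ρ w * t * ⟦ adj G w u ⟧)
      (⟦⟧² (not (c u))))
      where rearrange : ∀ a b c → b * (a * b * c) ≡ a * (b * b) * c
            rearrange = solve-∀
    ⟦⟧≤1 : ∀ b → ⟦ b ⟧ ≤ 1
    ⟦⟧≤1 true = ≤-refl
    ⟦⟧≤1 false = z≤n
    columns : ∀ u v → u ≢ v → ∑ (λ w → m w u * m w v) ≤ 2 * t * (σ u * σ v)
    columns u v ne = ≤-trans (∑-mono λ w → ≤-trans (≤-reflexive
      (trans (rearrange (ρ w) (σ u) (σ v) ⟦ adj G w u ⟧ ⟦ adj G w v ⟧)
      (cong₂ (λ a b → a * (σ u * σ v) * b) (⟦⟧² (c w)) (sym (⟦∧⟧ (adj G w u) (adj G w v))))))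
        (*-monoˡ-≤ ⟦ adj G w u ∧ adj G w v ⟧ (*-monoˡ-≤ (σ u * σ v) (⟦⟧≤1 (c w)))))
      (≤-trans (≤-reflexive (sym (*-distribˡ-sum {n} (1 * (σ u * σ v)) (λ w → ⟦ adj G w u ∧ adj G w v ⟧))))
      (≤-trans (*-monoʳ-≤ (1 * (σ u * σ v)) (codegree-bound G (2 * t) u v ne free))
        (≤-reflexive (swap (σ u * σ v) (2 * t)))))
      where rearrange : ∀ a b b' c c' → a * b * c * (a * b' * c') ≡ a * a * (b * b') * (c * c')
            rearrange = solve-∀
            swap : ∀ a b → 1 * a * b ≡ b * a
            swap = solve-∀
    rows : ∀ w w' → w ≢ w' → ∑ (λ u → m w u * m w' u) ≤ 2 * t * (ρ w * ρ w')
    rows w w' ne = ≤-trans (∑-mono λ u → ≤-trans (≤-reflexive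
      (trans (rearrange (ρ w) (ρ w') (σ u) ⟦ adj G w u ⟧ ⟦ adj G w' u ⟧)
      (cong₂ (λ a b → a * (ρ w * ρ w') * b) (⟦⟧² (not (c u)))
        (trans (cong₂ (λ a b → ⟦ a ⟧ * ⟦ b ⟧) (adj-sym G w u) (adj-sym G w' u))
          (sym (⟦∧⟧ (adj G u w) (adj G u w')))))))
        (*-monoˡ-≤ ⟦ adj G u w ∧ adj G u w' ⟧ (*-monoˡ-≤ (ρ w * ρ w') (⟦⟧≤1 (not (c u))))))
      (≤-trans (≤-reflexive (sym (*-distribˡ-sum {n} (1 * (ρ w * ρ w')) (λ u → ⟦ adj G u w ∧ adj G u w' ⟧))))
      (≤-trans (*-monoʳ-≤ (1 * (ρ w * ρ w')) (codegree-bound G (2 * t) w w' ne free))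
        (≤-reflexive (swap (ρ w * ρ w') (2 * t)))))
      where rearrange : ∀ a a' b c c' → a * b * c * (a' * b * c') ≡ b * b * (a * a') * (c * c')
            rearrange = solve-∀
            swap : ∀ a b → 1 * a * b ≡ b * a
            swap = solve-∀
    parts : ∑ ρ + ∑ σ ≡ n
    parts = trans (sym (∑-distrib-+ {n} ρ σ)) (trans (sum-cong-≗ {n} λ i → one (c i))
      (trans (∑-const n 1) (*-identityʳ n)))
      where one : ∀ b → ⟦ b ⟧ + ⟦ not b ⟧ ≡ 1
            one true = refl
            one false = refl
    combine : ∀ a b t e {n} → a + b ≡ n → e * e ≤ a * (e + 2 * t * (b * b)) → e * e ≤ b *
      (e + 2 * t * (a * a)) → 4 * (e * e) ≤ t * (n * n * n) + 2 * (n * e)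
    combine a b t e refl h1 h2 = go (2ab≤a²+b² a b)
      where
      go : 2 * (a * b) ≤ a * a + b * b → 4 * (e * e) ≤ t * ((a + b) * (a + b) * (a + b)) + 2 * ((a + b) * e)
      go h3 = lin (2 ⊛ h1 ⊹ 2 ⊛ h2 ⊹ (a * t + b * t) ⊛ h3) 0 (solve (a ∷ b ∷ t ∷ e ∷ []))

z-bound : ∀ n t → 4 * (z n (K2 (suc (2 * t))) * z n (K2 (suc (2 * t)))) ≤ t * (n * n * n) + 2 *
  (n * z n (K2 (suc (2 * t))))
z-bound n t = maxList-property (λ e → 4 * (e * e) ≤ t * (n * n * n) + 2 * (n * e)) z≤n _ λ e e∈ → each e
  (∈-map⁻ _ e∈)
  where
  H = K2 (suc (2 * t))
  each : ∀ e → ∃[ G ] (G ∈ allGraphs n × e ≡ (if bipartite G ∧ not (contains G H) then edges G else 0)) → 4 *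
    (e * e) ≤ t * (n * n * n) + 2 * (n * e)
  each e (G , _ , refl) with bipartite G in bip | contains G H in free
  ... | false | _ = z≤n
  ... | true | true = z≤n
  ... | true | false with any-true⁻¹ _ (allFuns n (true ∷ false ∷ [])) bip
  ...   | c , _ , good = bipartite-bound G c (λ i j a → proper i j a (allV-true⁻¹ _ (allV-true⁻¹ _ good i) j))
    t free
    where
    proper : ∀ i j → adj G i j ≡ true → not (adj G i j) ∨ (c i xor c j) ≡ true → c i xor c j ≡ true
    proper i j a h rewrite a = h

-- The construction of triangle-free graphs

module ModPrime (q : ℕ) (prime-q : Prime q) (3<q : 3 < q) where
  private
    p : ℤ
    p = + q

    instance
      q≢0 : NonZero q
      q≢0 = prime⇒nonZero prime-q

  by-identity : ∀ {a b : ℤ} → a ≡ b → p ∣ℤ a → p ∣ℤ b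
  by-identity = subst (p ∣ℤ_)

  euclid : ∀ a b → p ∣ℤ a ℤ.* b → (p ∣ℤ a) ⊎ (p ∣ℤ b)
  euclid a b h with euclidsLemma ∣ a ∣ ∣ b ∣ prime-q (subst (q ∣_) (ℤₚ.∣i*j∣≡∣i∣*∣j∣ a b) (ℤ∣.∣⇒∣ᵤ h))
  ... | inj₁ h' = inj₁ (ℤ∣.∣ᵤ⇒∣ h')
  ... | inj₂ h' = inj₂ (ℤ∣.∣ᵤ⇒∣ h')

  private
    ∣-small-≤ : ∀ a b → a < q → b ≤ a → p ∣ℤ + a ℤ.- + b → a ≡ b
    ∣-small-≤ a b a<q b≤a h with a ∸ b in eq | subst (q ∣_) (cong ∣_∣ (trans (ℤₚ.m-n≡m⊖n a b) (ℤₚ.⊖-≥ b≤a)))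
      (ℤ∣.∣⇒∣ᵤ h)
    ... | zero | _ = ≤-antisym (m∸n≡0⇒m≤n eq) b≤a
    ... | suc d | q∣d = ⊥-elim (<-irrefl refl (<-≤-trans a<q
      (≤-trans (∣⇒≤ q∣d) (≤-trans (≤-reflexive (sym eq)) (m∸n≤m a b)))))

  ∣-small : ∀ {a b} → a < q → b < q → p ∣ℤ + a ℤ.- + b → a ≡ b
  ∣-small {a} {b} a<q b<q h with ≤-total a b
  ... | inj₁ a≤b = sym (∣-small-≤ b a b<q a≤b (by-identity (flip (+ a) (+ b)) (ℤ∣.∣m⇒∣-m h)))
    where
    flip : ∀ x y → ℤ.- (x ℤ.- y) ≡ y ℤ.- x
    flip = ℤ-Ring.solve-∀
  ... | inj₂ b≤a = ∣-small-≤ a b a<q b≤a h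

  ∤-constant : ∀ c → 1 ≤ c → c < q → ¬ p ∣ℤ + c
  ∤-constant c 1≤c c<q h = <-irrefl (sym
    (∣-small c<q (≤-trans 1≤c (<⇒≤ c<q)) (by-identity (sym (ℤₚ.+-identityʳ (+ c))) h))) 1≤c

  residue : ∀ (a : ℤ) → ∃[ r ] (r < q × p ∣ℤ a ℤ.- + r)
  residue a = a ℤ.%ℕ q , ℤ.n%ℕd<d a q , dividesℤ (a ℤ./ℕ q) (trans
    (cong (ℤ._- + (a ℤ.%ℕ q)) (ℤ.a≡a%ℕn+[a/ℕn]*n a q)) (cancel (+ (a ℤ.%ℕ q)) ((a ℤ./ℕ q) ℤ.* p)))
    where cancel : ∀ x y → (x ℤ.+ y) ℤ.- x ≡ y
          cancel = ℤ-Ring.solve-∀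

  inverse : ∀ g → ¬ p ∣ℤ g → ∃[ h ] (p ∣ℤ g ℤ.* h ℤ.- + 1)
  inverse g p∤g with residue g
  ... | zero , _ , p∣g = ⊥-elim (p∤g (by-identity (ℤₚ.+-identityʳ g) p∣g))
  ... | r@(suc _) , r<q , p∣g-r with coprime-Bézout (prime⇒coprime prime-q r<q)
  ...   | Bézout.+- x y e = ℤ.- + y , by-identity (combine g (+ r) (+ y))
    (ℤ∣.∣m∣n⇒∣m+n (ℤ∣.∣m⇒∣-m (ℤ∣.∣n⇒∣m*n (+ y) p∣g-r))
          (by-identity (sym (key (+ y) (+ r) (+ x) p (trans (cong (λ t → + 1 ℤ.+ t) (sym (ℤₚ.pos-* y r)))
            (trans (cong +_ e) (ℤₚ.pos-* x q))))) (ℤ∣.∣m⇒∣-m (ℤ∣.∣n⇒∣m*n (+ x) ℤ∣.∣-refl))))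
    where
    key : ∀ y r x p → + 1 ℤ.+ y ℤ.* r ≡ x ℤ.* p → r ℤ.* (ℤ.- y) ℤ.- + 1 ≡ ℤ.- (x ℤ.* p)
    key y r x p h = trans (rearrange y r) (cong ℤ.-_ h)
      where rearrange : ∀ y r → r ℤ.* (ℤ.- y) ℤ.- + 1 ≡ ℤ.- (+ 1 ℤ.+ y ℤ.* r)
            rearrange = ℤ-Ring.solve-∀
    combine : ∀ g r y → ℤ.- (y ℤ.* (g ℤ.- r)) ℤ.+ (r ℤ.* (ℤ.- y) ℤ.- + 1) ≡ g ℤ.* (ℤ.- y) ℤ.- + 1
    combine = ℤ-Ring.solve-∀
  ...   | Bézout.-+ x y e = + y , by-identity (combine g (+ r) (+ y)) (ℤ∣.∣m∣n⇒∣m+n (ℤ∣.∣n⇒∣m*n (+ y) p∣g-r)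
          (by-identity (sym (key (+ y) (+ r) (+ x) p (trans (cong (λ t → + 1 ℤ.+ t) (sym (ℤₚ.pos-* x q)))
            (trans (cong +_ e) (ℤₚ.pos-* y r))))) (ℤ∣.∣n⇒∣m*n (+ x) ℤ∣.∣-refl)))
    where
    key : ∀ y r x p → + 1 ℤ.+ x ℤ.* p ≡ y ℤ.* r → r ℤ.* y ℤ.- + 1 ≡ x ℤ.* p
    key y r x p h = trans (cong (ℤ._- + 1) (trans (ℤₚ.*-comm r y) (sym h))) (rearrange x p)
      where rearrange : ∀ x p → (+ 1 ℤ.+ x ℤ.* p) ℤ.- + 1 ≡ x ℤ.* p
            rearrange = ℤ-Ring.solve-∀
    combine : ∀ g r y → y ℤ.* (g ℤ.- r) ℤ.+ (r ℤ.* y ℤ.- + 1) ≡ g ℤ.* y ℤ.- + 1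
    combine = ℤ-Ring.solve-∀

  solvable : ∀ s c → ¬ p ∣ℤ s → ∃[ b ] (b < q × p ∣ℤ s ℤ.* + b ℤ.- c)
  solvable s c p∤s with inverse s p∤s
  ... | h , sh≡1 with residue (c ℤ.* h)
  ...   | b , b<q , ch≡b = b , b<q , by-identity (combine s c h (+ b))
    (ℤ∣.∣m∣n⇒∣m-n (ℤ∣.∣n⇒∣m*n c sh≡1) (ℤ∣.∣n⇒∣m*n s ch≡b))
    where combine : ∀ s c h b → c ℤ.* (s ℤ.* h ℤ.- + 1) ℤ.- s ℤ.* (c ℤ.* h ℤ.- b) ≡ s ℤ.* b ℤ.- c
          combine = ℤ-Ring.solve-∀

  private
    sq : ℕ → ℕ → ℤ
    sq x ν = + x ℤ.* + x ℤ.- + 3 ℤ.* + ν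

    root? : ∀ ν → Dec (Σ (Fin q) λ x → p ∣ℤ sq (toℕ x) ν)
    root? ν = Finₚ.any? (λ x → p ∣ℤ? sq (toℕ x) ν)

    -- Choosing for each ν the smaller square root of 3ν in absolute value injects ℤ/q into [0 , q/2].
    not-all-squares : ¬ (∀ (ν : Fin q) → Σ (Fin q) λ x → p ∣ℤ sq (toℕ x) (toℕ ν))
    not-all-squares root = conclude (Finₚ.pigeonhole half<q
      (λ ν → Fin.fromℕ< (s≤s (proj₁ (proj₂ (small ν))))))
      where
      double : ∀ q → q * 2 ≡ q + q
      double = solve-∀
      half<q : suc (q ÷ 2) < q
      half<q = *-cancelʳ-< 2 (suc (q ÷ 2)) q (≤-trans (s≤s (+-monoʳ-≤ 2 (÷-lower q 2)))
        (≤-trans (+-monoˡ-≤ q (<⇒≤ 3<q)) (≤-reflexive (sym (double q)))))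
      reflect : ∀ p x v → (x ℤ.* x ℤ.- + 3 ℤ.* v) ℤ.+ p ℤ.* (p ℤ.- + 2 ℤ.* x) ≡ (p ℤ.- x) ℤ.* (p ℤ.- x) ℤ.- +
        3 ℤ.* v
      reflect = ℤ-Ring.solve-∀
      choose : ∀ ν x → x ≤ q → p ∣ℤ sq x ν → ∃[ y ] (y ≤ q ÷ 2 × p ∣ℤ sq y ν)
      choose ν x x≤q h with x * 2 ≤? q
      ... | yes le = x , ÷-greatest q (s≤s z≤n) le , h
      ... | no gt = q ∸ x , ÷-greatest q (s≤s z≤n) (≤-trans (≤-reflexive (*-distribʳ-∸ 2 q x))
        (m≤n+o⇒m∸n≤o (q * 2) (x * 2) (≤-trans (≤-reflexive (double q)) (+-monoˡ-≤ q (<⇒≤ (≰⇒> gt))))))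
        , by-identity (trans (reflect p (+ x) (+ ν)) (cong (λ t → t ℤ.* t ℤ.- + 3 ℤ.* + ν)
          (trans (ℤₚ.m-n≡m⊖n q x) (ℤₚ.⊖-≥ x≤q))))
            (ℤ∣.∣m∣n⇒∣m+n h (ℤ∣.∣m⇒∣m*n (p ℤ.- + 2 ℤ.* + x) ℤ∣.∣-refl))
      small : ∀ ν → ∃[ x ] (x ≤ q ÷ 2 × p ∣ℤ sq x (toℕ ν))
      small ν = choose (toℕ ν) (toℕ (proj₁ (root ν))) (<⇒≤ (Finₚ.toℕ<n (proj₁ (root ν)))) (proj₂ (root ν))
      distinct : ∀ (ν ν' : Fin q) x x' → x ≡ x' → p ∣ℤ sq x (toℕ ν) → p ∣ℤ sq x' (toℕ ν') → toℕ ν ≡ toℕ ν'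
      distinct ν ν' x .x refl h h' = ∣-small (Finₚ.toℕ<n ν) (Finₚ.toℕ<n ν')
        (cancel-3 (euclid (+ 3) _ (by-identity (subtract (+ x) (+ toℕ ν) (+ toℕ ν')) (ℤ∣.∣m∣n⇒∣m-n h' h))))
        where
        subtract : ∀ x v v' → (x ℤ.* x ℤ.- + 3 ℤ.* v') ℤ.- (x ℤ.* x ℤ.- + 3 ℤ.* v) ≡ + 3 ℤ.* (v ℤ.- v')
        subtract = ℤ-Ring.solve-∀
        cancel-3 : (p ∣ℤ + 3) ⊎ (p ∣ℤ + toℕ ν ℤ.- + toℕ ν') → p ∣ℤ + toℕ ν ℤ.- + toℕ ν'
        cancel-3 (inj₁ h) = ⊥-elim (∤-constant 3 (s≤s z≤n) 3<q h)
        cancel-3 (inj₂ h) = h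
      conclude : (∃[ ν ] ∃[ ν' ] (ν Fin.< ν' × Fin.fromℕ< (s≤s (proj₁ (proj₂ (small ν)))) ≡ Fin.fromℕ<
        (s≤s (proj₁ (proj₂ (small ν')))))) → ⊥
      conclude (ν , ν' , ν<ν' , e) = <-irrefl (distinct ν ν' (proj₁ (small ν)) (proj₁ (small ν'))
        (trans (sym (Finₚ.toℕ-fromℕ< _)) (trans (cong toℕ e) (Finₚ.toℕ-fromℕ< _)))
        (proj₂ (proj₂ (small ν))) (proj₂ (proj₂ (small ν')))) ν<ν'

  NonResidue : ℤ → Set
  NonResidue ν = ∀ X g → p ∣ℤ X ℤ.* X ℤ.- + 3 ℤ.* ν ℤ.* (g ℤ.* g) → p ∣ℤ g

  nonresidue : ∃[ ν ] NonResidue ν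
  nonresidue = conclude (Finₚ.¬∀⟶∃¬ q (λ ν → Σ (Fin q) λ x → p ∣ℤ sq (toℕ x) (toℕ ν)) (λ ν → root? (toℕ ν))
    not-all-squares)
    where
    normalise : ∀ X g g' r v → (g' ℤ.* g') ℤ.* (X ℤ.* X ℤ.- + 3 ℤ.* v ℤ.* (g ℤ.* g)) ℤ.+
      (+ 3 ℤ.* v ℤ.* (g ℤ.* g' ℤ.+ + 1)) ℤ.* (g ℤ.* g' ℤ.- + 1) ℤ.- (X ℤ.* g' ℤ.+ r) ℤ.* (X ℤ.* g' ℤ.- r)
      ≡ r ℤ.* r ℤ.- + 3 ℤ.* v
    normalise = ℤ-Ring.solve-∀
    root : ∀ ν X g g' → p ∣ℤ X ℤ.* X ℤ.- + 3 ℤ.* + ν ℤ.* (g ℤ.* g) → p ∣ℤ g ℤ.* g' ℤ.- + 1 → ∃[ r ]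
      (r < q × p ∣ℤ X ℤ.* g' ℤ.- + r) → Σ (Fin q) λ x → p ∣ℤ sq (toℕ x) ν
    root ν X g g' h gg'≡1 (r , r<q , Xg'≡r) = Fin.fromℕ< r<q , subst (λ t → p ∣ℤ sq t ν)
      (sym (Finₚ.toℕ-fromℕ< r<q))
      (by-identity (normalise X g g' (+ r) (+ ν)) (ℤ∣.∣m∣n⇒∣m-n
        (ℤ∣.∣m∣n⇒∣m+n (ℤ∣.∣n⇒∣m*n (g' ℤ.* g') h) (ℤ∣.∣n⇒∣m*n (+ 3 ℤ.* + ν ℤ.* (g ℤ.* g' ℤ.+ + 1)) gg'≡1))
        (ℤ∣.∣n⇒∣m*n (X ℤ.* g' ℤ.+ + r) Xg'≡r)))
    conclude : ∃[ ν ] (¬ (Σ (Fin q) λ x → p ∣ℤ sq (toℕ x) (toℕ ν))) → ∃[ ν ] NonResidue ν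
    conclude (ν , none) = + toℕ ν , nonres
      where
      nonres : NonResidue (+ toℕ ν)
      nonres X g h with p ∣ℤ? g
      ... | yes p∣g = p∣g
      ... | no p∤g = ⊥-elim (none (root (toℕ ν) X g (proj₁ (inverse g p∤g)) h (proj₂ (inverse g p∤g))
        (residue (X ℤ.* proj₁ (inverse g p∤g)))))

record Point : Set where
  constructor point
  field
    part first second : ℕ

open Point

point-≡ : ∀ {u v} → part u ≡ part v → first u ≡ first v → second u ≡ second v → u ≡ v
point-≡ refl refl refl = refl

-- On a triangle the three quadratic forms (a′ − a)² / (k − i) combine to a degenerate form; this makes triangles avoidable.
module Cone (q : ℕ) (prime-q : Prime q) (3<q : 3 < q) (ν : ℤ) where
  open ModPrime q prime-q 3<q

  private
    p : ℤ
    p = + q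

  cone : (s e a b x y : ℤ) → ℤ
  cone s e a b x y = s ℤ.* (y ℤ.- b) ℤ.- (x ℤ.- a) ℤ.* (x ℤ.- a) ℤ.- e

  gap : Point → Point → ℤ
  gap u w = + part w ℤ.- + part u

  link : Point → Point → ℤ
  link u w = cone (gap u w) (ν ℤ.* (gap u w ℤ.* gap u w ℤ.* (gap u w ℤ.* gap u w))) (+ first u) (+ second u)
    (+ first w) (+ second w)

  link-sym : ∀ u w → link u w ≡ link w u
  link-sym u w = algebra ν (+ part u) (+ part w) (+ first u) (+ second u) (+ first w) (+ second w)
    where
    algebra : ∀ v i k a b x y → (k ℤ.- i) ℤ.* (y ℤ.- b) ℤ.- (x ℤ.- a) ℤ.* (x ℤ.- a) ℤ.- v ℤ.*
      ((k ℤ.- i) ℤ.* (k ℤ.- i) ℤ.* ((k ℤ.- i) ℤ.* (k ℤ.- i)))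
      ≡ (i ℤ.- k) ℤ.* (b ℤ.- y) ℤ.- (a ℤ.- x) ℤ.* (a ℤ.- x) ℤ.- v ℤ.*
        ((i ℤ.- k) ℤ.* (i ℤ.- k) ℤ.* ((i ℤ.- k) ℤ.* (i ℤ.- k)))
    algebra = ℤ-Ring.solve-∀

  InBox : Point → Set
  InBox u = part u < q × first u < q × second u < q

  record Linked (u w : Point) : Set where
    constructor linked
    field
      parts-≢ : part u ≢ part w
      divides-link : p ∣ℤ link u w

  open Linked

  Linked-sym : ∀ {u w} → Linked u w → Linked w u
  Linked-sym {u} {w} (linked ne d) = linked (ne ∘ sym) (by-identity (link-sym u w) d)

  gap-unit : ∀ {u w} → InBox u → InBox w → part u ≢ part w → ¬ p ∣ℤ gap u w
  gap-unit {u} {w} (u< , _) (w< , _) ne h = ne (sym (∣-small w< u< h))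

  private
    cancel-unit : ∀ {a b} → ¬ p ∣ℤ a → p ∣ℤ a ℤ.* b → p ∣ℤ b
    cancel-unit {a} {b} na h with euclid a b h
    ... | inj₁ d = ⊥-elim (na d)
    ... | inj₂ d = d

    same-first : ∀ s e a b x y y' → ¬ p ∣ℤ s → p ∣ℤ cone s e a b x y → p ∣ℤ cone s e a b x y' → p ∣ℤ y ℤ.- y'
    same-first s e a b x y y' ns h h' = cancel-unit ns (by-identity (algebra s e a b x y y')
      (ℤ∣.∣m∣n⇒∣m-n h h'))
      where
      algebra : ∀ s e a b x y y' → (s ℤ.* (y ℤ.- b) ℤ.- (x ℤ.- a) ℤ.* (x ℤ.- a) ℤ.- e) ℤ.-
        (s ℤ.* (y' ℤ.- b) ℤ.- (x ℤ.- a) ℤ.* (x ℤ.- a) ℤ.- e) ≡ s ℤ.* (y ℤ.- y')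
      algebra = ℤ-Ring.solve-∀

    same-second : ∀ s e a b b' x y → ¬ p ∣ℤ s → p ∣ℤ cone s e a b x y → p ∣ℤ cone s e a b' x y → p ∣ℤ b ℤ.- b'
    same-second s e a b b' x y ns h h' = cancel-unit ns (by-identity (algebra s e a b b' x y)
      (ℤ∣.∣m∣n⇒∣m-n h' h))
      where
      algebra : ∀ s e a b b' x y → (s ℤ.* (y ℤ.- b') ℤ.- (x ℤ.- a) ℤ.* (x ℤ.- a) ℤ.- e) ℤ.-
        (s ℤ.* (y ℤ.- b) ℤ.- (x ℤ.- a) ℤ.* (x ℤ.- a) ℤ.- e) ≡ s ℤ.* (b ℤ.- b')
      algebra = ℤ-Ring.solve-∀

  -- A common neighbour w of u and v satisfies an equation in first w, linear if part u ≡ part v and quadratic otherwise.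
  neighbour-determined : ∀ {u w w'} → InBox u → InBox w → InBox w' → part w ≡ part w' → Linked u w → Linked u
    w' → p ∣ℤ + first w ℤ.- + first w' → w ≡ w'
  neighbour-determined {u} {w} {point .(part w) x' y'} bu bw bw' refl (linked ne h) (linked _ h') d
    with refl ← ∣-small (proj₁ (proj₂ bw)) (proj₁ (proj₂ bw')) d =
    point-≡ refl refl (∣-small (proj₂ (proj₂ bw)) (proj₂ (proj₂ bw'))
      (same-first (gap u w) _ (+ first u) (+ second u) (+ first w) (+ second w) (+ y') (gap-unit bu bw ne) h
        h'))

  same-part : ∀ {u v w w'} → InBox u → InBox v → InBox w → InBox w' → part u ≡ part v → part w ≡ part w' → u ≢
    v →
    Linked u w → Linked v w → Linked u w' → Linked v w' → w ≡ w'
  same-part {u} {point .(part u) a' b'} {w} {w'@(point .(part w) x' y')} bu bv bw bw' refl refl u≢v uw vw uw'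
    vw' =
    neighbour-determined bu bw bw' refl uw uw' (conclude
      (euclid (+ 2) _ (by-identity (algebra (gap u w) (ν ℤ.* (gap u w ℤ.* gap u w ℤ.* (gap u w ℤ.* gap u w)))
      (+ first u) (+ second u) (+ a') (+ b') (+ first w) (+ second w) (+ x') (+ y'))
      (ℤ∣.∣m∣n⇒∣m-n (ℤ∣.∣m∣n⇒∣m-n (divides-link vw) (divides-link uw))
        (ℤ∣.∣m∣n⇒∣m-n (divides-link vw') (divides-link uw'))))))
    where
    algebra : ∀ s e a b a' b' x y x' y' →
      ((s ℤ.* (y ℤ.- b') ℤ.- (x ℤ.- a') ℤ.* (x ℤ.- a') ℤ.- e) ℤ.- (s ℤ.* (y ℤ.- b) ℤ.- (x ℤ.- a) ℤ.* (x ℤ.- a)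
        ℤ.- e)) ℤ.-
      ((s ℤ.* (y' ℤ.- b') ℤ.- (x' ℤ.- a') ℤ.* (x' ℤ.- a') ℤ.- e) ℤ.-
        (s ℤ.* (y' ℤ.- b) ℤ.- (x' ℤ.- a) ℤ.* (x' ℤ.- a) ℤ.- e))
      ≡ + 2 ℤ.* ((a' ℤ.- a) ℤ.* (x ℤ.- x'))
    algebra = ℤ-Ring.solve-∀
    first-≢ : ¬ p ∣ℤ + a' ℤ.- + first u
    first-≢ d with refl ← ∣-small (proj₁ (proj₂ bv)) (proj₁ (proj₂ bu)) d =
      u≢v (point-≡ refl refl (∣-small (proj₂ (proj₂ bu)) (proj₂ (proj₂ bv))
        (same-second (gap u w) _ (+ first u) (+ second u) (+ b') (+ first w) (+ second w)
          (gap-unit bu bw (parts-≢ uw)) (divides-link uw) (divides-link vw))))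
    conclude : (p ∣ℤ + 2) ⊎ (p ∣ℤ (+ a' ℤ.- + first u) ℤ.* (+ first w ℤ.- + x')) → p ∣ℤ + first w ℤ.- + x'
    conclude (inj₁ d) = ⊥-elim (∤-constant 2 (s≤s z≤n) (<⇒≤ 3<q) d)
    conclude (inj₂ d) = cancel-unit first-≢ d

  private
    chord : (s r a c x x' : ℤ) → ℤ
    chord s r a c x x' = (s ℤ.- r) ℤ.* (x ℤ.+ x') ℤ.+ + 2 ℤ.* (r ℤ.* a ℤ.- s ℤ.* c)

    chord-divides : ∀ s e r f a b c d x y x' y' → ¬ p ∣ℤ x ℤ.- x' → p ∣ℤ cone s e a b x y → p ∣ℤ cone r f c d
      x y → p ∣ℤ cone s e a b x' y' → p ∣ℤ cone r f c d x' y' →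
      p ∣ℤ chord s r a c x x'
    chord-divides s e r f a b c d x y x' y' nx h1 h2 h3 h4 = cancel-unit nx
      (by-identity (algebra s e r f a b c d x y x' y')
      (ℤ∣.∣m∣n⇒∣m-n (ℤ∣.∣m∣n⇒∣m-n (ℤ∣.∣n⇒∣m*n r h1) (ℤ∣.∣n⇒∣m*n s h2))
        (ℤ∣.∣m∣n⇒∣m-n (ℤ∣.∣n⇒∣m*n r h3) (ℤ∣.∣n⇒∣m*n s h4))))
      where
      algebra : ∀ s e r f a b c d x y x' y' →
        (r ℤ.* (s ℤ.* (y ℤ.- b) ℤ.- (x ℤ.- a) ℤ.* (x ℤ.- a) ℤ.- e) ℤ.- s ℤ.*
          (r ℤ.* (y ℤ.- d) ℤ.- (x ℤ.- c) ℤ.* (x ℤ.- c) ℤ.- f)) ℤ.-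
        (r ℤ.* (s ℤ.* (y' ℤ.- b) ℤ.- (x' ℤ.- a) ℤ.* (x' ℤ.- a) ℤ.- e) ℤ.- s ℤ.*
          (r ℤ.* (y' ℤ.- d) ℤ.- (x' ℤ.- c) ℤ.* (x' ℤ.- c) ℤ.- f))
        ≡ (x ℤ.- x') ℤ.* ((s ℤ.- r) ℤ.* (x ℤ.+ x') ℤ.+ + 2 ℤ.* (r ℤ.* a ℤ.- s ℤ.* c))
      algebra = ℤ-Ring.solve-∀

    chord-difference : ∀ s r a c x x' x'' → p ∣ℤ chord s r a c x x' → p ∣ℤ chord s r a c x x'' → p ∣ℤ
      (s ℤ.- r) ℤ.* (x' ℤ.- x'')
    chord-difference s r a c x x' x'' h h' = by-identity (algebra s r a c x x' x'') (ℤ∣.∣m∣n⇒∣m-n h h')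
      where
      algebra : ∀ s r a c x x' x'' → ((s ℤ.- r) ℤ.* (x ℤ.+ x') ℤ.+ + 2 ℤ.* (r ℤ.* a ℤ.- s ℤ.* c)) ℤ.-
        ((s ℤ.- r) ℤ.* (x ℤ.+ x'') ℤ.+ + 2 ℤ.* (r ℤ.* a ℤ.- s ℤ.* c)) ≡ (s ℤ.- r) ℤ.* (x' ℤ.- x'')
      algebra = ℤ-Ring.solve-∀

  different-parts : ∀ {u v w w' w''} → InBox u → InBox v → InBox w → InBox w' → InBox w'' → part u ≢ part v →
    part w ≡ part w' → part w ≡ part w'' →
    Linked u w → Linked v w → Linked u w' → Linked v w' → Linked u w'' → Linked v w'' → w ≢ w' → w ≢ w'' → w'
      ≡ w''
  different-parts {u} {v} {w} {w'@(point .(part w) x' y')} {w''@(point .(part w) x'' y'')} bu bv bw bw' bw''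
    ne refl refl uw vw uw' vw' uw'' vw'' w≢w' w≢w'' =
    neighbour-determined bu bw' bw'' refl uw' uw'' (cancel-unit s-r
      (chord-difference (gap u w) (gap v w) (+ first u) (+ first v) (+ first w) (+ x') (+ x'')
      (chord-divides (gap u w) _ (gap v w) _ (+ first u) (+ second u) (+ first v) (+ second v) (+ first w)
        (+ second w) (+ x') (+ y')
        (λ d → w≢w' (neighbour-determined bu bw bw' refl uw uw' d)) (divides-link uw) (divides-link vw)
          (divides-link uw') (divides-link vw'))
      (chord-divides (gap u w) _ (gap v w) _ (+ first u) (+ second u) (+ first v) (+ second v) (+ first w)
        (+ second w) (+ x'') (+ y'')
        (λ d → w≢w'' (neighbour-determined bu bw bw'' refl uw uw'' d)) (divides-link uw) (divides-link vw)
          (divides-link uw'') (divides-link vw''))))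
    where
    s-r : ¬ p ∣ℤ gap u w ℤ.- gap v w
    s-r d = gap-unit {u} {v} bu bv ne (by-identity (algebra (+ part u) (+ part v) (+ part w)) d)
      where
      algebra : ∀ i j k → (k ℤ.- i) ℤ.- (k ℤ.- j) ≡ j ℤ.- i
      algebra = ℤ-Ring.solve-∀

  triangle-free : NonResidue ν → ∀ {u v w} → InBox u → InBox v → InBox w → Linked u v → Linked v w → Linked u
    w → ⊥
  triangle-free nonres {u} {v} {w} bu bv bw uv vw uw = conclude (nonres X (A ℤ.* B ℤ.* C)
    (by-identity (algebra (+ part u) (+ part v) (+ part w) (+ first u) (+ first v) (+ first w) (+ second u)
    (+ second v) (+ second w) ν)
      (ℤ∣.∣m∣n⇒∣m-n (ℤ∣.∣n⇒∣m*n (A ℤ.* B) (divides-link uw)) (ℤ∣.∣m∣n⇒∣m+n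
        (ℤ∣.∣n⇒∣m*n (B ℤ.* C) (divides-link uv)) (ℤ∣.∣n⇒∣m*n (A ℤ.* C) (divides-link vw))))))
    where
    A B C : ℤ
    A = gap u v
    B = gap v w
    C = gap u w
    X : ℤ
    X = B ℤ.* (+ first v ℤ.- + first u) ℤ.- A ℤ.* (+ first w ℤ.- + first v)
    link′ : (v i k a x b y : ℤ) → ℤ
    link′ v i k a x b y = (k ℤ.- i) ℤ.* (y ℤ.- b) ℤ.- (x ℤ.- a) ℤ.* (x ℤ.- a) ℤ.- v ℤ.*
      ((k ℤ.- i) ℤ.* (k ℤ.- i) ℤ.* ((k ℤ.- i) ℤ.* (k ℤ.- i)))
    core : ∀ v A B x y β γ → (A ℤ.* B) ℤ.* ((A ℤ.+ B) ℤ.* (β ℤ.+ γ) ℤ.- (x ℤ.+ y) ℤ.* (x ℤ.+ y) ℤ.- v ℤ.*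
      ((A ℤ.+ B) ℤ.* (A ℤ.+ B) ℤ.* ((A ℤ.+ B) ℤ.* (A ℤ.+ B)))) ℤ.-
      ((B ℤ.* (A ℤ.+ B)) ℤ.* (A ℤ.* β ℤ.- x ℤ.* x ℤ.- v ℤ.* (A ℤ.* A ℤ.* (A ℤ.* A))) ℤ.+ (A ℤ.* (A ℤ.+ B)) ℤ.*
        (B ℤ.* γ ℤ.- y ℤ.* y ℤ.- v ℤ.* (B ℤ.* B ℤ.* (B ℤ.* B))))
      ≡ (B ℤ.* x ℤ.- A ℤ.* y) ℤ.* (B ℤ.* x ℤ.- A ℤ.* y) ℤ.- + 3 ℤ.* v ℤ.*
        ((A ℤ.* B ℤ.* (A ℤ.+ B)) ℤ.* (A ℤ.* B ℤ.* (A ℤ.+ B)))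
    core = ℤ-Ring.solve-∀
    telescope : ∀ i j k → (j ℤ.- i) ℤ.+ (k ℤ.- j) ≡ k ℤ.- i
    telescope = ℤ-Ring.solve-∀
    algebra : ∀ i j k a c x b d y v → ((j ℤ.- i) ℤ.* (k ℤ.- j)) ℤ.* link′ v i k a x b y ℤ.-
      (((k ℤ.- j) ℤ.* (k ℤ.- i)) ℤ.* link′ v i j a c b d ℤ.+ ((j ℤ.- i) ℤ.* (k ℤ.- i)) ℤ.* link′ v j k c x d
      y)
      ≡ ((k ℤ.- j) ℤ.* (c ℤ.- a) ℤ.- (j ℤ.- i) ℤ.* (x ℤ.- c)) ℤ.* ((k ℤ.- j) ℤ.* (c ℤ.- a) ℤ.- (j ℤ.- i) ℤ.*
        (x ℤ.- c)) ℤ.- + 3 ℤ.* v ℤ.* (((j ℤ.- i) ℤ.* (k ℤ.- j) ℤ.* (k ℤ.- i)) ℤ.*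
        ((j ℤ.- i) ℤ.* (k ℤ.- j) ℤ.* (k ℤ.- i)))
    algebra i j k a c x b d y v = substituted (j ℤ.- i) (k ℤ.- j) (k ℤ.- i) (c ℤ.- a) (x ℤ.- c) (x ℤ.- a)
      (d ℤ.- b) (y ℤ.- d) (y ℤ.- b) v (telescope i j k) (telescope a c x) (telescope b d y)
      (core v (j ℤ.- i) (k ℤ.- j) (c ℤ.- a) (x ℤ.- c) (d ℤ.- b) (y ℤ.- d))
      where
      substituted : ∀ A B C x y z β γ δ v → A ℤ.+ B ≡ C → x ℤ.+ y ≡ z → β ℤ.+ γ ≡ δ →
        (A ℤ.* B) ℤ.* ((A ℤ.+ B) ℤ.* (β ℤ.+ γ) ℤ.- (x ℤ.+ y) ℤ.* (x ℤ.+ y) ℤ.- v ℤ.*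
          ((A ℤ.+ B) ℤ.* (A ℤ.+ B) ℤ.* ((A ℤ.+ B) ℤ.* (A ℤ.+ B)))) ℤ.-
        ((B ℤ.* (A ℤ.+ B)) ℤ.* (A ℤ.* β ℤ.- x ℤ.* x ℤ.- v ℤ.* (A ℤ.* A ℤ.* (A ℤ.* A))) ℤ.+ (A ℤ.* (A ℤ.+ B))
          ℤ.* (B ℤ.* γ ℤ.- y ℤ.* y ℤ.- v ℤ.* (B ℤ.* B ℤ.* (B ℤ.* B))))
        ≡ (B ℤ.* x ℤ.- A ℤ.* y) ℤ.* (B ℤ.* x ℤ.- A ℤ.* y) ℤ.- + 3 ℤ.* v ℤ.*
          ((A ℤ.* B ℤ.* (A ℤ.+ B)) ℤ.* (A ℤ.* B ℤ.* (A ℤ.+ B))) →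
        (A ℤ.* B) ℤ.* (C ℤ.* δ ℤ.- z ℤ.* z ℤ.- v ℤ.* (C ℤ.* C ℤ.* (C ℤ.* C))) ℤ.-
        ((B ℤ.* C) ℤ.* (A ℤ.* β ℤ.- x ℤ.* x ℤ.- v ℤ.* (A ℤ.* A ℤ.* (A ℤ.* A))) ℤ.+ (A ℤ.* C) ℤ.*
          (B ℤ.* γ ℤ.- y ℤ.* y ℤ.- v ℤ.* (B ℤ.* B ℤ.* (B ℤ.* B))))
        ≡ (B ℤ.* x ℤ.- A ℤ.* y) ℤ.* (B ℤ.* x ℤ.- A ℤ.* y) ℤ.- + 3 ℤ.* v ℤ.*
          ((A ℤ.* B ℤ.* C) ℤ.* (A ℤ.* B ℤ.* C))
      substituted A B _ x y _ β γ _ v refl refl refl e = e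
    conclude : p ∣ℤ A ℤ.* B ℤ.* C → ⊥
    conclude d with euclid (A ℤ.* B) C d
    ... | inj₂ dC = gap-unit bu bw (parts-≢ uw) dC
    ... | inj₁ dAB with euclid A B dAB
    ...   | inj₁ dA = gap-unit bu bv (parts-≢ uv) dA
    ...   | inj₂ dB = gap-unit bv bw (parts-≢ vw) dB

  neighbour-exists : ∀ u k x → InBox u → k < q → part u ≢ k → ∃[ y ] (y < q × p ∣ℤ link u (point k x y))
  neighbour-exists u k x bu k<q ne = conclude (solvable s c p∤s)
    where
    s e c : ℤ
    s = + k ℤ.- + part u
    e = ν ℤ.* (s ℤ.* s ℤ.* (s ℤ.* s))
    c = s ℤ.* + second u ℤ.+ (+ x ℤ.- + first u) ℤ.* (+ x ℤ.- + first u) ℤ.+ e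
    p∤s : ¬ p ∣ℤ s
    p∤s d = ne (sym (∣-small k<q (proj₁ bu) d))
    algebra : ∀ s e a b x y → s ℤ.* y ℤ.- (s ℤ.* b ℤ.+ (x ℤ.- a) ℤ.* (x ℤ.- a) ℤ.+ e) ≡ cone s e a b x y
    algebra = expand
      where
      expand : ∀ s e a b x y → s ℤ.* y ℤ.- (s ℤ.* b ℤ.+ (x ℤ.- a) ℤ.* (x ℤ.- a) ℤ.+ e) ≡ s ℤ.* (y ℤ.- b) ℤ.-
        (x ℤ.- a) ℤ.* (x ℤ.- a) ℤ.- e
      expand = ℤ-Ring.solve-∀
    conclude : ∃[ y ] (y < q × p ∣ℤ s ℤ.* + y ℤ.- c) → ∃[ y ] (y < q × p ∣ℤ link u (point k x y))
    conclude (y , y<q , h) = y , y<q , by-identity (algebra s e (+ first u) (+ second u) (+ x) (+ y)) h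

-- Unlike S, R n f sums f over 0 ≤ k < n.
R : ℕ → (ℕ → ℕ) → ℕ
R zero f = 0
R (suc n) f = R n f + f n

R-mono : ∀ n {f g} → (∀ k → k < n → f k ≤ g k) → R n f ≤ R n g
R-mono zero h = z≤n
R-mono (suc n) h = +-mono-≤ (R-mono n λ k k<n → h k (m≤n⇒m≤1+n k<n)) (h n ≤-refl)

R-monoˡ : ∀ {m n} f → m ≤ n → R m f ≤ R n f
R-monoˡ {m} {n} f m≤n = ≤-trans (go m (n ∸ m)) (≤-reflexive (cong (λ k → R k f) (m∸n+n≡m m≤n)))
  where
  go : ∀ m d → R m f ≤ R (d + m) f
  go m zero = ≤-refl
  go m (suc d) = ≤-trans (go m d) (m≤m+n _ _)

R-const : ∀ n c → R n (λ _ → c) ≡ n * c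
R-const zero c = refl
R-const (suc n) c = trans (cong (_+ c) (R-const n c)) (+-comm (n * c) c)

R-*ʳ : ∀ n c f → R n (λ k → f k * c) ≡ R n f * c
R-*ʳ zero c f = refl
R-*ʳ (suc n) c f = trans (cong (_+ f n * c) (R-*ʳ n c f)) (sym (*-distribʳ-+ c (R n f) (f n)))

R-+ : ∀ m n f → R (m + n) f ≡ R m f + R n (λ k → f (m + k))
R-+ m zero f = trans (cong (λ k → R k f) (+-identityʳ m)) (sym (+-identityʳ (R m f)))
R-+ m (suc n) f = trans (cong (λ k → R k f) (+-suc m n)) (trans (cong (_+ f (m + n)) (R-+ m n f))
  (+-assoc (R m f) _ _))

R-* : ∀ m n f → R (m * n) f ≡ R m (λ i → R n (λ k → f (i * n + k)))
R-* zero n f = refl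
R-* (suc m) n f = trans (cong (λ k → R k f) (+-comm n (m * n))) (trans (R-+ (m * n) n f)
  (cong (_+ R n (λ k → f (m * n + k))) (R-* m n f)))

term≤R : ∀ {n} f {k} → k < n → f k ≤ R n f
term≤R f {k} k<n = ≤-trans (m≤n+m (f k) (R k f)) (R-monoˡ f k<n)

∑-R : ∀ n f → ∑ {n} (λ i → f (toℕ i)) ≡ R n f
∑-R zero f = refl
∑-R (suc n) f = trans (cong (λ t → f 0 + t) (∑-R n (f ∘ suc))) (sym (R-+ 1 n f))

pairs : ∀ m → 2 * R m (λ i → R m (λ j → ⟦ i <ᵇ j ⟧)) + m ≡ m * m
pairs zero = refl
pairs (suc m) = step (R m λ i → R m λ j → ⟦ i <ᵇ j ⟧) (R m λ i → R m (λ j → ⟦ i <ᵇ j ⟧) + ⟦ i <ᵇ m ⟧)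
  (R (suc m) (λ j → ⟦ m <ᵇ j ⟧))
    (R-split {m} m (λ i → R m (λ j → ⟦ i <ᵇ j ⟧)) λ i i<m → <⇒≡1 {i} {m} i<m) (none (suc m) ≤-refl) (pairs m)
  where
  step : ∀ P P' N → P' ≡ P + m → N ≡ 0 → 2 * P + m ≡ m * m → 2 * (P' + N) + suc m ≡ suc m * suc m
  step P _ _ refl refl h = trans (left P m) (trans (cong (λ t → t + (2 * m + 1)) h) (right m))
    where left : ∀ P m → 2 * ((P + m) + 0) + suc m ≡ (2 * P + m) + (2 * m + 1)
          left = solve-∀
          right : ∀ m → m * m + (2 * m + 1) ≡ suc m * suc m
          right = solve-∀
  <⇒≡1 : ∀ {i m} → i < m → ⟦ i <ᵇ m ⟧ ≡ 1
  <⇒≡1 {i} {m} h with i <ᵇ m in eq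
  ... | true = refl
  ... | false with () ← subst Bool.T eq (<⇒<ᵇ h)
  none : ∀ k → k ≤ suc m → R k (λ j → ⟦ m <ᵇ j ⟧) ≡ 0
  none zero _ = refl
  none (suc k) k≤m with m <ᵇ k in eq
  ... | true = ⊥-elim (<⇒≱ (<ᵇ⇒< m k (subst Bool.T (sym eq) _)) (≤-pred k≤m))
  ... | false = trans (+-identityʳ _) (none k (≤-trans (n≤1+n k) k≤m))
  R-split : ∀ {m} k f → (∀ i → i < k → ⟦ i <ᵇ m ⟧ ≡ 1) → R k (λ i → f i + ⟦ i <ᵇ m ⟧) ≡ R k f + k
  R-split zero f h = refl
  R-split {m} (suc k) f h = trans (cong₂ _+_ (R-split {m} k f λ i i<k → h i (m≤n⇒m≤1+n i<k))
    (cong (λ t → f k + t) (h k ≤-refl))) (rearrange (R k f) k (f k))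
    where rearrange : ∀ a k b → a + k + (b + 1) ≡ a + b + suc k
          rearrange = solve-∀

does-true : ∀ {P : Set} (d : Dec P) → does d ≡ true → P
does-true (yes p) _ = p

module Construction (q : ℕ) (prime-q : Prime q) (3<q : 3 < q) (ν : ℤ) (nonres : ModPrime.NonResidue q prime-q 3<q ν)
  (t : ℕ) (1≤t : 1 ≤ t) (t<q : t + 2 ≤ q) (n : ℕ) (room : (t + 2) * (q * q) ≤ n) where
  open ModPrime q prime-q 3<q
  open Cone q prime-q 3<q ν
  open Point

  private
    m N : ℕ
    m = t + 2
    N = m * (q * q)

    1≤q : 1 ≤ q
    1≤q = prime≥1 prime-q

  decode : ℕ → Point
  decode v = point (v ÷ q ÷ q) (v ÷ q ∸ v ÷ q ÷ q * q) (v ∸ v ÷ q * q)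

  encode : Point → ℕ
  encode u = part u * (q * q) + (first u * q + second u)

  private
    remainder< : ∀ v → v ∸ v ÷ q * q < q
    remainder< v = +-cancelˡ-< (v ÷ q * q) _ _ (≤-trans (s≤s (≤-reflexive (m+[n∸m]≡n (÷-lower v q))))
      (≤-trans (÷-upper v 1≤q) (≤-reflexive (+-comm q (v ÷ q * q)))))

  encode-decode : ∀ v → encode (decode v) ≡ v
  encode-decode v = trans (regroup (v ÷ q ÷ q) (v ÷ q ∸ v ÷ q ÷ q * q) (v ∸ v ÷ q * q) q)
    (trans (cong (λ h → h * q + (v ∸ v ÷ q * q)) (m+[n∸m]≡n (÷-lower (v ÷ q) q))) (m+[n∸m]≡n (÷-lower v q)))
    where regroup : ∀ i a b q → i * (q * q) + (a * q + b) ≡ (i * q + a) * q + b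
          regroup = solve-∀

  decode-injective : ∀ {v w} → decode v ≡ decode w → v ≡ w
  decode-injective {v} {w} e = trans (sym (encode-decode v)) (trans (cong encode e) (encode-decode w))

  decode-encode : ∀ u → first u < q → second u < q → decode (encode u) ≡ u
  decode-encode u@(point i a b) a<q b<q = point-≡ hi-part (trans (cong₂ (λ x y → x ∸ y * q) hi hi-part)
    (m+n∸m≡n (i * q) a))
    (trans (cong₂ (λ x y → x ∸ y * q) (regroup i a b q) hi) (m+n∸m≡n ((i * q + a) * q) b))
    where
    regroup : ∀ i a b q → i * (q * q) + (a * q + b) ≡ (i * q + a) * q + b
    regroup = solve-∀
    quotient : ∀ h r → r < q → (h * q + r) ÷ q ≡ h
    quotient h r r<q = ÷-unique (h * q + r) 1≤q (m≤m+n (h * q) r) (≤-trans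
      (s≤s (≤-reflexive (+-comm (h * q) r))) (+-monoˡ-≤ (h * q) r<q))
    hi : encode u ÷ q ≡ i * q + a
    hi = trans (cong (_÷ q) (regroup i a b q)) (quotient (i * q + a) b b<q)
    hi-part : encode u ÷ q ÷ q ≡ i
    hi-part = trans (cong (_÷ q) hi) (quotient i a a<q)

  part<m : ∀ {v} → v < N → part (decode v) < m
  part<m {v} v<N = *-cancelʳ-< (q * q) (v ÷ q ÷ q) m (≤-<-trans
    (≤-trans (≤-reflexive (sym (*-assoc (v ÷ q ÷ q) q q))) (≤-trans (*-monoˡ-≤ q (÷-lower (v ÷ q) q))
    (÷-lower v q))) v<N)

  in-box : ∀ {v} → v < N → InBox (decode v)
  in-box {v} v<N = <-≤-trans (part<m v<N) t<q , remainder< (v ÷ q) , remainder< v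

  Gℕ : ℕ → ℕ → Bool
  Gℕ v w = does (w <? N) ∧ (does (part (decode v) <? part (decode w)) ∧ does
    (+ q ∣ℤ? link (decode v) (decode w)))

  G : Graph n
  G i j = Gℕ (toℕ i) (toℕ j)

  private
    Gℕ⇒ : ∀ v w → v < w → Gℕ v w ≡ true → v < N × w < N × Linked (decode v) (decode w)
    Gℕ⇒ v w v<w h with ∧-true {does (w <? N)} h
    ... | w<N , h' with ∧-true {does (part (decode v) <? part (decode w))} h'
    ...   | lt , d = <-trans v<w (does-true (w <? N) w<N) , does-true (w <? N) w<N ,
      linked (<⇒≢ (does-true (part (decode v) <? part (decode w)) lt))
        (does-true (+ q ∣ℤ? link (decode v) (decode w)) d)

  pt : Fin n → Point
  pt i = decode (toℕ i)

  adj⇒Linked : ∀ i j → adj G i j ≡ true → toℕ i < N × toℕ j < N × Linked (pt i) (pt j)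
  adj⇒Linked i j h with adj⇒ G i j h
  ... | inj₁ (i<j , e) = Gℕ⇒ (toℕ i) (toℕ j) i<j e
  ... | inj₂ (j<i , e) with Gℕ⇒ (toℕ j) (toℕ i) j<i e
  ...   | j<N , i<N , l = i<N , j<N , Linked-sym l

  no-triangle : ¬ Embeds G C3
  no-triangle (f , inj , hom) with adj⇒Linked (f 0F) (f 1F) (hom 0F 1F refl) | adj⇒Linked (f 1F) (f 2F)
    (hom 1F 2F refl) | adj⇒Linked (f 0F) (f 2F) (hom 0F 2F refl)
    where
    0F 1F 2F : Fin 3
    0F = Fin.zero
    1F = Fin.suc Fin.zero
    2F = Fin.suc (Fin.suc Fin.zero)
  ... | a< , b< , ab | _ , c< , bc | _ , _ , ac = triangle-free nonres (in-box a<) (in-box b<) (in-box c<) ab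
    bc ac

  no-K2 : ¬ Embeds G (K2 (suc (2 * t)))
  no-K2 (f , inj , hom) = by-parts (part (pt u) ≟ part (pt v))
    where
    u v : Fin n
    u = f Fin.zero
    v = f (Fin.suc Fin.zero)
    w : Fin (suc (2 * t)) → Fin n
    w l = f (Fin.suc (Fin.suc l))
    uw : ∀ l → toℕ u < N × toℕ (w l) < N × Linked (pt u) (pt (w l))
    uw l = adj⇒Linked u (w l) (hom Fin.zero (Fin.suc (Fin.suc l)) refl)
    vw : ∀ l → toℕ v < N × toℕ (w l) < N × Linked (pt v) (pt (w l))
    vw l = adj⇒Linked v (w l) (hom (Fin.suc Fin.zero) (Fin.suc (Fin.suc l)) refl)
    u<N : toℕ u < N
    u<N = proj₁ (uw Fin.zero)
    v<N : toℕ v < N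
    v<N = proj₁ (vw Fin.zero)
    bu = in-box u<N
    bv = in-box v<N
    w<N : ∀ l → toℕ (w l) < N
    w<N l = proj₁ (proj₂ (uw l))
    bw : ∀ l → InBox (pt (w l))
    bw l = in-box (w<N l)
    luw : ∀ l → Linked (pt u) (pt (w l))
    luw l = proj₂ (proj₂ (uw l))
    lvw : ∀ l → Linked (pt v) (pt (w l))
    lvw l = proj₂ (proj₂ (vw l))
    pt-injective : ∀ {i j} → pt i ≡ pt j → i ≡ j
    pt-injective e = Finₚ.toℕ-injective (decode-injective e)
    u≢v : pt u ≢ pt v
    u≢v e = case inj Fin.zero (Fin.suc Fin.zero) (pt-injective e) of λ ()
    w-injective : ∀ {l l'} → pt (w l) ≡ pt (w l') → l ≡ l'
    w-injective e = Finₚ.suc-injective (Finₚ.suc-injective (inj _ _ (pt-injective e)))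
    partF : ∀ {x} → x < N → Fin m
    partF x<N = Fin.fromℕ< (part<m x<N)
    part-eq : ∀ {x y} (x< : x < N) (y< : y < N) → partF x< ≡ partF y< → part (decode x) ≡ part (decode y)
    part-eq x< y< e = trans (sym (Finₚ.toℕ-fromℕ< (part<m x<))) (trans (cong toℕ e)
      (Finₚ.toℕ-fromℕ< (part<m y<)))
    hit : Fin m → Fin (suc (2 * t)) → Bool
    hit k l = does (partF (w<N l) Finₚ.≟ k)
    count δu δv : Fin m → ℕ
    count k = ∑ (λ l → ⟦ hit k l ⟧)
    δu k = ⟦ does (partF u<N Finₚ.≟ k) ⟧
    δv k = ⟦ does (partF v<N Finₚ.≟ k) ⟧
    δ-sum : ∀ (i : Fin m) → ∑ (λ k → ⟦ does (i Finₚ.≟ k) ⟧) ≡ 1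
    δ-sum i = trans (∑-point _ i (λ j ne → off j ne (i Finₚ.≟ j))) (on (i Finₚ.≟ i))
      where
      off : ∀ j → j ≢ i → (d : Dec (i ≡ j)) → ⟦ does d ⟧ ≡ 0
      off j ne (yes refl) = ⊥-elim (ne refl)
      off j ne (no _) = refl
      on : (d : Dec (i ≡ i)) → ⟦ does d ⟧ ≡ 1
      on (yes _) = refl
      on (no ne) = ⊥-elim (ne refl)
    count-sum : ∑ count ≡ suc (2 * t)
    count-sum = trans (∑-comm {m} {suc (2 * t)} (λ k l → ⟦ hit k l ⟧))
      (trans (sum-cong-≗ {suc (2 * t)} λ l → δ-sum (partF (w<N l)))
      (trans (∑-const (suc (2 * t)) 1) (*-identityʳ (suc (2 * t)))))
    hit-part : ∀ {k l} → hit k l ≡ true → partF (w<N l) ≡ k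
    hit-part {k} {l} = does-true (partF (w<N l) Finₚ.≟ k)
    same-hit : ∀ {k l l'} → hit k l ≡ true → hit k l' ≡ true → part (pt (w l)) ≡ part (pt (w l'))
    same-hit {k} {l} {l'} h h' = part-eq (w<N l) (w<N l') (trans (hit-part h) (sym (hit-part h')))
    bound : ∀ k c → (suc c ≤ count k → ⊥) → count k ≤ c
    bound k c h = ≮⇒≥ h
    missed : ∀ {x} (x< : x < N) → (∀ l → part (decode x) ≢ part (pt (w l))) → count (partF x<) ≡ 0
    missed x< apart = n≤0⇒n≡0 (bound (partF x<) 0 λ h → go (count-enumerate (hit (partF x<)) 1 h))
      where
      go : Σ (Fin 1 → Fin (suc (2 * t))) (λ g → (∀ i j → g i ≡ g j → i ≡ j) ×
        (∀ i → hit (partF x<) (g i) ≡ true)) → ⊥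
      go (g , _ , hits) = apart (g Fin.zero) (part-eq x< (w<N (g Fin.zero)) (sym (hit-part (hits Fin.zero))))
    avoids-u : count (partF u<N) ≡ 0
    avoids-u = missed u<N λ l → Linked.parts-≢ (luw l)
    avoids-v : count (partF v<N) ≡ 0
    avoids-v = missed v<N λ l → Linked.parts-≢ (lvw l)
    by-parts : Dec (part (pt u) ≡ part (pt v)) → ⊥
    by-parts (yes same) = <⇒≱ 1≤t (contradiction t (≤-trans
      (≤-reflexive (sym (trans (∑-distrib-+ {m} count δu) (cong₂ _+_ count-sum (δ-sum (partF u<N))))))
      (≤-trans (∑-mono per-part) (≤-reflexive (trans (∑-const m 1) (*-identityʳ m))))))
      where
      contradiction : ∀ t → suc (2 * t) + 1 ≤ t + 2 → t ≤ 0
      contradiction t h = +-cancelˡ-≤ (t + 2) t 0 (≤-trans (≤-reflexive (rearrange t))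
        (≤-trans h (≤-reflexive (sym (+-identityʳ (t + 2))))))
        where rearrange : ∀ t → t + 2 + t ≡ suc (2 * t) + 1
              rearrange = solve-∀
      once : ∀ k → count k ≤ 1
      once k = bound k 1 λ h → go (count-enumerate (hit k) 2 h)
        where
        go : Σ (Fin 2 → Fin (suc (2 * t))) (λ g → (∀ i j → g i ≡ g j → i ≡ j) × (∀ i → hit k (g i) ≡ true)) →
          ⊥
        unique : ∀ l₀ l₁ → hit k l₀ ≡ true → hit k l₁ ≡ true → l₀ ≡ l₁
        unique l₀ l₁ h₀ h₁ = w-injective (same-part bu bv (bw l₀) (bw l₁) same (same-hit h₀ h₁) u≢v (luw l₀)
          (lvw l₀) (luw l₁) (lvw l₁))
        go (g , g-inj , hits) = case g-inj Fin.zero (Fin.suc Fin.zero)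
          (unique (g Fin.zero) (g (Fin.suc Fin.zero)) (hits Fin.zero) (hits (Fin.suc Fin.zero))) of λ ()
      per-part : ∀ k → count k + δu k ≤ 1
      per-part k = go (partF u<N Finₚ.≟ k)
        where
        go : (d : Dec (partF u<N ≡ k)) → count k + ⟦ does d ⟧ ≤ 1
        go (yes refl) = ≤-reflexive (cong (_+ 1) avoids-u)
        go (no _) = ≤-trans (≤-reflexive (+-identityʳ (count k))) (once k)
    by-parts (no different) = <⇒≱ ≤-refl (+-cancelˡ-≤ (2 * t + 4) 1 0
      (≤-trans (≤-reflexive (rearrange t)) (≤-trans total (≤-reflexive (rearrange' t)))))
      where
      rearrange : ∀ t → 2 * t + 4 + 1 ≡ suc (2 * t) + 2 * 1 + 2 * 1
      rearrange = solve-∀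
      rearrange' : ∀ t → (t + 2) * 2 ≡ 2 * t + 4 + 0
      rearrange' = solve-∀
      twice : ∀ k → count k ≤ 2
      twice k = bound k 2 λ h → go (count-enumerate (hit k) 3 h)
        where
        go : Σ (Fin 3 → Fin (suc (2 * t))) (λ g → (∀ i j → g i ≡ g j → i ≡ j) × (∀ i → hit k (g i) ≡ true)) →
          ⊥
        third : ∀ l₀ l₁ l₂ → hit k l₀ ≡ true → hit k l₁ ≡ true → hit k l₂ ≡ true → l₀ ≢ l₁ → l₀ ≢ l₂ → l₁ ≡ l₂
        third l₀ l₁ l₂ h₀ h₁ h₂ ne₁ ne₂ = w-injective (different-parts bu bv (bw l₀) (bw l₁) (bw l₂) different
          (same-hit h₀ h₁) (same-hit h₀ h₂)
          (luw l₀) (lvw l₀) (luw l₁) (lvw l₁) (luw l₂) (lvw l₂) (ne₁ ∘ w-injective) (ne₂ ∘ w-injective))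
        go (g , g-inj , hits) = case g-inj (Fin.suc Fin.zero) (Fin.suc (Fin.suc Fin.zero))
          (third (g Fin.zero) (g (Fin.suc Fin.zero)) (g (Fin.suc (Fin.suc Fin.zero))) (hits Fin.zero)
            (hits (Fin.suc Fin.zero)) (hits (Fin.suc (Fin.suc Fin.zero)))
            (λ e → case g-inj Fin.zero (Fin.suc Fin.zero) e of λ ())
              (λ e → case g-inj Fin.zero (Fin.suc (Fin.suc Fin.zero)) e of λ ())) of λ ()
      per-part : ∀ k → count k + 2 * δu k + 2 * δv k ≤ 2
      per-part k = go (partF u<N Finₚ.≟ k) (partF v<N Finₚ.≟ k)
        where
        go : (d : Dec (partF u<N ≡ k)) (d' : Dec (partF v<N ≡ k)) → count k + 2 * ⟦ does d ⟧ + 2 * ⟦ does d' ⟧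
          ≤ 2
        go (yes refl) (yes e) = ⊥-elim (different (part-eq u<N v<N (sym e)))
        go (yes refl) (no _) = ≤-reflexive (cong (λ c → c + 2 + 0) avoids-u)
        go (no _) (yes refl) = ≤-reflexive (cong (λ c → c + 0 + 2) avoids-v)
        go (no _) (no _) = ≤-trans (≤-reflexive (trans (+-identityʳ (count k + 0)) (+-identityʳ (count k))))
          (twice k)
      total : suc (2 * t) + 2 * 1 + 2 * 1 ≤ (t + 2) * 2
      total = ≤-trans (≤-reflexive (sym (trans (∑-distrib-+ {m} (λ k → count k + 2 * δu k) (λ k → 2 * δv k))
        (cong₂ _+_
          (trans (∑-distrib-+ {m} count (λ k → 2 * δu k)) (cong₂ _+_ count-sum
            (trans (sym (*-distribˡ-sum {m} 2 δu)) (cong (2 *_) (δ-sum (partF u<N))))))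
          (trans (sym (*-distribˡ-sum {m} 2 δv)) (cong (2 *_) (δ-sum (partF v<N))))))))
        (≤-trans (∑-mono per-part) (≤-reflexive (∑-const m 2)))

  private
    e : ℕ → ℕ → ℕ
    e v w = ⟦ (v <ᵇ w) ∧ Gℕ v w ⟧

  edges-R : edges G ≡ R n (λ v → R n (e v))
  edges-R = trans (edges-∑ G) (trans (sum-cong-≗ {n} λ i → trans
    (sum-cong-≗ {n} λ j → cong ⟦_⟧ (pointwise i j)) (∑-R n (e (toℕ i)))) (∑-R n (λ v → R n (e v))))
    where
    pointwise : ∀ i j → (toℕ i <ᵇ toℕ j) ∧ adj G i j ≡ (toℕ i <ᵇ toℕ j) ∧ Gℕ (toℕ i) (toℕ j)
    pointwise i j with toℕ i <ᵇ toℕ j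
    ... | true = refl
    ... | false = refl

  private
    low<q² : ∀ {a b} → a < q → b < q → a * q + b < q * q
    low<q² {a} {b} a<q b<q = <-≤-trans (+-monoʳ-< (a * q) b<q) (≤-trans (≤-reflexive (+-comm (a * q) q))
      (*-monoˡ-≤ q a<q))

    encode-upper : ∀ i {a b} → a < q → b < q → encode (point i a b) < suc i * (q * q)
    encode-upper i a<q b<q = <-≤-trans (+-monoʳ-< (i * (q * q)) (low<q² a<q b<q))
      (≤-reflexive (+-comm (i * (q * q)) (q * q)))

    edge-exists : ∀ {i a b j x} → i < j → j < m → a < q → b < q → x < q → ∃[ y ]
      (y < q × e (encode (point i a b)) (encode (point j x y)) ≡ 1)
    edge-exists {i} {a} {b} {j} {x} i<j j<m a<q b<q x<q = conclude
      (neighbour-exists (point i a b) j x (<-trans i<j (<-≤-trans j<m t<q) , a<q , b<q) (<-≤-trans j<m t<q)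
      (<⇒≢ i<j))
      where
      conclude : ∃[ y ] (y < q × + q ∣ℤ link (point i a b) (point j x y)) → ∃[ y ]
        (y < q × e (encode (point i a b)) (encode (point j x y)) ≡ 1)
      conclude (y , y<q , h) = y , y<q , cong ⟦_⟧ (cong₂ _∧_ (<ᵇ-true v<w) (cong₂ _∧_ (dec-true (w <? N) w<N)
          (trans (cong₂ (λ P Q → does (part P <? part Q) ∧ does (+ q ∣ℤ? link P Q))
            (decode-encode (point i a b) a<q b<q) (decode-encode (point j x y) x<q y<q))
            (cong₂ _∧_ (dec-true (i <? j) i<j) (dec-true (+ q ∣ℤ? link (point i a b) (point j x y)) h)))))
        where
        v w : ℕ
        v = encode (point i a b)
        w = encode (point j x y)
        <ᵇ-true : ∀ {v w} → v < w → (v <ᵇ w) ≡ true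
        <ᵇ-true {v} {w} h with v <ᵇ w in eq
        ... | true = refl
        ... | false with () ← subst Bool.T eq (<⇒<ᵇ h)
        v<w : v < w
        v<w = <-≤-trans (encode-upper i a<q b<q) (≤-trans (*-monoˡ-≤ (q * q) i<j)
          (m≤m+n (j * (q * q)) (x * q + y)))
        w<N : w < N
        w<N = <-≤-trans (encode-upper j x<q y<q) (*-monoˡ-≤ (q * q) j<m)

    degree-lower : ∀ {i a b} → a < q → b < q → R m (λ j → ⟦ i <ᵇ j ⟧) * q ≤ R N (e (encode (point i a b)))
    degree-lower {i} {a} {b} a<q b<q = begin
      R m (λ j → ⟦ i <ᵇ j ⟧) * q ≡⟨ sym (R-*ʳ m q _) ⟩
      R m (λ j → ⟦ i <ᵇ j ⟧ * q) ≤⟨ R-mono m (λ j j<m → per-part j j<m) ⟩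
      R m (λ j → R (q * q) (λ β → e v (j * (q * q) + β))) ≡⟨ sym (R-* m (q * q) (e v)) ⟩
      R N (e v) ∎
      where
      open ≤-Reasoning
      v = encode (point i a b)
      per-part : ∀ j → j < m → ⟦ i <ᵇ j ⟧ * q ≤ R (q * q) (λ β → e v (j * (q * q) + β))
      per-part j j<m with i <ᵇ j in eq
      ... | false = z≤n
      ... | true = begin
        1 * q ≡⟨ *-comm 1 q ⟩
        q * 1 ≡⟨ sym (R-const q 1) ⟩
        R q (λ x → 1) ≤⟨ R-mono q (λ x x<q → per-x x x<q (edge-exists (<ᵇ⇒< i j (subst Bool.T (sym eq) _)) j<m
          a<q b<q x<q)) ⟩
        R q (λ x → R q (λ y → e v (j * (q * q) + (x * q + y)))) ≡⟨ sym (R-* q q (λ β → e v (j * (q * q) + β)))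
          ⟩
        R (q * q) (λ β → e v (j * (q * q) + β)) ∎
        where
        per-x : ∀ x → x < q → ∃[ y ] (y < q × e v (encode (point j x y)) ≡ 1) → 1 ≤ R q
          (λ y → e v (j * (q * q) + (x * q + y)))
        per-x x _ (y , y<q , h) = ≤-trans (≤-reflexive (sym h)) (term≤R
          (λ y → e v (j * (q * q) + (x * q + y))) y<q)

  edges-lower : m * m * (q * q * q) ≤ 2 * edges G + m * (q * q * q)
  edges-lower = begin
    m * m * (q * q * q) ≡⟨ cong (_* (q * q * q)) (sym (pairs m)) ⟩
    (2 * P + m) * (q * q * q) ≡⟨ expand P m (q * q * q) ⟩
    2 * (P * (q * q * q)) + m * (q * q * q) ≤⟨ +-monoˡ-≤ (m * (q * q * q))
      (*-monoʳ-≤ 2 (≤-trans total (≤-reflexive (sym edges-R)))) ⟩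
    2 * edges G + m * (q * q * q) ∎
    where
    open ≤-Reasoning
    d : ℕ → ℕ
    d i = R m (λ j → ⟦ i <ᵇ j ⟧)
    P : ℕ
    P = R m d
    expand : ∀ P m c → (2 * P + m) * c ≡ 2 * (P * c) + m * c
    expand = solve-∀
    rearrange : ∀ d q → d * (q * q * q) ≡ q * (q * (d * q))
    rearrange = solve-∀
    total : P * (q * q * q) ≤ R n (λ v → R n (e v))
    total = begin
      P * (q * q * q) ≡⟨ sym (R-*ʳ m (q * q * q) d) ⟩
      R m (λ i → d i * (q * q * q)) ≤⟨ R-mono m (λ i i<m → ≤-trans
        (≤-reflexive (trans (rearrange (d i) q) (sym
        (trans (R-const q _) (cong (q *_) (R-const q (d i * q)))))))
        (≤-trans (R-mono q λ a a<q → R-mono q λ b b<q → degree-lower {i} a<q b<q)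
          (≤-reflexive (sym (R-* q q (λ α → R N (e (i * (q * q) + α)))))))) ⟩
      R m (λ i → R (q * q) (λ α → R N (e (i * (q * q) + α)))) ≡⟨ sym (R-* m (q * q) (λ v → R N (e v))) ⟩
      R N (λ v → R N (e v)) ≤⟨ ≤-trans (R-mono N λ v _ → R-monoˡ (e v) room) (R-monoˡ (λ v → R n (e v)) room)
        ⟩
      R n (λ v → R n (e v)) ∎

edges-cong : ∀ {n} {G G' : Graph n} → (∀ i j → G i j ≡ G' i j) → edges G ≡ edges G'
edges-cong {n} {G} {G'} h = trans (edges-∑ G) (trans
  (sum-cong-≗ {n} λ i → sum-cong-≗ {n} λ j → cong (λ a → ⟦ (toℕ i <ᵇ toℕ j) ∧ a ⟧) (adj-cong h i j))
  (sym (edges-∑ G')))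

ex-lower : ∀ {n h h'} (G : Graph n) (H : Graph h) (H' : Graph h') → ¬ Embeds G H → ¬ Embeds G H' → edges G ≤
  ex n ((h , H) ∷ (h' , H') ∷ [])
ex-lower {n} {h} {h'} G H H' noH noH' with ∈-allGraphs G
... | G' , G'∈ , G'≗G = ≤-trans (≤-reflexive (trans (edges-cong (λ i j → sym (G'≗G i j))) (sym value)))
    (maxList-upper (∈-map⁺ (λ G → if containsSome G ((h , H) ∷ (h' , H') ∷ []) then 0 else edges G) G'∈))
  where
  absent : ∀ {k} (K : Graph k) → ¬ Embeds G K → contains G' K ≡ false
  absent K none with contains G' K in eq
  ... | false = refl
  ... | true = ⊥-elim (none (Embeds-cong K G'≗G (contains-sound G' K eq)))
  value : (if containsSome G' ((h , H) ∷ (h' , H') ∷ []) then 0 else edges G') ≡ edges G'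
  value = cong (λ b → if b then 0 else edges G') (cong₂ (λ a b → a ∨ (b ∨ false)) (absent H noH)
    (absent H' noH'))

ex-bound : ∀ {q} → Prime q → 3 < q → ∀ t → 1 ≤ t → t + 2 ≤ q → ∀ n → (t + 2) * (q * q) ≤ n →
  (t + 2) * (t + 2) * (q * q * q) ≤ 2 * ex n ((3 , C3) ∷ (2 + suc (2 * t) , K2 (suc (2 * t))) ∷ []) + (t + 2)
    * (q * q * q)
ex-bound {q} prime-q 3<q t 1≤t t<q n room = conclude (ModPrime.nonresidue q prime-q 3<q)
  where
  conclude : ∃[ ν ] ModPrime.NonResidue q prime-q 3<q ν → (t + 2) * (t + 2) * (q * q * q) ≤ 2 * ex n
    ((3 , C3) ∷ (2 + suc (2 * t) , K2 (suc (2 * t))) ∷ []) + (t + 2) * (q * q * q)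
  conclude (ν , nonres) = ≤-trans edges-lower (+-monoˡ-≤ _
    (*-monoʳ-≤ 2 (ex-lower G C3 (K2 (suc (2 * t))) no-triangle no-K2)))
    where open Construction q prime-q 3<q ν nonres t 1≤t t<q n room

-- The theorem

square-≤ : ∀ {a b} → a * a ≤ b * b → a ≤ b
square-≤ {a} {b} h = ≮⇒≥ λ b<a → <⇒≱ (*-mono-< b<a b<a) h

cube-≤ : ∀ {a b} → a ≤ b → a * a * a ≤ b * b * b
cube-≤ h = *-mono-≤ (*-mono-≤ h h) h

prime-near-root : ∀ M m → 1 ≤ M → 1 ≤ m → ∀ Q → ∃[ n₀ ] (∀ n → n₀ ≤ n →
  ∃[ q ] (Prime q × Q < q × m * (q * q) ≤ n × n * (M * M) ≤ m * (suc M * q * (suc M * q))))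
prime-near-root M m 1≤M 1≤m Q = from (prime-gap (suc M) (s≤s z≤n))
  where
  from : ∃[ X₀ ] (∀ x → X₀ ≤ x → ∃[ p ] (Prime p × x < p × p ≤ x + x ÷ suc M)) → ∃[ n₀ ] (∀ n → n₀ ≤ n →
    ∃[ q ] (Prime q × Q < q × m * (q * q) ≤ n × n * (M * M) ≤ m * (suc M * q * (suc M * q))))
  from (X₀ , gap) = m * (X * X) , λ n n₀≤n → at n n₀≤n (square-root (n ÷ m))
    where
    X : ℕ
    X = 2 * (X₀ + Q)
    at : ∀ n → m * (X * X) ≤ n → ∃[ s ] (s * s ≤ n ÷ m × n ÷ m < suc s * suc s) → ∃[ q ]
      (Prime q × Q < q × m * (q * q) ≤ n × n * (M * M) ≤ m * (suc M * q * (suc M * q)))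
    at n n₀≤n (s , s²≤ , <s²) = conclude (gap x (≤-trans (m≤m+n X₀ Q) X₀+Q≤x))
      where
      d x : ℕ
      d = s ÷ suc M
      x = s ∸ d
      x+d≡s : x + d ≡ s
      x+d≡s = m∸n+n≡m (÷≤ s (suc M))
      d-small : d * suc M ≤ s
      d-small = ÷-lower s (suc M)
      X≤s : X ≤ s
      X≤s = ≤-pred (≰⇒> λ s<X → <⇒≱ <s² (≤-trans (*-mono-≤ s<X s<X)
        (÷-greatest n 1≤m (≤-trans (≤-reflexive (*-comm (X * X) m)) n₀≤n))))
      X₀+Q≤x : X₀ + Q ≤ x
      X₀+Q≤x = halve (X₀ + Q) M d x s 1≤M d-small X≤s (≤-reflexive (sym x+d≡s))
        where
        halve : ∀ Y M d x s → 1 ≤ M → d * suc M ≤ s → 2 * Y ≤ s → s ≤ x + d → Y ≤ x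
        halve Y M d x s h1 h2 h3 h4 = lin/ 2 (d ⊛ h1 ⊹ h2 ⊹ h3 ⊹ 2 ⊛ h4) 0 (solve (Y ∷ M ∷ d ∷ x ∷ s ∷ []))
      conclude : ∃[ p ] (Prime p × x < p × p ≤ x + x ÷ suc M) → ∃[ q ]
        (Prime q × Q < q × m * (q * q) ≤ n × n * (M * M) ≤ m * (suc M * q * (suc M * q)))
      conclude (q , prime-q , x<q , q≤) = q , prime-q , ≤-<-trans (≤-trans (m≤n+m Q X₀) X₀+Q≤x) x<q
        , ≤-trans (*-monoʳ-≤ m (≤-trans (*-mono-≤ q≤s q≤s) s²≤)) (≤-trans (≤-reflexive (*-comm m (n ÷ m)))
          (÷-lower n m))
        , ≤-trans (*-monoˡ-≤ (M * M) n≤) (≤-trans (≤-reflexive (regroup m (suc s) M))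
          (*-monoʳ-≤ m (*-mono-≤ close close)))
        where
        q≤s : q ≤ s
        q≤s = ≤-trans q≤ (≤-trans (+-monoʳ-≤ x (÷-monoˡ (suc M) (m∸n≤m s d))) (≤-reflexive x+d≡s))
        n≤ : n ≤ m * (suc s * suc s)
        n≤ = ≤-trans (<⇒≤ (÷-upper n 1≤m)) (≤-trans (*-monoˡ-≤ m <s²)
          (≤-reflexive (*-comm (suc s * suc s) m)))
        regroup : ∀ m s M → m * (s * s) * (M * M) ≡ m * (M * s * (M * s))
        regroup = solve-∀
        close : M * suc s ≤ suc M * q
        close = arith M d x s q d-small (≤-reflexive (sym x+d≡s)) x<q
          where
          arith : ∀ M d x s q → d * suc M ≤ s → s ≤ x + d → suc x ≤ q → M * suc s ≤ suc M * q
          arith M d x s q h1 h2 h3 = lin (h1 ⊹ (1 + M) ⊛ h2 ⊹ (1 + M) ⊛ h3) 1 (solve (M ∷ d ∷ x ∷ s ∷ q ∷ []))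

private
  z-small : ∀ t n z c → 4 * (z * z) ≤ t * (n * n * n) + 2 * (n * z) → c * c * t + 2 * c ≤ n → c * z ≤ n * n
  z-small t n z c h n-large = ≮⇒≥ λ n²<cz → <⇒≱ n²<cz (≤-trans
    (vanishes (c * z) (arith t n z c h n-large (<⇒≤ n²<cz))) z≤n)
    where
    vanishes : ∀ T → 4 * (T * T) ≤ T * T → T ≤ 0
    vanishes T h = square-≤ {T} {0} (arith₀ (T * T) h)
      where
      arith₀ : ∀ u → 4 * u ≤ u → u ≤ 0
      arith₀ u h = lin/ 3 (h) 0 (solve (u ∷ []))
    arith : ∀ t n z c → 4 * (z * z) ≤ t * (n * n * n) + 2 * (n * z) → c * c * t + 2 * c ≤ n → n * n ≤ c * z →
      4 * (c * z * (c * z)) ≤ c * z * (c * z)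
    arith t n z c h1 h2 h3 = lin ((c * c) ⊛ h1 ⊹ (c * n * z) ⊛ h2 ⊹ (c * z + c * c * n * t) ⊛ h3) 0
      (solve (t ∷ n ∷ z ∷ c ∷ []))

  power-ratio : ∀ D n m q → let M = 12 * D in n * (M * M) ≤ m * (suc M * q * (suc M * q)) → 1 ≤ D →
    2 * D * (n * n * n) ≤ 2 * D * (m * m * m * (q * q * q * (q * q * q))) + n * n * n
  power-ratio D n m q h 1≤D = *-cancelˡ-≤ (suc (12 * D) ^ 6) {{m^n≢0 (suc (12 * D)) 6}}
      (arith D (suc (12 * D) ^ 6) ((12 * D) ^ 6) (n * n * n) (m * m * m * (q * q * q * (q * q * q))) drop
        cubes)
    where
    M = 12 * D
    drop : 2 * D * suc M ^ 6 ≤ 2 * D * M ^ 6 + suc M ^ 6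
    drop = *-cancelˡ-≤ (suc M) (go M D (suc M ^ 6) (M ^ 6) (bernoulli-upper M 6) (≤-reflexive refl))
      where
      go : ∀ M D B A → suc M * B ≤ A * suc M + 6 * B → 12 * D ≤ M → suc M * (2 * D * B) ≤ suc M *
        (2 * D * A + B)
      go M D B A h1 h2 = lin ((2 * D) ⊛ h1 ⊹ B ⊛ h2) B (solve (M ∷ D ∷ B ∷ A ∷ []))
    cubes : n * n * n * M ^ 6 ≤ m * m * m * (q * q * q * (q * q * q)) * suc M ^ 6
    cubes = ≤-trans (≤-reflexive (left n M)) (≤-trans (cube-≤ h) (≤-reflexive (right m (suc M) q)))
      where
      left : ∀ n M → n * n * n * (M * (M * (M * (M * (M * (M * 1)))))) ≡ n * (M * M) * (n * (M * M)) *
        (n * (M * M))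
      left = solve-∀
      right : ∀ m M q → m * (M * q * (M * q)) * (m * (M * q * (M * q))) * (m * (M * q * (M * q))) ≡ m * m * m
        * (q * q * q * (q * q * q)) * (M * (M * (M * (M * (M * (M * 1))))))
      right = solve-∀
    arith : ∀ D B A n³ Q → 2 * D * B ≤ 2 * D * A + B → n³ * A ≤ Q * B → B * (2 * D * n³) ≤ B *
      (2 * D * Q + n³)
    arith D B A n³ Q h1 h2 = lin (n³ ⊛ h1 ⊹ (2 * D) ⊛ h2) 0 (solve (D ∷ B ∷ A ∷ n³ ∷ Q ∷ []))

  compare : ∀ t p d n q z e → suc (p * p * (t * (t + 2))) ≤ d * d * ((t + 1) * (t + 1)) →
    4 * (z * z) ≤ t * (n * n * n) + 2 * (n * z) → 4 * (t + 2) * (p * p) * z ≤ n * n →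
    (t + 2) * (t + 2) * (q * q * q) ≤ 2 * e + (t + 2) * (q * q * q) →
    let D = d * d * ((t + 1) * (t + 1)) in 2 * D * (n * n * n) ≤ 2 * D *
          ((t + 2) * (t + 2) * (t + 2) * (q * q * q * (q * q * q))) + n * n * n →
    p * z ≤ d * e
  compare t p d n q z e h1 h2 h3 h4 h5 = square-≤ (*-cancelˡ-≤ (8 * (t + 2))
    {{>-nonZero (*-mono-≤ {1} {8} (s≤s z≤n) (≤-trans (s≤s z≤n) (m≤n+m 2 t)))}}
      (≤-trans upper (≤-trans middle lower)))
    where
    m D n³ q⁶ : ℕ
    m = t + 2
    D = d * d * ((t + 1) * (t + 1))
    n³ = n * n * n
    q⁶ = q * q * q * (q * q * q)
    upper : 8 * m * (p * z * (p * z)) ≤ 2 * (p * p * (t * m)) * n³ + n³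
    upper = go t p n z h2 h3
      where
      go : ∀ t p n z → 4 * (z * z) ≤ t * (n * n * n) + 2 * (n * z) → 4 * (t + 2) * (p * p) * z ≤ n * n → 8 *
        (t + 2) * (p * z * (p * z)) ≤ 2 * (p * p * (t * (t + 2))) * (n * n * n) + n * n * n
      go t p n z h2 h3 = lin ((4 * p * p + 2 * p * p * t) ⊛ h2 ⊹ n ⊛ h3) 0 (solve (t ∷ p ∷ n ∷ z ∷ []))
    middle : 2 * (p * p * (t * m)) * n³ + n³ ≤ 2 * D * (m * m * m * q⁶)
    middle = go (p * p * (t * m)) D n³ (m * m * m * q⁶) h1 h5
      where
      go : ∀ a D n³ Q → suc a ≤ D → 2 * D * n³ ≤ 2 * D * Q + n³ → 2 * a * n³ + n³ ≤ 2 * D * Q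
      go a D n³ Q h h' = lin ((2 * n³) ⊛ h ⊹ h') 0 (solve (a ∷ D ∷ n³ ∷ Q ∷ []))
    many-edges : m * (t + 1) * (q * q * q) ≤ 2 * e
    many-edges = go t e (q * q * q) h4
      where
      go : ∀ t e c → (t + 2) * (t + 2) * c ≤ 2 * e + (t + 2) * c → (t + 2) * (t + 1) * c ≤ 2 * e
      go t e c h = lin (h) 0 (solve (t ∷ e ∷ c ∷ []))
    lower : 2 * D * (m * m * m * q⁶) ≤ 8 * m * (d * e * (d * e))
    lower = ≤-trans (≤-reflexive (left m d (t + 1) (q * q * q))) (≤-trans
      (*-monoʳ-≤ (2 * m * (d * d)) (*-mono-≤ many-edges many-edges)) (≤-reflexive (right m d e)))
      where
      left : ∀ m d s c → 2 * (d * d * (s * s)) * (m * m * m * (c * c)) ≡ 2 * m * (d * d) *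
        (m * s * c * (m * s * c))
      left = solve-∀
      right : ∀ m d e → 2 * m * (d * d) * (2 * e * (2 * e)) ≡ 8 * m * (d * e * (d * e))
      right = solve-∀

theorem1p7 : (t : ℕ) → 1 ≤ t → (p d : ℕ) →
    p * p * (t * (t + 2)) < d * d * ((t + 1) * (t + 1)) →
    ∃[ N ] ((n : ℕ) → N ≤ n →
    p * z n (K2 (2 * t + 1)) ≤ d * ex n ((3 , C3) ∷ (2 + (2 * t + 1) , K2 (2 * t + 1)) ∷ []))
theorem1p7 t 1≤t p d ratio = subst (λ s → ∃[ N ]
  ((n : ℕ) → N ≤ n → p * z n (K2 s) ≤ d * ex n ((3 , C3) ∷ (2 + s , K2 s) ∷ [])))
    (+-comm 1 (2 * t)) (from (prime-near-root (12 * D) (t + 2) (*-mono-≤ {1} {12} (s≤s z≤n) 1≤D)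
      (≤-trans (s≤s z≤n) (m≤n+m 2 t)) (3 + (t + 2))))
  where
  D c : ℕ
  D = d * d * ((t + 1) * (t + 1))
  c = 4 * (t + 2) * (p * p)
  1≤D : 1 ≤ D
  1≤D = ≤-trans (s≤s z≤n) ratio
  from : ∃[ n₀ ] (∀ n → n₀ ≤ n → ∃[ q ] (Prime q × 3 + (t + 2) < q × (t + 2) * (q * q) ≤ n × n *
    (12 * D * (12 * D)) ≤ (t + 2) * (suc (12 * D) * q * (suc (12 * D) * q)))) →
    ∃[ N ] ((n : ℕ) → N ≤ n → p * z n (K2 (suc (2 * t))) ≤ d * ex n
      ((3 , C3) ∷ (2 + suc (2 * t) , K2 (suc (2 * t))) ∷ []))
  from (n₀ , primes) = n₀ + (c * c * t + 2 * c) , λ n N≤n → at n (≤-trans (m≤n+m _ n₀) N≤n)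
    (primes n (≤-trans (m≤m+n n₀ _) N≤n))
    where
    at : ∀ n → c * c * t + 2 * c ≤ n → ∃[ q ] (Prime q × 3 + (t + 2) < q × (t + 2) * (q * q) ≤ n × n *
      (12 * D * (12 * D)) ≤ (t + 2) * (suc (12 * D) * q * (suc (12 * D) * q))) →
      p * z n (K2 (suc (2 * t))) ≤ d * ex n ((3 , C3) ∷ (2 + suc (2 * t) , K2 (suc (2 * t))) ∷ [])
    at n n-large (q , prime-q , q-large , room , close) =
      compare t p d n q (z n (K2 (suc (2 * t)))) _ ratio (z-bound n t)
        (z-small t n (z n (K2 (suc (2 * t)))) c (z-bound n t) n-large)
        (ex-bound prime-q (≤-trans (s≤s (m≤m+n 3 (t + 2))) q-large) t 1≤t
          (≤-trans (m≤n+m (t + 2) 3) (<⇒≤ q-large)) n room)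
        (power-ratio D n (t + 2) q close 1≤D)
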